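{- There is a semi-streaming algorithm which, given any undirected graph $G$ with $n$ vertices and $m$ edges (presented as an edge stream) and a positive integer $k$, computes a DFS tree of $G$ such that, if $h$ denotes the height of the computed DFS tree and $k\le h$, the algorithm uses $\lceil h/k\rceil$ passes over the stream, $O(nk)$ space, and amortized $O(m+nk)$ time per pass.
   Context: Streaming model: the vertex set $V$, $|V|=n$, is known, and the $m$ edges are accessible only as a stream. One pass reads all edges once, one after another, in an arbitrary order. The algorithm may perform several passes, and between consecutive edges it may do computation using only its local storage. The space bound limits the size of the local storage at all times (measured in words, each able to hold a vertex identifier or an edge in $O(1)$ words). Amortized time per pass means the total time over all passes divided by the number of passes. DFS tree: a rooted spanning tree of a connected undirected graph is a DFS tree if and only if every non-tree edge is a back edge, i.e. one of its endpoints is an ancestor of the other in the tree. A graph may have many DFS trees of different heights; $h$ is the height of the particular (valid) DFS tree output by the algorithm, and it is not claimed that this height is minimum. Convention: $G$ is taken to be connected. A disconnected graph is handled by adding a dummy vertex $r$ adjacent to all vertices and computing a DFS tree rooted at $r$ of the augmented graph (each child subtree of $r$ is then a DFS tree of a connected component of the original graph). -}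

module Defs where

open import Data.Fin.Base using (Fin; zero; suc; toℕ)
open import Data.Fin.Properties using () renaming (_≟_ to _≟ᶠ_)
open import Data.List.Base using (List; []; _∷_; length; map; foldr; allFin)
open import Data.List.Membership.Propositional using (_∈_)
open import Data.List.Relation.Binary.Permutation.Homogeneous using (Permutation)
open import Data.List.Relation.Unary.All using (All)
open import Data.List.Relation.Unary.AllPairs using (AllPairs)
open import Data.Nat.Base using (ℕ; suc; pred; _+_; _∸_; _*_; _/_; _^_; _⊔_; _≤_; NonZero)
open import Data.Nat.Properties using (_≟_)
open import Data.Product.Base using (_×_; _,_; proj₁; proj₂; swap)
open import Data.Sum.Base using (_⊎_)
open import Relation.Binary.Construct.Closure.ReflexiveTransitive using (Star; fold)
open import Relation.Binary.PropositionalEquality.Core using (_≡_; _≢_)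
open import Relation.Nullary.Decidable.Core using (does)
open import Relation.Nullary.Negation.Core using (¬_)
open import Data.Bool.Base using (if_then_else_; _∧_)

Edge : ℕ → Set
Edge n = Fin n × Fin n

-- Edges are undirected: a pair stands for the set of its two components.
_≈ᵉ_ : ∀ {n} → Edge n → Edge n → Set
e ≈ᵉ f = e ≡ f ⊎ e ≡ swap f

-- A finite simple graph with vertex set Fin n.
record Graph (n : ℕ) : Set where
  field
    edges    : List (Edge n)
    loopless : All (λ e → proj₁ e ≢ proj₂ e) edges
    simple   : AllPairs (λ e f → ¬ (e ≈ᵉ f)) edges

  size : ℕ
  size = length edges

  Adj : Fin n → Fin n → Set
  Adj u v = (u , v) ∈ edges ⊎ (v , u) ∈ edges

  Connected : Set
  Connected = ∀ u v → Star Adj u v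

-- What a pass may read: every edge exactly once, in any order and with its
-- endpoints in either order.
EdgeOrder : ∀ {n} → Graph n → List (Edge n) → Set
EdgeOrder G es = Permutation _≈ᵉ_ es (Graph.edges G)

-- A rooted tree on the whole of Fin n, given by parent pointers.
record RootedTree (n : ℕ) : Set where
  field
    root       : Fin n
    parent     : Fin n → Fin n
    parentRoot : parent root ≡ root

  -- v ↑ p : p is the parent of v.  The self-loop at the root, a mere
  -- encoding convention, is excluded.
  _↑_ : Fin n → Fin n → Set
  v ↑ p = v ≢ root × parent v ≡ p

  field
    rooted : ∀ v → Star _↑_ v root

  Ancestor : Fin n → Fin n → Set
  Ancestor a v = Star _↑_ v a

  TreeEdge : Fin n → Fin n → Set
  TreeEdge u v = u ↑ v ⊎ v ↑ u

  depth : Fin n → ℕ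
  depth v = fold (λ _ _ → ℕ) (λ _ → suc) 0 (rooted v)

  -- The number of edges on a longest path from the root down to a vertex.
  height : ℕ
  height = foldr _⊔_ 0 (map depth (allFin n))

record IsDFSTree {n : ℕ} (G : Graph n) (T : RootedTree n) : Set where
  open Graph G
  open RootedTree T
  field
    spanning  : ∀ {u v} → TreeEdge u v → Adj u v
    backEdges : ∀ {u v} → Adj u v → ¬ TreeEdge u v → Ancestor u v ⊎ Ancestor v u

-- ⌈ h / k ⌉, as k ≥ 1
ceilDiv : (h k : ℕ) .{{_ : NonZero k}} → ℕ
ceilDiv h k = (h + pred k) / k

-- Multi-pass streaming algorithms: programs of a random access machine whose
-- only storage is a fixed number a of arrays of words (a scalar variable is
-- cell 0 of an array).

data Op : Set where
  add sub mul : Op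

⟦_⟧ᵒ : Op → ℕ → ℕ → ℕ
⟦ add ⟧ᵒ = _+_
⟦ sub ⟧ᵒ = _∸_
⟦ mul ⟧ᵒ = _*_

infix 20 _[_]

data Expr (a : ℕ) : Set where
  lit  : ℕ → Expr a
  _[_] : Fin a → Expr a → Expr a
  op   : Op → Expr a → Expr a → Expr a

-- Passes cannot be nested: the code run on an edge has mode `local`.
data Mode : Set where
  streaming local : Mode

infix  10 _[_]≔_
infixr  5 _⨾_

data Cmd (a : ℕ) : Mode → Set where
  skip   : ∀ {μ} → Cmd a μ
  _[_]≔_ : ∀ {μ} → Fin a → Expr a → Expr a → Cmd a μ
  _⨾_    : ∀ {μ} → Cmd a μ → Cmd a μ → Cmd a μ
  cond   : ∀ {μ} → Expr a → Cmd a μ → Cmd a μ → Cmd a μ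
  while  : ∀ {μ} → Expr a → Cmd a μ → Cmd a μ
  -- pass x y c reads the stream once; for each edge in turn it puts the
  -- endpoints into x [ 0 ] and y [ 0 ] and runs c.
  pass   : Fin a → Fin a → Cmd a local → Cmd a streaming

Store : ℕ → Set
Store a = Fin a → ℕ → ℕ

-- A store together with the resources consumed since the start of the run.
record State (a : ℕ) : Set where
  constructor state
  field
    store  : Store a
    passes : ℕ  -- passes begun
    time   : ℕ  -- elementary steps
    extent : ℕ  -- all cells accessed so far have index < extent
    word   : ℕ  -- largest value stored so far

  -- Each of the a arrays occupies at most `extent` words at any time so far.
  space : ℕ
  space = a * extent

open State

⟦_⟧ : ∀ {a} → Expr a → Store a → ℕ
⟦ lit c ⟧    σ = c
⟦ x [ e ] ⟧  σ = σ x (⟦ e ⟧ σ)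
⟦ op o e f ⟧ σ = ⟦ o ⟧ᵒ (⟦ e ⟧ σ) (⟦ f ⟧ σ)

steps : ∀ {a} → Expr a → ℕ
steps (lit c)    = 1
steps (x [ e ])  = suc (steps e)
steps (op o e f) = suc (steps e + steps f)

reach : ∀ {a} → Expr a → Store a → ℕ
reach (lit c)    σ = 0
reach (x [ e ])  σ = reach e σ ⊔ suc (⟦ e ⟧ σ)
reach (op o e f) σ = reach e σ ⊔ reach f σ

charge : ∀ {a} → Expr a → State a → State a
charge e (state σ p t x w) = state σ p (t + steps e) (x ⊔ reach e σ) w

_[_,_↦_] : ∀ {a} → Store a → Fin a → ℕ → ℕ → Store a
(σ [ x , i ↦ v ]) y j = if does (x ≟ᶠ y) ∧ does (i ≟ j) then v else σ y j

write : ∀ {a} → Fin a → ℕ → ℕ → State a → State a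
write y i v (state σ p t x w) =
  state (σ [ y , i ↦ v ]) p (suc t) (x ⊔ suc i) (w ⊔ v)

beginPass : ∀ {a} → State a → State a
beginPass (state σ p t x w) = state σ (suc p) (suc t) x w

-- Big-step semantics; streams i is what pass number i reads.  The language is
-- deterministic, so a derivation of c , s ⇓ s′ says that the run of c from s
-- terminates and that s′ is its outcome.
module Execution {n : ℕ} (streams : ℕ → List (Edge n)) where

  infix 4 _,_⇓_

  mutual
    data _,_⇓_ {a : ℕ} : ∀ {μ} → Cmd a μ → State a → State a → Set where
      skip⇓ : ∀ {μ s} → skip {μ = μ} , s ⇓ s
      assign⇓ : ∀ {μ x e f s} →
        _[_]≔_ {μ = μ} x e f , s ⇓
          write x (⟦ e ⟧ (store s)) (⟦ f ⟧ (store s)) (charge f (charge e s))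
      seq⇓ : ∀ {μ} {c d : Cmd a μ} {s s′ s″} →
        c , s ⇓ s′ → d , s′ ⇓ s″ → c ⨾ d , s ⇓ s″
      condTrue⇓ : ∀ {μ e} {c d : Cmd a μ} {s s′} →
        ⟦ e ⟧ (store s) ≢ 0 → c , charge e s ⇓ s′ → cond e c d , s ⇓ s′
      condFalse⇓ : ∀ {μ e} {c d : Cmd a μ} {s s′} →
        ⟦ e ⟧ (store s) ≡ 0 → d , charge e s ⇓ s′ → cond e c d , s ⇓ s′
      whileTrue⇓ : ∀ {μ e} {c : Cmd a μ} {s s′ s″} →
        ⟦ e ⟧ (store s) ≢ 0 → c , charge e s ⇓ s′ → while e c , s′ ⇓ s″ →
        while e c , s ⇓ s″
      whileFalse⇓ : ∀ {μ e} {c : Cmd a μ} {s} →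
        ⟦ e ⟧ (store s) ≡ 0 → while e c , s ⇓ charge e s
      pass⇓ : ∀ {x y c s s′} →
        ForEach x y c (streams (passes s)) (beginPass s) s′ →
        pass x y c , s ⇓ s′

    data ForEach {a : ℕ} (x y : Fin a) (c : Cmd a local) :
                 List (Edge n) → State a → State a → Set where
      done : ∀ {s} → ForEach x y c [] s s
      read : ∀ {u v es s s′ s″} →
        c , write y 0 (toℕ v) (write x 0 (toℕ u) s) ⇓ s′ →
        ForEach x y c es s′ s″ →
        ForEach x y c ((u , v) ∷ es) s s″

-- A streaming algorithm: array 0 initially holds the input n, k; array 1
-- finally holds the output.  The storage is otherwise initially zero.
record Algorithm : Set where
  field
    extraArrays : ℕ

  arrays : ℕ
  arrays = 2 + extraArrays

  field
    program : Cmd arrays streaming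

  initial : (n k : ℕ) → State arrays
  initial n k = state
    (((λ _ _ → 0) [ zero , 0 ↦ n ]) [ zero , 1 ↦ k ]) 0 0 2 (n ⊔ k)

  Run : ∀ {n} → ℕ → (ℕ → List (Edge n)) → State arrays → Set
  Run {n} k streams s = program , initial n k ⇓ s
    where open Execution streams

  Outputs : ∀ {n} → State arrays → RootedTree n → Set
  Outputs s T = ∀ v → store s (suc zero) (toℕ v) ≡ toℕ (RootedTree.parent T v)

-- The resource bounds, with c the constant hidden in all the O(·), for an
-- input with n vertices, m edges and parameter k when the output has height h.
-- A word has O(log n) bits, so it holds values polynomial in n; as expressions
-- of a fixed program have bounded size, it is enough to ask this of the stored
-- values.  Total time at most passes × B is amortized time at most B per pass.
record Bounds {a : ℕ} (c n m k h : ℕ) .{{_ : NonZero k}} (s : State a) : Set where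
  field
    passBound  : passes s ≡ ceilDiv h k
    spaceBound : space s ≤ c * (n * k)
    wordBound  : word s ≤ n ^ c
    timeBound  : time s ≤ passes s * (c * (m + n * k))

{-# OPTIONS --safe #-}
-- The top D levels of a DFS tree are final after D / k passes; a vertex below
-- them is only known to lie in the subtree of its ancestor on level D.  One
-- pass fixes the next k levels.  It keeps O(nk) edges H of the graph induced
-- on the levels ≥ D such that for every set S of at most k vertices, H - S and
-- the graph read so far minus S have the same components.  A depth-first
-- search tree of H is then correct on its first k levels: if an edge of the
-- graph were to join two branches that part at a vertex w above level D + k,
-- the at most k tree vertices from level D to w would separate its endpoints
-- in H but not in the graph.
--
-- Such an H is maintained by collecting 4n(k+1) arcs and then discarding half
-- of them by maximum adjacency search (Nagamochi and Ibaraki), which takes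
-- O(nk) time and is paid for by the arcs read since the last such step.  After
-- i passes some vertex lies below level (i-1)k, whence ⌈h/k⌉ passes in total.

module Submission where

open import Defs
open import Data.Bool.Base using (Bool; true; false; T; _∧_; if_then_else_)
open import Data.Bool.Properties using (T-∧)
open import Data.Fin.Base using (Fin; toℕ; fromℕ<; zero; suc)
open import Data.Fin.Patterns using (0F; 1F; 2F; 3F; 4F; 5F; 6F; 7F; 8F; 9F)
open import Data.Fin.Properties using (toℕ<n; toℕ-injective; toℕ-fromℕ<; injective⇒≤) renaming (_≟_ to _≟ᶠ_)
open import Data.List.Base using (List; []; _∷_; length; map; allFin)
open import Data.List.Membership.Propositional using (_∈_; _∉_)
open import Data.List.Membership.Propositional.Properties using (∈-map⁺; ∈-allFin)
open import Data.List.Properties using (foldr-forcesᵇ; foldr-preservesᵇ)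
open import Data.List.Relation.Binary.Permutation.Setoid using (↭-sym)
open import Data.List.Relation.Binary.Permutation.Setoid.Properties using (∈-resp-↭; xs↭ys⇒|xs|≡|ys|)
open import Data.List.Relation.Unary.All using ([]; _∷_; lookup; universal) renaming (tabulate to tabulateAll; map to mapAll)
open import Data.List.Relation.Unary.All.Properties using (map⁺)
open import Data.List.Relation.Unary.AllPairs using (AllPairs; []; _∷_)
open import Data.List.Relation.Unary.Any using (Any; here; there) renaming (map to mapAny)
open import Data.Nat.Base hiding (less)
open import Data.Nat.Divisibility using (n∣m*n)
open import Data.Nat.DivMod using (+-distrib-/-∣ˡ; m*n/n≡m; m<n⇒m/n≡0)
open import Data.Nat.Properties
open import Data.List.Membership.DecPropositional _≟_ using (_∈?_)
open import Data.Nat.Solver using (module +-*-Solver)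
open import Data.Product.Base using (Σ-syntax; ∃-syntax; _×_; _,_; proj₁; proj₂)
open import Data.Sum.Base using (_⊎_; inj₁; inj₂) renaming (map to map⊎; swap to swap⊎)
open import Data.Unit.Base using (⊤; tt)
open import Function.Base using (_∘_)
open import Function.Bundles using (Equivalence)
open import Relation.Binary.Bundles using (Setoid)
open import Relation.Binary.Construct.Closure.ReflexiveTransitive using (Star; ε; _◅_; _◅◅_; fold; gmap) renaming (map to mapStar; reverse to reverseStar)
open import Relation.Binary.PropositionalEquality hiding ([_])
open import Relation.Nullary.Decidable using (Dec; does; dec-true; dec-false; yes; no)
open import Relation.Nullary.Negation using (contradiction; ¬_)

-- A Hoare logic for the streaming machine

-- The size of H comes from a cap on priorities: an unscanned vertex with k + 1 kept edges to
-- scanned vertices stays joined to the vertex being scanned whichever k other vertices are removed,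
-- so a further edge between the two is redundant, and at most n(k+1) edges survive. Preservation is
-- stated for each removed set S separately and not as a connectivity number. An edge can then be
-- replaced by a path that avoids the same S, so the many compressions within one pass compose. The
-- price is that S may contain the vertex being scanned, and this case needs an invariant of its
-- own. Positions found below the k new levels are provisional, but they still tell which vertices
-- hang together from a fixed vertex, and the next pass asks for no more. The search itself notices
-- whether it went below those levels, so no pass is spent on finding out that the tree is complete.

bounded : ∀ {a} → Expr a → Bool
bounded (lit c)      = c ≤ᵇ 4
bounded (x [ e ])    = true
bounded (op sub e f) = bounded e
bounded (op _ e f)   = false

-- Only values in index position extend the accessed range. The expression as a whole may exceed the
-- word bound, as `full` or a sum in a guard may, as long as its value is not stored.
simple : ∀ {a} → Expr a → Bool
simple (lit c)    = true
simple (x [ e ])  = bounded e ∧ simple e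
simple (op o e f) = simple e ∧ simple f

straight : ∀ {a μ} → Cmd a μ → Bool
straight skip          = true
straight (x [ e ]≔ f)  = bounded e ∧ (simple e ∧ simple f)
straight (c ⨾ d)       = straight c ∧ straight d
straight _             = false

exec : ∀ {a μ} → Cmd a μ → Store a → Store a
exec (x [ e ]≔ f) σ = σ [ x , ⟦ e ⟧ σ ↦ ⟦ f ⟧ σ ]
exec (c ⨾ d)      σ = exec d (exec c σ)
exec _            σ = σ

cost : ∀ {a μ} → Cmd a μ → ℕ
cost (x [ e ]≔ f) = steps e + steps f + 1
cost (c ⨾ d)      = cost c + cost d
cost _            = 0

∧-split : ∀ {x y} → T (x ∧ y) → T x × T y
∧-split = Equivalence.to T-∧

module Logic {n : ℕ} (streams : ℕ → List (Edge n)) (W : ℕ) (4≤W : 4 ≤ W) {a : ℕ} where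
  open Execution streams

  Cells≤ : Store a → Set
  Cells≤ σ = ∀ x i → σ x i ≤ W

  record Fits (s : State a) : Set where
    constructor fits
    field
      word≤   : State.word s ≤ W
      extent≤ : State.extent s ≤ suc W
      cells≤  : Cells≤ (State.store s)

  record Outcome {μ} (c : Cmd a μ) (s : State a) (p t : ℕ) (Q : Store a → Set) : Set where
    constructor outcome
    field
      {final} : State a
      run     : c , s ⇓ final
      fit     : Fits final
      passes≡ : State.passes final ≡ p + State.passes s
      time≤   : State.time final ≤ State.time s + t
      post    : Q (State.store final)

  -- The initial store is fixed while the counters are arbitrary, so a proof is a symbolic
  -- execution. Passes are counted exactly because the theorem asserts an equality for them; time is
  -- only bounded.
  Triple : ∀ {μ} → Cmd a μ → Store a → (p t : ℕ) → (Store a → Set) → Set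
  Triple c σ p t Q = ∀ {q u x w} → Fits (state σ q u x w) → Outcome c (state σ q u x w) p t Q

  bounded-value : ∀ {σ} e → T (bounded e) → Cells≤ σ → ⟦ e ⟧ σ ≤ W
  bounded-value (lit c) b cells = ≤-trans (≤ᵇ⇒≤ c 4 b) 4≤W
  bounded-value {σ} (x [ e ]) b cells = cells x (⟦ e ⟧ σ)
  bounded-value {σ} (op sub e f) b cells =
    ≤-trans (m∸n≤m (⟦ e ⟧ σ) (⟦ f ⟧ σ)) (bounded-value e b cells)

  simple-reach : ∀ {σ} e → T (simple e) → Cells≤ σ → reach e σ ≤ suc W
  simple-reach (lit c) b cells = z≤n
  simple-reach (x [ e ]) b cells with ∧-split {bounded e} b
  ... | b₁ , b₂ = ⊔-lub (simple-reach e b₂ cells) (s≤s (bounded-value e b₁ cells))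
  simple-reach (op o e f) b cells with ∧-split {simple e} b
  ... | b₁ , b₂ = ⊔-lub (simple-reach e b₁ cells) (simple-reach f b₂ cells)

  charge-fits : ∀ {s} e → T (simple e) → Fits s → Fits (charge e s)
  charge-fits e b (fits w x c) = fits w (⊔-lub x (simple-reach e b c)) c

  update-cells : ∀ {σ} x i {v} → v ≤ W → Cells≤ σ → Cells≤ (σ [ x , i ↦ v ])
  update-cells x i v≤ cells y j with does (x ≟ᶠ y) ∧ does (i ≟ j)
  ... | true  = v≤
  ... | false = cells y j

  write-fits : ∀ {s} x i {v} → i ≤ W → v ≤ W → Fits s → Fits (write x i v s)
  write-fits x i i≤ v≤ (fits w e c) =
    fits (⊔-lub w v≤) (⊔-lub e (s≤s i≤)) (update-cells x i v≤ c)

  -- On concrete code this reduces to a product with a real obligation only where the assigned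
  -- expression is not `bounded` by its shape, essentially where a counter grows; the other
  -- components are filled by `tt`.
  Values≤ : ∀ {μ} → Cmd a μ → Store a → Set
  Values≤ (x [ e ]≔ f) σ = if bounded f then ⊤ else ⟦ f ⟧ σ ≤ W
  Values≤ (c ⨾ d)      σ = Values≤ c σ × Values≤ d (exec c σ)
  Values≤ _            σ = ⊤

  value≤ : ∀ {σ} f → (if bounded f then ⊤ else ⟦ f ⟧ σ ≤ W) → Cells≤ σ → ⟦ f ⟧ σ ≤ W
  value≤ f v cells with bounded f in eq
  ... | true  = bounded-value f (subst T (sym eq) tt) cells
  ... | false = v

  run-straight : ∀ {μ} (c : Cmd a μ) {σ} → T (straight c) → Values≤ c σ →
                 Triple c σ 0 (cost c) (_≡ exec c σ)
  run-straight skip b v f = outcome skip⇓ f refl (m≤m+n _ _) refl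
  run-straight (x [ e ]≔ g) {σ} b v {u = u} f@(fits _ _ cells) with ∧-split {bounded e} b
  ... | b₁ , b′ with ∧-split {simple e} b′
  ... | b₂ , b₃ = outcome assign⇓
    (write-fits x (⟦ e ⟧ σ) (bounded-value e b₁ cells) (value≤ g v cells)
      (charge-fits g b₃ (charge-fits e b₂ f)))
    refl
    (≤-reflexive (trans (+-comm 1 (u + steps e + steps g))
      (trans (cong (_+ 1) (+-assoc u (steps e) (steps g)))
             (+-assoc u (steps e + steps g) 1))))
    refl
  run-straight (c ⨾ d) b (v₁ , v₂) {u = u} f with ∧-split {straight c} b
  ... | b₁ , b₂ with run-straight c b₁ v₁ f
  ... | outcome r₁ f₁ p₁ t₁ refl with run-straight d b₂ v₂ f₁
  ... | outcome r₂ f₂ p₂ t₂ refl = outcome (seq⇓ r₁ r₂) f₂ (trans p₂ p₁)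
    (≤-trans t₂ (≤-trans (+-monoˡ-≤ (cost d) t₁) (≤-reflexive (+-assoc u (cost c) (cost d)))))
    refl

  slower : ∀ {μ} {c : Cmd a μ} {σ p t t′ Q} → t ≤ t′ → Triple c σ p t Q → Triple c σ p t′ Q
  slower t≤ tr {u = u} f with tr f
  ... | outcome r f′ p≡ t′ q = outcome r f′ p≡ (≤-trans t′ (+-monoʳ-≤ u t≤)) q

  weaken : ∀ {μ} {c : Cmd a μ} {σ p t} {Q R : Store a → Set} → (∀ {σ′} → Q σ′ → R σ′) →
           Triple c σ p t Q → Triple c σ p t R
  weaken h tr f with tr f
  ... | outcome r f′ p≡ t′ q = outcome r f′ p≡ t′ (h q)

  block : ∀ {μ} {c : Cmd a μ} {σ Q} {_ : T (straight c)} → Values≤ c σ → Q (exec c σ) →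
          Triple c σ 0 (cost c) Q
  block {c = c} {_} {Q} {b} v q = weaken {c = c} (λ { refl → q }) (run-straight c b v)

  infixr 4 _thenₜ_
  _thenₜ_ : ∀ {μ} {c d : Cmd a μ} {σ p p′ t t′ Q R} → Triple c σ p t R →
            (∀ {σ′} → R σ′ → Triple d σ′ p′ t′ Q) → Triple (c ⨾ d) σ (p′ + p) (t + t′) Q
  _thenₜ_ {p = p} {p′} {t} {t′} tr k {q = q} {u} f with tr f
  ... | outcome r₁ f₁ p₁ t₁ q₁ with k q₁ f₁
  ... | outcome r₂ f₂ p₂ t₂ q₂ = outcome (seq⇓ r₁ r₂) f₂
    (trans p₂ (trans (cong (p′ +_) p₁) (sym (+-assoc p′ p q))))
    (≤-trans t₂ (≤-trans (+-monoˡ-≤ t′ t₁) (≤-reflexive (+-assoc u t t′))))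
    q₂

  blockThen : ∀ {μ} {c d : Cmd a μ} {σ p t Q} {_ : T (straight c)} → Values≤ c σ →
              Triple d (exec c σ) p t Q → Triple (c ⨾ d) σ p (cost c + t) Q
  blockThen {c = c} {d} {σ} {p} {t} {Q} {b} v tr {q} {u} {x} {w} f with run-straight c b v f
  ... | outcome r₁ f₁ p₁ t₁ refl with tr f₁
  ... | outcome r₂ f₂ p₂ t₂ q₂ = outcome (seq⇓ r₁ r₂) f₂
    (trans p₂ (cong (p +_) p₁))
    (≤-trans t₂ (≤-trans (+-monoˡ-≤ t t₁) (≤-reflexive (+-assoc u (cost c) t))))
    q₂

  ifTrue : ∀ {μ e} {c d : Cmd a μ} {σ p t Q} {_ : T (simple e)} → ⟦ e ⟧ σ ≢ 0 →
           Triple c σ p t Q → Triple (cond e c d) σ p (steps e + t) Q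
  ifTrue {e = e} {t = t} {Q} {b} ne tr {q} {u} f with tr (charge-fits e b f)
  ... | outcome r f′ p≡ t′ q′ = outcome (condTrue⇓ ne r) f′ p≡
    (≤-trans t′ (≤-reflexive (+-assoc u (steps e) t))) q′

  ifFalse : ∀ {μ e} {c d : Cmd a μ} {σ p t Q} {_ : T (simple e)} → ⟦ e ⟧ σ ≡ 0 →
            Triple d σ p t Q → Triple (cond e c d) σ p (steps e + t) Q
  ifFalse {e = e} {t = t} {Q} {b} eq tr {q} {u} f with tr (charge-fits e b f)
  ... | outcome r f′ p≡ t′ q′ = outcome (condFalse⇓ eq r) f′ p≡
    (≤-trans t′ (≤-reflexive (+-assoc u (steps e) t))) q′

  Below : (ℕ → Store a → Set) → ℕ → Store a → Set
  Below I m σ = Σ[ m′ ∈ ℕ ] m′ < m × I m′ σ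

  module _ {μ} (e : Expr a) (c : Cmd a μ) (simpleGuard : T (simple e)) (B : ℕ)
           (I : ℕ → Store a → Set)
           (body : ∀ m σ → I m σ → ⟦ e ⟧ σ ≢ 0 →
                   Triple c σ 0 B (Below I m)) where

    private
      bound : ℕ → ℕ
      bound m = m * (steps e + B) + steps e

      arith : ∀ u m {m′} → m′ < m → u + steps e + B + bound m′ ≤ u + bound m
      arith u m {m′} lt = begin
        u + steps e + B + bound m′             ≡⟨ cong (_+ bound m′) (+-assoc u (steps e) B) ⟩
        u + (steps e + B) + bound m′           ≡⟨ +-assoc u (steps e + B) (bound m′) ⟩
        u + (steps e + B + (m′ * (steps e + B) + steps e))
          ≡⟨ cong (u +_) (+-assoc (steps e + B) (m′ * (steps e + B)) (steps e)) ⟨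
        u + (suc m′ * (steps e + B) + steps e)
          ≤⟨ +-monoʳ-≤ u (+-monoˡ-≤ (steps e) (*-monoˡ-≤ (steps e + B) lt)) ⟩
        u + bound m                            ∎
        where open ≤-Reasoning

      go : ∀ fuel m → m ≤ fuel → ∀ σ → I m σ →
           Triple (while e c) σ 0 (bound m) (λ σ′ → ⟦ e ⟧ σ′ ≡ 0 × ∃[ m′ ] I m′ σ′)
      go fuel m m≤ σ i {q} {u} f with ⟦ e ⟧ σ in eq
      ... | zero = outcome (whileFalse⇓ eq) (charge-fits e simpleGuard f) refl
        (+-monoʳ-≤ u (m≤n+m (steps e) (m * (steps e + B)))) (eq , m , i)
      ... | suc v with body m σ i (λ z → 0≢1+n (trans (sym z) eq)) (charge-fits e simpleGuard f)
      go zero m m≤ σ i f | suc v | outcome _ _ _ _ (m′ , lt , _) with () ← <-≤-trans lt m≤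
      go (suc fuel) m m≤ σ i {q} {u} f | suc v | outcome {s₁} r₁ f₁ p₁ t₁ (m′ , lt , i′)
        with go fuel m′ (≤-pred (≤-trans lt m≤)) (State.store s₁) i′ f₁
      ... | outcome r₂ f₂ p₂ t₂ q₂ = outcome
        (whileTrue⇓ (λ z → 0≢1+n (trans (sym z) eq)) r₁ r₂) f₂ (trans p₂ p₁)
        (≤-trans t₂ (≤-trans (+-monoˡ-≤ (bound m′) t₁) (arith u m lt))) q₂

    -- The index of `I` is the variant and the time budget in one: every iteration lowers it, so
    -- there are at most `m` of them, and the last `steps e` is the failing test.
    loop : ∀ {m σ} → I m σ →
           Triple (while e c) σ 0 (m * (steps e + B) + steps e)
             (λ σ′ → ⟦ e ⟧ σ′ ≡ 0 × ∃[ m′ ] I m′ σ′)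
    loop i = go _ _ ≤-refl _ i

  -- Amortised cost: φ is a potential, which the body may spend.
  module _ (x y : Fin a) (c : Cmd a local) (B : ℕ) (n≤W : n ≤ W)
           (I : List (Edge n) → ℕ → Store a → Set)
           (body : ∀ u v es φ σ → I ((u , v) ∷ es) φ σ →
                   ∃[ t ] Triple c ((σ [ x , 0 ↦ toℕ u ]) [ y , 0 ↦ toℕ v ]) 0 t
                     (λ σ′ → Σ[ φ′ ∈ ℕ ] t + φ′ ≤ B + φ × I es φ′ σ′)) where
    private
      record After (es : List (Edge n)) (s : State a) (φ : ℕ) : Set where
        constructor after
        field
          {final} : State a
          runs    : ForEach x y c es s final
          fit     : Fits final
          passes≡ : State.passes final ≡ State.passes s
          {rest}  : ℕ
          time≤   : State.time final + rest ≤ State.time s + (length es * (2 + B) + φ)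
          post    : I [] rest (State.store final)

      arith : ∀ u t {φ φ′} N → t + φ′ ≤ B + φ → suc (suc u) + t + (N + φ′) ≤ u + (2 + B + N + φ)
      arith u t {φ} {φ′} N le = begin
        suc (suc u) + t + (N + φ′)   ≡⟨ solve 4 (λ u t N φ′ → con 2 :+ u :+ t :+ (N :+ φ′) := u :+ (con 2 :+ N) :+ (t :+ φ′)) refl u t N φ′ ⟩
        u + (2 + N) + (t + φ′)       ≤⟨ +-monoʳ-≤ (u + (2 + N)) le ⟩
        u + (2 + N) + (B + φ)        ≡⟨ solve 4 (λ u N B φ → u :+ (con 2 :+ N) :+ (B :+ φ) := u :+ (con 2 :+ B :+ N :+ φ)) refl u N B φ ⟩
        u + (2 + B + N + φ)          ∎
        where open ≤-Reasoning
              open +-*-Solver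

      forAll : ∀ es {φ s} → Fits s → I es φ (State.store s) → After es s φ
      forAll [] {φ} {s} f i = after done f refl ≤-refl i
      forAll ((u , v) ∷ es) {φ} {s@(state σ p t₀ _ _)} f i with body u v es φ σ i
      ... | t , tr with tr (write-fits y 0 z≤n (≤-trans (<⇒≤ (toℕ<n v)) n≤W)
                             (write-fits x 0 z≤n (≤-trans (<⇒≤ (toℕ<n u)) n≤W) f))
      ... | outcome r f₁ p₁ t₁ (φ′ , le , i′) with forAll es f₁ i′
      ... | after rs f₂ p₂ {rest} t₂ i″ = after (read r rs) f₂ (trans p₂ p₁)
        (≤-trans t₂ (≤-trans (+-monoˡ-≤ _ t₁) (arith t₀ t {φ} {φ′} (length es * (2 + B)) le))) i″

    -- `2 + B` includes the two writes that deliver the endpoints. The invariant is demanded for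
    -- every `q` since a `Triple` leaves open how many passes have begun, hence which stream is
    -- read. Potential left at the end is forfeited.
    onePass : ∀ {σ φ} → (∀ q → I (streams q) φ σ) → ∀ {N} → (∀ q → length (streams q) ≡ N) →
              Triple (pass x y c) σ 1 (1 + (N * (2 + B) + φ)) (λ σ′ → ∃[ φ′ ] I [] φ′ σ′)
    onePass {σ} {φ} i {N} len {q} {u} f@(fits fw fe fc) with forAll (streams q) (fits fw fe fc) (i q)
    ... | after {s₁} rs f₁ p₁ {rest} t₁ i₁ = outcome (pass⇓ rs) f₁ p₁
      (begin
        State.time s₁                           ≤⟨ m≤m+n _ rest ⟩
        State.time s₁ + rest                    ≤⟨ t₁ ⟩
        suc u + (length (streams q) * (2 + B) + φ) ≡⟨ cong (λ l → suc u + (l * (2 + B) + φ)) (len q) ⟩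
        suc u + (N * (2 + B) + φ)               ≡⟨ +-suc u _ ⟨
        u + (1 + (N * (2 + B) + φ))             ∎)
      (rest , i₁)
      where open ≤-Reasoning

-- Arrays, linked lists and sums

-- For a concrete array name, a row of an updated store reduces to `upd` of the old row, so facts
-- about `upd` apply to executed code without conversion.
upd : ∀ {A : Set} → (ℕ → A) → ℕ → A → ℕ → A
upd f i v j = if does (i ≟ j) then v else f j

upd-≡ : ∀ {A : Set} (f : ℕ → A) {i v j} → i ≡ j → upd f i v j ≡ v
upd-≡ f {i} {v} {j} eq = cong (λ b → if b then v else f j) (dec-true (i ≟ j) eq)

upd-≢ : ∀ {A : Set} (f : ℕ → A) {i v j} → i ≢ j → upd f i v j ≡ f j
upd-≢ f {i} {v} {j} ne = cong (λ b → if b then v else f j) (dec-false (i ≟ j) ne)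

upd-view : ∀ {A : Set} (f : ℕ → A) i v j →
           (i ≡ j × upd f i v j ≡ v) ⊎ (i ≢ j × upd f i v j ≡ f j)
upd-view f i v j with i ≟ j
... | yes eq = inj₁ (eq , upd-≡ f eq)
... | no ne  = inj₂ (ne , upd-≢ f ne)

sumTo : ℕ → (ℕ → ℕ) → ℕ
sumTo zero    f = 0
sumTo (suc n) f = f n + sumTo n f

sumTo-mono : ∀ n {f g : ℕ → ℕ} → (∀ {i} → i < n → f i ≤ g i) → sumTo n f ≤ sumTo n g
sumTo-mono zero    le = z≤n
sumTo-mono (suc n) le = +-mono-≤ (le ≤-refl) (sumTo-mono n (le ∘ m<n⇒m<1+n))

sumTo-const : ∀ n {f : ℕ → ℕ} {c} → (∀ {i} → i < n → f i ≤ c) → sumTo n f ≤ n * c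
sumTo-const zero    le = z≤n
sumTo-const (suc n) le = +-mono-≤ (le ≤-refl) (sumTo-const n (le ∘ m<n⇒m<1+n))

-- The cross-added form avoids truncated subtraction.
sumTo-change : ∀ n (f g : ℕ → ℕ) {i} → i < n → (∀ {j} → i ≢ j → g j ≡ f j) →
               sumTo n g + f i ≡ sumTo n f + g i
sumTo-change (suc n) f g {i} i<n same with i ≟ n
... | yes refl = begin
  g n + sumTo n g + f n   ≡⟨ cong (λ z → g n + z + f n) (below n ≤-refl) ⟩
  g n + sumTo n f + f n   ≡⟨ +-comm (g n + sumTo n f) (f n) ⟩
  f n + (g n + sumTo n f) ≡⟨ cong (f n +_) (+-comm (g n) (sumTo n f)) ⟩
  f n + (sumTo n f + g n) ≡⟨ +-assoc (f n) (sumTo n f) (g n) ⟨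
  f n + sumTo n f + g n   ∎
  where
    open ≡-Reasoning
    below : ∀ m → m ≤ n → sumTo m g ≡ sumTo m f
    below zero    _ = refl
    below (suc m) m<n = cong₂ _+_ (same (λ { refl → <-irrefl refl m<n })) (below m (<⇒≤ m<n))
... | no ne = begin
  g n + sumTo n g + f i   ≡⟨ +-assoc (g n) (sumTo n g) (f i) ⟩
  g n + (sumTo n g + f i) ≡⟨ cong₂ _+_ (same ne) (sumTo-change n f g (≤∧≢⇒< (≤-pred i<n) ne) same) ⟩
  f n + (sumTo n f + g i) ≡⟨ +-assoc (f n) (sumTo n f) (g i) ⟨
  f n + sumTo n f + g i   ∎
  where open ≡-Reasoning

size : ℕ → (ℕ → List ℕ) → ℕ
size n ls = sumTo n (length ∘ ls)

private
  length-upd : ∀ (ls : ℕ → List ℕ) {i l j} → i ≢ j → length (upd ls i l j) ≡ length (ls j)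
  length-upd ls ne = cong length (upd-≢ ls ne)

size-upd : ∀ n (ls : ℕ → List ℕ) {i} l → i < n →
           size n (upd ls i l) + length (ls i) ≡ size n ls + length l
size-upd n ls {i} l i<n =
  trans (sumTo-change n (length ∘ ls) (length ∘ upd ls i l) i<n (length-upd ls))
        (cong (λ z → size n ls + length z) (upd-≡ ls {i} refl))

size-push : ∀ n (ls : ℕ → List ℕ) {i v} → i < n → size n (upd ls i (v ∷ ls i)) ≡ suc (size n ls)
size-push n ls {i} {v} i<n = +-cancelʳ-≡ (length (ls i)) _ _
  (trans (size-upd n ls (v ∷ ls i) i<n) (+-suc (size n ls) (length (ls i))))

size-pop : ∀ n (ls : ℕ → List ℕ) {i v l} → i < n → ls i ≡ v ∷ l → suc (size n (upd ls i l)) ≡ size n ls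
size-pop n ls {i} {v} {l} i<n eq = +-cancelʳ-≡ (length l) _ _
  (trans (sym (+-suc (size n (upd ls i l)) (length l)))
    (trans (cong (λ z → size n (upd ls i l) + length z) (sym eq)) (size-upd n ls l i<n)))

∈-upd⁻ : ∀ {ls : ℕ → List ℕ} {i l j y} → (∀ {z} → z ∈ l → z ∈ ls i) → y ∈ upd ls i l j → y ∈ ls j
∈-upd⁻ {ls} {i} {l} {j} incl m with upd-view ls i l j
... | inj₁ (refl , eq) rewrite eq = incl m
... | inj₂ (_ , eq)    rewrite eq = m

∈-push⁻ : ∀ {ls : ℕ → List ℕ} {i v j y} → y ∈ upd ls i (v ∷ ls i) j → (i ≡ j × y ≡ v) ⊎ y ∈ ls j
∈-push⁻ {ls} {i} {v} {j} m with upd-view ls i (v ∷ ls i) j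
... | inj₂ (_ , eq) rewrite eq = inj₂ m
... | inj₁ (refl , eq) rewrite eq with m
... | here e  = inj₁ (refl , e)
... | there m = inj₂ m

∈-push-new : ∀ {ls : ℕ → List ℕ} {i v} → v ∈ upd ls i (v ∷ ls i) i
∈-push-new {ls} {i} {v} rewrite upd-≡ ls {i} {v ∷ ls i} refl = here refl

∈-push-old : ∀ {ls : ℕ → List ℕ} {i v j y} → y ∈ ls j → y ∈ upd ls i (v ∷ ls i) j
∈-push-old {ls} {i} {v} {j} m with upd-view ls i (v ∷ ls i) j
... | inj₁ (refl , eq) rewrite eq = there m
... | inj₂ (_ , eq)    rewrite eq = m

∈-pop : ∀ {ls : ℕ → List ℕ} {i v l j y} → ls i ≡ v ∷ l → y ∈ ls j →
        (i ≡ j × y ≡ v) ⊎ y ∈ upd ls i l j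
∈-pop {ls} {i} {v} {l} {j} eq m with upd-view ls i l j
... | inj₂ (_ , e) rewrite e = inj₂ m
... | inj₁ (refl , e) rewrite e | eq with m
... | here e′ = inj₁ (refl , e′)
... | there m = inj₂ m

pop-⊆ : ∀ {ls : ℕ → List ℕ} {i v l j y} → ls i ≡ v ∷ l → y ∈ upd ls i l j → y ∈ ls j
pop-⊆ {ls} eq = ∈-upd⁻ {ls} (λ {z} m → subst (z ∈_) (sym eq) (there m))

pop-empty : ∀ {ls : ℕ → List ℕ} {i v l j} → ls i ≡ v ∷ l → ls j ≡ [] → upd ls i l j ≡ []
pop-empty {ls} {i} {v} {l} {j} eq e with upd-view ls i l j
... | inj₁ (refl , _) with () ← trans (sym eq) e
... | inj₂ (_ , e′)   = trans e′ e

-- A linked list threaded through the arrays vl (values) and nx (successors),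
-- with nodes 1 … c and null pointer 0.
data Chain (vl nx : ℕ → ℕ) (c : ℕ) : ℕ → List ℕ → Set where
  nil  : Chain vl nx c 0 []
  cons : ∀ {p l} → suc p ≤ c → Chain vl nx c (nx (suc p)) l → Chain vl nx c (suc p) (vl (suc p) ∷ l)

Linked : (hd vl nx : ℕ → ℕ) (c : ℕ) → (ℕ → List ℕ) → Set
Linked hd vl nx c ls = ∀ i → Chain vl nx c (hd i) (ls i)

-- A chain visits only nodes numbered up to `c`, and a push writes node `suc c`. This freshness
-- takes the place of an argument that different lists are disjoint.
chain-extend : ∀ {vl nx c v q p l} → Chain vl nx c p l →
               Chain (upd vl (suc c) v) (upd nx (suc c) q) (suc c) p l
chain-extend nil = nil
chain-extend {vl} {nx} {c} {v} {q} (cons {p} {l} p≤ ch) =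
  subst (λ z → Chain (upd vl (suc c) v) (upd nx (suc c) q) (suc c) (suc p) (z ∷ l)) (upd-≢ vl ne)
    (cons (m≤n⇒m≤1+n p≤)
      (subst (λ z → Chain (upd vl (suc c) v) (upd nx (suc c) q) (suc c) z l) (sym (upd-≢ nx ne))
        (chain-extend ch)))
  where
    ne : suc c ≢ suc p
    ne eq = <-irrefl refl (subst (_≤ c) (sym eq) p≤)

linked-push : ∀ {hd vl nx c ls} i v → Linked hd vl nx c ls →
              Linked (upd hd i (suc c)) (upd vl (suc c) v) (upd nx (suc c) (hd i)) (suc c)
                     (upd ls i (v ∷ ls i))
linked-push {hd} {vl} {nx} {c} {ls} i v lk j with upd-view hd i (suc c) j | upd-view ls i (v ∷ ls i) j
... | inj₁ (refl , e) | inj₁ (_ , e′) rewrite e | e′ =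
  subst (λ z → Chain (upd vl (suc c) v) (upd nx (suc c) (hd i)) (suc c) (suc c) (z ∷ ls i))
    (upd-≡ vl {suc c} refl)
    (cons ≤-refl (subst (λ z → Chain (upd vl (suc c) v) (upd nx (suc c) (hd i)) (suc c) z (ls i))
      (sym (upd-≡ nx {suc c} refl)) (chain-extend (lk i))))
... | inj₂ (_ , e)  | inj₂ (_ , e′) rewrite e | e′ = chain-extend (lk j)
... | inj₁ (eq , _) | inj₂ (ne , _) = contradiction eq ne
... | inj₂ (ne , _) | inj₁ (eq , _) = contradiction eq ne

linked-empty : ∀ {hd vl nx c ls} i → Linked hd vl nx c ls → hd i ≡ 0 → ls i ≡ []
linked-empty {hd} {ls = ls} i lk eq with hd i | ls i | lk i
... | _ | _ | nil = refl
... | _ | _ | cons _ _ with () ← eq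

linked-head : ∀ {hd vl nx c ls} i → Linked hd vl nx c ls → hd i ≢ 0 →
              ∃[ l ] ls i ≡ vl (hd i) ∷ l × Chain vl nx c (nx (hd i)) l
linked-head {hd} {ls = ls} i lk ne with hd i | ls i | lk i
... | _ | _ | nil = contradiction refl ne
... | _ | _ | cons _ ch = _ , refl , ch

linked-pop : ∀ {hd vl nx c ls} i → Linked hd vl nx c ls → hd i ≢ 0 →
             ∃[ l ] ls i ≡ vl (hd i) ∷ l × Linked (upd hd i (nx (hd i))) vl nx c (upd ls i l)
linked-pop {hd} {vl} {nx} {c} {ls} i lk ne with linked-head i lk ne
... | l , eq , ch = l , eq , λ j → popped j
  where
    popped : ∀ j → Chain vl nx c (upd hd i (nx (hd i)) j) (upd ls i l j)
    popped j with upd-view hd i (nx (hd i)) j | upd-view ls i l j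
    ... | inj₁ (refl , e) | inj₁ (_ , e′) rewrite e | e′ = ch
    ... | inj₂ (_ , e)  | inj₂ (_ , e′) rewrite e | e′ = lk j
    ... | inj₁ (eq , _) | inj₂ (ne , _) = contradiction eq ne
    ... | inj₂ (ne , _) | inj₁ (eq , _) = contradiction eq ne

linked-nonempty : ∀ {hd vl nx c ls} i → Linked hd vl nx c ls → ls i ≡ [] → hd i ≡ 0
linked-nonempty {hd} {ls = ls} i lk eq with hd i | ls i | lk i
... | _ | _ | nil = refl
... | _ | _ | cons _ _ with () ← eq

-- This is how nodes are reclaimed: popping frees nothing, but once all heads are null no chain
-- refers to a node and numbering may restart.
linked-reset : ∀ {hd vl nx c vl′ nx′ c′ ls} → Linked hd vl nx c ls → (∀ i → ls i ≡ []) → Linked hd vl′ nx′ c′ ls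
linked-reset {hd} lk empty i rewrite empty i | linked-nonempty i lk (empty i) = nil

pairs : (f g : ℕ → ℕ) → ℕ → List (ℕ × ℕ)
pairs f g zero    = []
pairs f g (suc c) = (f c , g c) ∷ pairs f g c

pairs-cong : ∀ {f g f′ g′ : ℕ → ℕ} c → (∀ {i} → i < c → f′ i ≡ f i) → (∀ {i} → i < c → g′ i ≡ g i) →
             pairs f′ g′ c ≡ pairs f g c
pairs-cong zero    e e′ = refl
pairs-cong (suc c) e e′ = cong₂ _∷_ (cong₂ _,_ (e ≤-refl) (e′ ≤-refl))
  (pairs-cong c (e ∘ m<n⇒m<1+n) (e′ ∘ m<n⇒m<1+n))

pairs-push : ∀ (f g : ℕ → ℕ) c {x y} → pairs (upd f c x) (upd g c y) (suc c) ≡ (x , y) ∷ pairs f g c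
pairs-push f g c = cong₂ _∷_ (cong₂ _,_ (upd-≡ f {c} refl) (upd-≡ g {c} refl))
  (pairs-cong c (λ lt → upd-≢ f (>⇒≢ lt)) (λ lt → upd-≢ g (>⇒≢ lt)))

length-pairs : ∀ f g c → length (pairs f g c) ≡ c
length-pairs f g zero    = refl
length-pairs f g (suc c) = cong suc (length-pairs f g c)

-- Entries occupy cells 1 to `c`, so the stack pointer is also their number and can serve as a loop
-- guard.
stack : (ℕ → ℕ) → ℕ → List ℕ
stack f zero    = []
stack f (suc c) = f (suc c) ∷ stack f c

stack-cong : ∀ {f g : ℕ → ℕ} c → (∀ {i} → i ≤ c → g i ≡ f i) → stack g c ≡ stack f c
stack-cong zero    e = refl
stack-cong (suc c) e = cong₂ _∷_ (e ≤-refl) (stack-cong c (e ∘ m≤n⇒m≤1+n))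

stack-push : ∀ (f : ℕ → ℕ) c {v} → stack (upd f (suc c) v) (suc c) ≡ v ∷ stack f c
stack-push f c = cong₂ _∷_ (upd-≡ f {suc c} refl)
  (stack-cong c (λ le → upd-≢ f {suc c} (λ { refl → <-irrefl refl le })))

-- Sparsification by maximum adjacency search

Conn : (ℕ → ℕ → Set) → List ℕ → ℕ → ℕ → Set
Conn R S = Star (λ x y → R x y × x ∉ S × y ∉ S)

-- Removed sets are lists; a repetition only wastes part of the allowance `k`, so every set of at
-- most `k` vertices is covered.
Inseparable : (ℕ → ℕ → Set) → ℕ → ℕ → ℕ → Set
Inseparable R k x y = ∀ S → length S ≤ k → x ∉ S → y ∉ S → Conn R S x y

conn-map : ∀ {R R′ : ℕ → ℕ → Set} {S x y} → (∀ {u v} → R u v → R′ u v) → Conn R S x y → Conn R′ S x y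
conn-map f = mapStar λ (r , s) → f r , s

conn-sym : ∀ {R : ℕ → ℕ → Set} {S x y} → (∀ {u v} → R u v → R v u) → Conn R S x y → Conn R S y x
conn-sym f = reverseStar λ (r , s , t) → f r , t , s

-- Each step of the path already avoids `S` and is replaced by a detour avoiding the same `S`. Hence
-- sparsifying an already sparsified graph loses nothing.
conn-bind : ∀ {R R′ : ℕ → ℕ → Set} {k S x y} → length S ≤ k →
            (∀ {u v} → R u v → Inseparable R′ k u v) → Conn R S x y → Conn R′ S x y
conn-bind len h ε = ε
conn-bind len h ((r , s , t) ◅ c) = h r _ len s t ◅◅ conn-bind len h c

Kept : List (ℕ × ℕ) → ℕ → ℕ → Set
Kept ks x y = (x , y) ∈ ks ⊎ (y , x) ∈ ks

kept-there : ∀ {e ks x y} → Kept ks x y → Kept (e ∷ ks) x y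
kept-there = map⊎ there there

bit : Bool → ℕ
bit b = if b then 1 else 0

aboveBit : ℕ → ℕ → ℕ
aboveBit b l = bit (does (b <? l))

aboveBit-yes : ∀ {b l} → b < l → aboveBit b l ≡ 1
aboveBit-yes {b} {l} lt = cong bit (dec-true (b <? l) lt)

aboveBit-no : ∀ {b l} → l ≤ b → aboveBit b l ≡ 0
aboveBit-no {b} {l} le = cong bit (dec-false (b <? l) (≤⇒≯ le))

aboveBit≤1 : ∀ b l → aboveBit b l ≤ 1
aboveBit≤1 b l with b <? l
... | yes lt = ≤-reflexive (aboveBit-yes lt)
... | no ¬lt = ≤-trans (≤-reflexive (aboveBit-no (≮⇒≥ ¬lt))) z≤n

aboveBit-mono : ∀ {b l l′} → (b < l → b < l′) → aboveBit b l ≤ aboveBit b l′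
aboveBit-mono {b} {l} {l′} f with b <? l
... | yes lt = ≤-trans (aboveBit≤1 b l) (≤-reflexive (sym (aboveBit-yes (f lt))))
... | no ¬lt = ≤-trans (≤-reflexive (aboveBit-no (≮⇒≥ ¬lt))) z≤n

-- Used with `b = top`, where it counts the removed vertices that are already scanned, the only ones
-- at which kept edges of an unscanned vertex can have been lost.
above : ℕ → (ℕ → ℕ) → List ℕ → ℕ
above b lev []      = 0
above b lev (v ∷ S) = aboveBit b (lev v) + above b lev S

above≤length : ∀ b lev S → above b lev S ≤ length S
above≤length b lev []      = z≤n
above≤length b lev (v ∷ S) = +-mono-≤ (aboveBit≤1 b (lev v)) (above≤length b lev S)

above-mono : ∀ {b lev lev′} S → (∀ v → b < lev v → b < lev′ v) → above b lev S ≤ above b lev′ S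
above-mono []      f = z≤n
above-mono (v ∷ S) f = +-mono-≤ (aboveBit-mono (f v)) (above-mono S f)

above-strict : ∀ {b lev lev′ y} S → (∀ v → b < lev v → b < lev′ v) → y ∈ S → lev y ≤ b → b < lev′ y →
               above b lev S < above b lev′ S
above-strict (v ∷ S) f (here refl) le lt
  rewrite aboveBit-no le | aboveBit-yes lt = s≤s (above-mono S f)
above-strict {b} {lev} {lev′} (v ∷ S) f (there y∈) le lt = begin
  suc (aboveBit b (lev v) + above b lev S) ≡⟨ +-suc (aboveBit b (lev v)) (above b lev S) ⟨
  aboveBit b (lev v) + suc (above b lev S) ≤⟨ +-mono-≤ (aboveBit-mono (f v)) (above-strict S f y∈ le lt) ⟩
  aboveBit b (lev′ v) + above b lev′ S     ∎
  where open ≤-Reasoning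

-- One for a vertex that the current scan has not yet raised. Raising it costs the mark, so level
-- plus mark of an unscanned vertex is constant throughout a scan.
mark : (ℕ → ℕ) → ℕ → ℕ → ℕ
mark last cur w = if does (last w ≟ cur) then 0 else 1

mark-yes : ∀ last {cur w} → last w ≢ cur → mark last cur w ≡ 1
mark-yes last {cur} {w} ne = cong (λ b → if b then 0 else 1) (dec-false (last w ≟ cur) ne)

mark-no : ∀ last {cur w} → last w ≡ cur → mark last cur w ≡ 0
mark-no last {cur} {w} eq = cong (λ b → if b then 0 else 1) (dec-true (last w ≟ cur) eq)

mark≤1 : ∀ last cur w → mark last cur w ≤ 1
mark≤1 last cur w with last w ≟ cur
... | yes eq = ≤-trans (≤-reflexive (mark-no last eq)) z≤n
... | no ne  = ≤-reflexive (mark-yes last ne)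

mark-cong : ∀ last last′ {cur w} → last′ w ≡ last w → mark last′ cur w ≡ mark last cur w
mark-cong last last′ {cur} eq = cong (λ z → if does (z ≟ cur) then 0 else 1) eq

no-member : ∀ {l : List ℕ} → (∀ y → y ∉ l) → l ≡ []
no-member {[]}    h = refl
no-member {y ∷ l} h = contradiction (here refl) (h y)

no-∈ : ∀ {l : List ℕ} {y} → l ≡ [] → y ∉ l
no-∈ refl ()

-- Maximum adjacency search (Nagamochi and Ibaraki), with priorities capped at
-- k + 1.  lev v is one more than the number of kept edges from v to scanned
-- vertices while v is unscanned, and 3 + k once v is scanned.
module MaximumAdjacency (n k : ℕ) (adj₀ : ℕ → List ℕ)
  (adj₀-sym : ∀ {x y} → y ∈ adj₀ x → x ∈ adj₀ y) (adj₀-bound : ∀ {x y} → y ∈ adj₀ x → x < n) where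

  top : ℕ
  top = 2 + k

  -- If S is removed, the unscanned vertices with more kept neighbours than
  -- there are scanned vertices in S still lie in one component.
  Joined : (ℕ → ℕ) → ℕ → List (ℕ × ℕ) → Set
  Joined lev cur ks =
    ∀ S → length S ≤ k → cur ∉ S → ∀ {w} → w < n → w ∉ S → lev w ≤ top →
    suc (above top lev S) < lev w → Conn (Kept ks) S cur w

  -- While a vertex of S is being scanned, it counts only against the
  -- neighbours whose level it has already raised.
  Joined′ : (lev last : ℕ → ℕ) → ℕ → List (ℕ × ℕ) → Set
  Joined′ lev last cur ks =
    ∀ S → length S ≤ k → cur ∈ S → ∀ {w w′} → w < n → w′ < n → w ∉ S → w′ ∉ S →
    lev w ≤ top → lev w′ ≤ top → suc (above top lev S) < lev w + mark last cur w →
    suc (above top lev S) < lev w′ + mark last cur w′ → Conn (Kept ks) S w w′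

  -- Buckets are cleaned lazily: a raised vertex leaves its old entries behind, so `entries` gives
  -- only `ℓ ≤ lev y`. Levels start at 1 so that `L = 0` can mean that every bucket is empty. `busy`
  -- holds `L` at `top` during a scan, so that no raised vertex lands above `L`. The value `n` is a
  -- dummy: for `cur` before the first scan, for `last` before the first raise. In `kept#` each kept
  -- edge uses up one of the k + 1 raises available to its unscanned end.
  record Search (adj bkt : ℕ → List ℕ) (lev last : ℕ → ℕ) (cur L : ℕ) (ks : List (ℕ × ℕ)) : Set where
    field
      adj⊆    : ∀ {x y} → y ∈ adj x → y ∈ adj₀ x
      lev≥1   : ∀ {v} → v < n → 1 ≤ lev v
      lev≤    : ∀ {v} → v < n → lev v ≤ suc top
      queued  : ∀ {v} → v < n → lev v ≤ top → v ∈ bkt (lev v)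
      entries : ∀ {y ℓ} → y ∈ bkt ℓ → y < n × ℓ ≤ lev y × 1 ≤ ℓ
      empty   : ∀ {ℓ} → L < ℓ → bkt ℓ ≡ []
      L≤top   : L ≤ top
      busy    : ∀ {y} → y ∈ adj cur → L ≡ top
      current : cur ≡ n ⊎ top < lev cur
      read    : ∀ {v} → v < n → top < lev v → v ≢ cur → adj v ≡ []
      unread  : ∀ {x y} → y ∈ adj₀ x → lev x ≤ top → y ∈ adj x
      marked  : ∀ {w} → w < n → last w ≡ n ⊎ (last w , w) ∈ ks
      safe    : ∀ {x y} → y ∈ adj₀ x → top < lev x → y ∈ adj x ⊎ Inseparable (Kept ks) k x y
      kept⊆   : ∀ {x y} → (x , y) ∈ ks → y ∈ adj₀ x
      kept#   : length ks + sumTo n (λ v → top ∸ lev v) ≤ n * suc k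
      joined  : Joined lev cur ks
      joined′ : Joined′ lev last cur ks

  start : ∀ {bkt lev last} → (∀ {v} → v < n → lev v ≡ 1) → (∀ {v} → v < n → last v ≡ n) →
          (∀ {v} → v < n → v ∈ bkt 1) → (∀ {y ℓ} → y ∈ bkt ℓ → y < n × ℓ ≡ 1) →
          Search adj₀ bkt lev last n top []
  start {bkt} {lev} {last} lev≡ last≡ full ent = record
    { adj⊆    = λ m → m
    ; lev≥1   = λ v< → ≤-reflexive (sym (lev≡ v<))
    ; lev≤    = λ v< → ≤-trans (≤-reflexive (lev≡ v<)) (s≤s z≤n)
    ; queued  = λ {v} v< _ → subst (λ z → v ∈ bkt z) (sym (lev≡ v<)) (full v<)
    ; entries = λ m → let y< , ℓ≡ = ent m in
                  y< , ≤-reflexive (trans ℓ≡ (sym (lev≡ y<))) , ≤-reflexive (sym ℓ≡)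
    ; empty   = λ {ℓ} lt → no-member λ y m →
                  contradiction (proj₂ (ent m)) (λ { refl → contradiction lt (λ { (s≤s ()) }) })
    ; L≤top   = ≤-refl
    ; busy    = λ _ → refl
    ; current = inj₁ refl
    ; read    = λ v< lt _ → contradiction (subst (top <_) (lev≡ v<) lt) (λ { (s≤s ()) })
    ; unread  = λ m _ → m
    ; marked  = λ w< → inj₁ (last≡ w<)
    ; safe    = λ m lt → contradiction (subst (top <_) (lev≡ (adj₀-bound m)) lt) (λ { (s≤s ()) })
    ; kept⊆   = λ ()
    ; kept#   = sumTo-const n (λ v< → ≤-reflexive (cong (top ∸_) (lev≡ v<)))
    ; joined  = λ S _ _ w< _ _ lt → contradiction (subst (suc (above top lev S) <_) (lev≡ w<) lt) λ { (s≤s ()) }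
    ; joined′ = λ S _ _ w< _ _ _ _ _ lt _ → contradiction
                  (subst (suc (above top lev S) <_) (cong₂ _+_ (lev≡ w<) (mark-no last (last≡ w<))) lt) λ { (s≤s ()) }
    }

  module _ {adj bkt lev last cur L ks} (s : Search adj bkt lev last cur L ks) where
    open Search s

    module _ {w l} (eq : adj cur ≡ w ∷ l) where
      private
        w∈ : w ∈ adj cur
        w∈ = subst (w ∈_) (sym eq) (here refl)

        w∈₀ : w ∈ adj₀ cur
        w∈₀ = adj⊆ w∈

        cur<n : cur < n
        cur<n = adj₀-bound w∈₀

      head-bound : w < n
      head-bound = adj₀-bound (adj₀-sym w∈₀)

      current-bound : cur < n
      current-bound = cur<n

      current-scanned : top < lev cur
      current-scanned with current
      ... | inj₁ refl = contradiction cur<n (<-irrefl refl)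
      ... | inj₂ lt   = lt

      private
        -- There are three reasons to discard an arc. If this scan raised `w`, a parallel edge is
        -- kept. If `w` is at the cap, its k + 1 kept edges outnumber any `S`, so `joined` applies.
        -- If `w` was scanned earlier, the opposite arc was settled then, which is where symmetry of
        -- `adj₀` enters.
        redundant : top ≤ lev w ⊎ last w ≡ cur → Inseparable (Kept ks) k cur w
        redundant (inj₂ refl) S _ s t with marked head-bound
        ... | inj₁ e = contradiction cur<n (λ lt → <-irrefl e lt)
        ... | inj₂ m = (inj₁ m , s , t) ◅ ε
        redundant (inj₁ le) S len s t with m≤n⇒m<n∨m≡n le
        ... | inj₂ e = joined S len s head-bound t (≤-reflexive (sym e))
                (<-≤-trans (s≤s (s≤s (≤-trans (above≤length top lev S) len))) (≤-reflexive e))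
        ... | inj₁ lt with w ≟ cur
        ...   | yes refl = ε
        ...   | no ne with safe (adj₀-sym w∈₀) lt
        ...     | inj₁ m = contradiction m (no-∈ (read head-bound lt ne))
        ...     | inj₂ h = conn-sym swap⊎ (h S len t s)

        read′ : ∀ {v} → v < n → top < lev v → v ≢ cur → upd adj cur l v ≡ []
        read′ v< lt ne = pop-empty {adj} eq (read v< lt ne)

        unread′ : ∀ {x y} → y ∈ adj x → lev x ≤ top → y ∈ upd adj cur l x
        unread′ m le with ∈-pop {adj} eq m
        ... | inj₁ (refl , _) = contradiction current-scanned (≤⇒≯ le)
        ... | inj₂ m′         = m′

      scan-skip : top ≤ lev w ⊎ last w ≡ cur → Search (upd adj cur l) bkt lev last cur L ks
      scan-skip red = record
        { adj⊆ = λ m → adj⊆ (pop-⊆ {adj} eq m)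
        ; busy = λ m → busy w∈
        ; read = read′
        ; safe = λ {x} m lt → safe′ m lt
        ; unread = λ m le → unread′ (unread m le) le
        ; lev≥1 = lev≥1 ; lev≤ = lev≤ ; queued = queued ; entries = entries ; empty = empty
        ; L≤top = L≤top ; current = current ; marked = marked ; kept⊆ = kept⊆ ; kept# = kept#
        ; joined = joined ; joined′ = joined′
        }
        where
          safe′ : ∀ {x y} → y ∈ adj₀ x → top < lev x → y ∈ upd adj cur l x ⊎ Inseparable (Kept ks) k x y
          safe′ m lt with safe m lt
          ... | inj₂ h = inj₂ h
          ... | inj₁ m′ with ∈-pop {adj} eq m′
          ...   | inj₁ (refl , refl) = inj₂ (redundant red)
          ...   | inj₂ m″ = inj₁ m″

      scan-keep : lev w < top → last w ≢ cur →
                  Search (upd adj cur l) (upd bkt (suc (lev w)) (w ∷ bkt (suc (lev w))))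
                         (upd lev w (suc (lev w))) (upd last w cur) cur L ((cur , w) ∷ ks)
      scan-keep lt fresh = record
        { adj⊆ = λ m → adj⊆ (pop-⊆ {adj} eq m)
        ; lev≥1 = lev≥1′
        ; lev≤ = lev≤′
        ; queued = queued′
        ; entries = entries′
        ; empty = empty′
        ; L≤top = L≤top
        ; busy = λ m → busy w∈
        ; current = inj₂ (scanned⁺ cur current-scanned)
        ; read = λ v< lt′ ne → read′ v< (scanned⁻ _ lt′) ne
        ; unread = λ {x} m le → let le′ = ≤-trans (lev-grows x) le in unread′ (unread m le′) le′
        ; marked = marked′
        ; safe = safe′
        ; kept⊆ = λ { (here refl) → w∈₀ ; (there m) → kept⊆ m }
        ; kept# = kept#′
        ; joined = joined₁
        ; joined′ = joined₁′
        }
        where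
          lev′ last′ : ℕ → ℕ
          lev′  = upd lev w (suc (lev w))
          last′ = upd last w cur

          scanned⁺ : ∀ v → top < lev v → top < lev′ v
          scanned⁺ v lt′ with upd-view lev w (suc (lev w)) v
          ... | inj₁ (refl , _) = contradiction lt′ (<⇒≯ lt)
          ... | inj₂ (_ , e)    = subst (top <_) (sym e) lt′

          scanned⁻ : ∀ v → top < lev′ v → top < lev v
          scanned⁻ v lt′ with upd-view lev w (suc (lev w)) v
          ... | inj₁ (refl , e) = contradiction (subst (top <_) e lt′) (≤⇒≯ lt)
          ... | inj₂ (_ , e)    = subst (top <_) e lt′

          lev≥1′ : ∀ {v} → v < n → 1 ≤ lev′ v
          lev≥1′ {v} v< with upd-view lev w (suc (lev w)) v
          ... | inj₁ (_ , e) = subst (1 ≤_) (sym e) (s≤s z≤n)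
          ... | inj₂ (_ , e) = subst (1 ≤_) (sym e) (lev≥1 v<)

          lev≤′ : ∀ {v} → v < n → lev′ v ≤ suc top
          lev≤′ {v} v< with upd-view lev w (suc (lev w)) v
          ... | inj₁ (_ , e) = subst (_≤ suc top) (sym e) (m≤n⇒m≤1+n lt)
          ... | inj₂ (_ , e) = subst (_≤ suc top) (sym e) (lev≤ v<)

          queued′ : ∀ {v} → v < n → lev′ v ≤ top → v ∈ upd bkt (suc (lev w)) (w ∷ bkt (suc (lev w))) (lev′ v)
          queued′ {v} v< le with upd-view lev w (suc (lev w)) v
          ... | inj₁ (refl , e) rewrite e = ∈-push-new {bkt}
          ... | inj₂ (_ , e)    rewrite e = ∈-push-old {bkt} (queued v< le)

          lev-grows : ∀ y → lev y ≤ lev′ y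
          lev-grows y with upd-view lev w (suc (lev w)) y
          ... | inj₁ (refl , e) = subst (lev w ≤_) (sym e) (n≤1+n _)
          ... | inj₂ (_ , e)    = ≤-reflexive (sym e)

          entries′ : ∀ {y ℓ} → y ∈ upd bkt (suc (lev w)) (w ∷ bkt (suc (lev w))) ℓ →
                     y < n × ℓ ≤ lev′ y × 1 ≤ ℓ
          entries′ m with ∈-push⁻ {bkt} m
          ... | inj₁ (refl , refl) = head-bound , ≤-reflexive (sym (upd-≡ lev {w} refl)) , s≤s z≤n
          ... | inj₂ m′ = let y< , le , 1≤ = entries m′ in y< , ≤-trans le (lev-grows _) , 1≤

          empty′ : ∀ {ℓ} → L < ℓ → upd bkt (suc (lev w)) (w ∷ bkt (suc (lev w))) ℓ ≡ []
          empty′ {ℓ} lt′ = trans (upd-≢ bkt ne) (empty lt′)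
            where
              ne : suc (lev w) ≢ ℓ
              ne refl = contradiction (subst (_< suc (lev w)) (busy w∈) lt′) (≤⇒≯ lt)

          marked′ : ∀ {v} → v < n → last′ v ≡ n ⊎ (last′ v , v) ∈ (cur , w) ∷ ks
          marked′ {v} v< with upd-view last w cur v
          ... | inj₁ (refl , e) rewrite e = inj₂ (here refl)
          ... | inj₂ (_ , e)    rewrite e = map⊎ (λ z → z) there (marked v<)

          safe′ : ∀ {x y} → y ∈ adj₀ x → top < lev′ x →
                  y ∈ upd adj cur l x ⊎ Inseparable (Kept ((cur , w) ∷ ks)) k x y
          safe′ m lt′ with safe m (scanned⁻ _ lt′)
          ... | inj₂ h = inj₂ λ S len s t → conn-map kept-there (h S len s t)
          ... | inj₁ m′ with ∈-pop {adj} eq m′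
          ...   | inj₁ (refl , refl) = inj₂ λ S len s t → (inj₁ (here refl) , s , t) ◅ ε
          ...   | inj₂ m″ = inj₁ m″

          room : ℕ → ℕ
          room v = top ∸ lev v

          kept#′ : suc (length ks) + sumTo n (λ v → top ∸ lev′ v) ≤ n * suc k
          kept#′ = ≤-trans (≤-reflexive (trans (sym (+-suc (length ks) _)) (cong (length ks +_) fewer))) kept#
            where
              open ≡-Reasoning
              fewer : suc (sumTo n (λ v → top ∸ lev′ v)) ≡ sumTo n room
              fewer = +-cancelʳ-≡ (top ∸ suc (lev w)) _ _ (begin
                suc (sumTo n (λ v → top ∸ lev′ v)) + (top ∸ suc (lev w))
                  ≡⟨ +-suc (sumTo n (λ v → top ∸ lev′ v)) (top ∸ suc (lev w)) ⟨
                sumTo n (λ v → top ∸ lev′ v) + suc (top ∸ suc (lev w))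
                  ≡⟨ cong (sumTo n (λ v → top ∸ lev′ v) +_) (suc[m∸suc[n]]≡m∸n {top} lt) ⟩
                sumTo n (λ v → top ∸ lev′ v) + room w
                  ≡⟨ sumTo-change n room (λ v → top ∸ lev′ v) head-bound (λ ne → cong (top ∸_) (upd-≢ lev ne)) ⟩
                sumTo n room + (top ∸ lev′ w)
                  ≡⟨ cong (λ z → sumTo n room + (top ∸ z)) (upd-≡ lev {w} refl) ⟩
                sumTo n room + (top ∸ suc (lev w)) ∎)
                where
                  suc[m∸suc[n]]≡m∸n : ∀ {m j} → j < m → suc (m ∸ suc j) ≡ m ∸ j
                  suc[m∸suc[n]]≡m∸n {suc m} {j} (s≤s le) = sym (+-∸-assoc 1 le)

          count : ∀ S → above top lev S ≤ above top lev′ S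
          count S = above-mono S scanned⁺

          joined₁ : Joined lev′ cur ((cur , w) ∷ ks)
          joined₁ S len s {z} z< t le lt′ with upd-view lev w (suc (lev w)) z
          ... | inj₁ (refl , _) = (inj₁ (here refl) , s , t) ◅ ε
          ... | inj₂ (_ , e) = conn-map kept-there
            (joined S len s z< t (subst (_≤ top) e le)
              (≤-<-trans (s≤s (count S)) (subst (_ <_) e lt′)))

          -- The gain of `w` in level and its loss of the mark cancel, so the threshold of `Joined′`
          -- is met after the step only if it was met before.
          before : ∀ {S z} → lev′ z ≤ top → suc (above top lev′ S) < lev′ z + mark last′ cur z →
                   lev z ≤ top × suc (above top lev S) < lev z + mark last cur z
          before {S} {z} le lt′ with upd-view lev w (suc (lev w)) z
          ... | inj₁ (refl , e) = <⇒≤ lt , ≤-<-trans (s≤s (count S)) (<-≤-trans lt′ (≤-reflexive (begin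
              lev′ w + mark last′ cur w ≡⟨ cong₂ _+_ e (mark-no last′ (upd-≡ last {w} refl)) ⟩
              suc (lev w) + 0           ≡⟨ +-suc (lev w) 0 ⟨
              lev w + 1                 ≡⟨ cong (lev w +_) (mark-yes last fresh) ⟨
              lev w + mark last cur w   ∎)))
            where open ≡-Reasoning
          ... | inj₂ (ne , e) = subst (_≤ top) e le , ≤-<-trans (s≤s (count S))
            (<-≤-trans lt′ (≤-reflexive (cong₂ _+_ e (mark-cong last last′ {cur} (upd-≢ last ne)))))

          joined₁′ : Joined′ lev′ last′ cur ((cur , w) ∷ ks)
          joined₁′ S len s z< z′< t t′ le le′ lt₁ lt₂ with before {S} le lt₁ | before {S} le′ lt₂
          ... | a , b | a′ , b′ = conn-map kept-there (joined′ S len s z< z′< t t′ a a′ b b′)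

    module _ (idle : adj cur ≡ []) where
      private
        all-read : ∀ {v} → v < n → top < lev v → adj v ≡ []
        all-read {v} v< lt with v ≟ cur
        ... | yes refl = idle
        ... | no ne    = read v< lt ne

      lower : bkt L ≡ [] → Search adj bkt lev last cur (L ∸ 1) ks
      lower e = record
        { busy = λ m → contradiction m (no-∈ idle)
        ; L≤top = ≤-trans (m∸n≤m L 1) L≤top
        ; empty = λ {ℓ} lt → empty′ {ℓ} lt
        ; adj⊆ = adj⊆ ; lev≥1 = lev≥1 ; lev≤ = lev≤ ; queued = queued ; entries = entries
        ; current = current ; read = read ; unread = unread ; marked = marked ; safe = safe ; kept⊆ = kept⊆
        ; kept# = kept# ; joined = joined ; joined′ = joined′
        }
        where
          empty′ : ∀ {ℓ} → L ∸ 1 < ℓ → bkt ℓ ≡ []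
          empty′ {ℓ} lt with m≤n⇒m<n∨m≡n (≤-trans (m≤n+m∸n L 1) lt)
          ... | inj₁ lt′  = empty lt′
          ... | inj₂ refl = e

      module _ {y l} (eq : bkt L ≡ y ∷ l) where
        private
          y∈ : y ∈ bkt L
          y∈ = subst (y ∈_) (sym eq) (here refl)

        popped-bound : y < n
        popped-bound = proj₁ (entries y∈)

        private
          empty′ : ∀ {ℓ} → L < ℓ → upd bkt L l ℓ ≡ []
          empty′ lt = pop-empty {bkt} eq (empty lt)

          entries′ : ∀ {z ℓ} → z ∈ upd bkt L l ℓ → z < n × ℓ ≤ lev z × 1 ≤ ℓ
          entries′ m = entries (pop-⊆ {bkt} eq m)

        pop-drop : top < lev y → Search adj (upd bkt L l) lev last cur L ks
        pop-drop lt = record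
          { queued = queued′ ; entries = entries′ ; empty = empty′
          ; adj⊆ = adj⊆ ; lev≥1 = lev≥1 ; lev≤ = lev≤ ; L≤top = L≤top ; busy = busy
          ; current = current ; read = read ; unread = unread ; marked = marked ; safe = safe ; kept⊆ = kept⊆
          ; kept# = kept# ; joined = joined ; joined′ = joined′
          }
          where
            queued′ : ∀ {v} → v < n → lev v ≤ top → v ∈ upd bkt L l (lev v)
            queued′ v< le with ∈-pop {bkt} eq (queued v< le)
            ... | inj₁ (_ , refl) = contradiction lt (≤⇒≯ le)
            ... | inj₂ m = m

        pop-scan : lev y ≤ top → Search adj (upd bkt L l) (upd lev y (suc top)) last y top ks
        pop-scan le = record
          { adj⊆ = adj⊆
          ; lev≥1 = λ {v} v< → ≤-trans (lev≥1 v<) (lev-grows v v<)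
          ; lev≤ = lev≤′
          ; queued = queued′
          ; entries = λ m → let z< , a , b = entries′ m in z< , ≤-trans a (lev-grows _ z<) , b
          ; empty = λ lt → empty′ (≤-<-trans L≤top lt)
          ; L≤top = ≤-refl
          ; busy = λ _ → refl
          ; current = inj₂ y-scanned
          ; read = read′
          ; unread = λ {x} m le′ → unread m (subst (_≤ top) (proj₂ (unscanned {x} le′)) le′)
          ; marked = marked
          ; safe = safe′
          ; kept⊆ = kept⊆
          ; kept# = ≤-trans (+-monoʳ-≤ (length ks) (sumTo-mono n (λ {v} v< → ∸-monoʳ-≤ top (lev-grows v v<)))) kept#
          ; joined = joined₁
          ; joined′ = joined₁′
          }
          where
            lev′ : ℕ → ℕ
            lev′ = upd lev y (suc top)

            y-scanned : top < lev′ y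
            y-scanned = ≤-reflexive (sym (upd-≡ lev {y} refl))

            lev-grows : ∀ v → v < n → lev v ≤ lev′ v
            lev-grows v v< with upd-view lev y (suc top) v
            ... | inj₁ (_ , e) = subst (lev v ≤_) (sym e) (lev≤ v<)
            ... | inj₂ (_ , e) = ≤-reflexive (sym e)

            lev≤′ : ∀ {v} → v < n → lev′ v ≤ suc top
            lev≤′ {v} v< with upd-view lev y (suc top) v
            ... | inj₁ (_ , e) = ≤-reflexive e
            ... | inj₂ (_ , e) = subst (_≤ suc top) (sym e) (lev≤ v<)

            unscanned : ∀ {v} → lev′ v ≤ top → v ≢ y × lev′ v ≡ lev v
            unscanned {v} le′ with upd-view lev y (suc top) v
            ... | inj₁ (_ , e)  = contradiction (subst (_≤ top) e le′) (<-irrefl refl)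
            ... | inj₂ (ne , e) = ne ∘ sym , e

            scanned⁺ : ∀ v → top < lev v → top < lev′ v
            scanned⁺ v lt with upd-view lev y (suc top) v
            ... | inj₁ (_ , e) = ≤-reflexive (sym e)
            ... | inj₂ (_ , e) = subst (top <_) (sym e) lt

            queued′ : ∀ {v} → v < n → lev′ v ≤ top → v ∈ upd bkt L l (lev′ v)
            queued′ {v} v< le′ with unscanned {v} le′
            ... | ne , e rewrite e with ∈-pop {bkt} eq (queued v< le′)
            ...   | inj₁ (_ , e′) = contradiction e′ ne
            ...   | inj₂ m = m

            read′ : ∀ {v} → v < n → top < lev′ v → v ≢ y → adj v ≡ []
            read′ {v} v< lt ne = all-read v< (subst (top <_) (upd-≢ lev (ne ∘ sym)) lt)

            safe′ : ∀ {x z} → z ∈ adj₀ x → top < lev′ x → z ∈ adj x ⊎ Inseparable (Kept ks) k x z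
            safe′ {x} m lt with upd-view lev y (suc top) x
            ... | inj₂ (_ , e) = safe m (subst (top <_) e lt)
            ... | inj₁ (refl , _) = inj₁ (unread m le)

            -- A stale entry does no harm: buckets above `L` are empty, and every entry of bucket
            -- `L` has level at least `L`.
            maximal : ∀ {w} → w < n → lev w ≤ top → lev w ≤ lev y
            maximal {w} w< le′ with lev w ≤? L
            ... | yes w≤L = ≤-trans w≤L (proj₁ (proj₂ (entries y∈)))
            ... | no w≰L  = contradiction (queued w< le′) (no-∈ (empty (≰⇒> w≰L)))

            count : ∀ S → above top lev S ≤ above top lev′ S
            count S = above-mono S scanned⁺

            -- If the previous current vertex survives the removal of `S`, both vertices are joined
            -- through it; if it lies in `S`, `joined′` joins them directly.
            joined-before : ∀ S → length S ≤ k → ∀ {w w′} → w < n → w′ < n → w ∉ S → w′ ∉ S →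
                            lev w ≤ top → lev w′ ≤ top → suc (above top lev S) < lev w →
                            suc (above top lev S) < lev w′ → Conn (Kept ks) S w w′
            joined-before S len w< w′< s s′ a a′ b b′ with cur ∈? S
            ... | yes c = joined′ S len c w< w′< s s′ a a′
                            (<-≤-trans b (m≤m+n _ _)) (<-≤-trans b′ (m≤m+n _ _))
            ... | no c  = conn-sym swap⊎ (joined S len c w< s a b) ◅◅ joined S len c w′< s′ a′ b′

            joined₁ : Joined lev′ y ks
            joined₁ S len s {w} w< t le′ lt with unscanned {w} le′
            ... | _ , e = joined-before S len popped-bound w< s t le lev-w≤
                            (<-≤-trans lt′ (maximal w< lev-w≤)) lt′
              where
                lev-w≤ : lev w ≤ top
                lev-w≤ = subst (_≤ top) e le′
                lt′ : suc (above top lev S) < lev w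
                lt′ = ≤-<-trans (s≤s (count S)) (subst (_ <_) e lt)

            joined₁′ : Joined′ lev′ last y ks
            joined₁′ S len s {w} {w′} w< w′< t t′ a a′ lt lt′ with unscanned {w} a | unscanned {w′} a′
            ... | _ , e | _ , e′ = joined-before S len w< w′< t t′
                    (subst (_≤ top) e a) (subst (_≤ top) e′ a′) (weaker e lt) (weaker e′ lt′)
              where
                -- Since `y` lies in `S` and has just become scanned, the count grows by one, which
                -- makes up for the mark of at most one.
                weaker : ∀ {z} → lev′ z ≡ lev z → suc (above top lev′ S) < lev′ z + mark last y z →
                         suc (above top lev S) < lev z
                weaker {z} e lt = ≤-pred (begin-strict
                  suc (suc (above top lev S))  ≤⟨ s≤s (above-strict S scanned⁺ s le y-scanned) ⟩
                  suc (above top lev′ S)       <⟨ lt ⟩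
                  lev′ z + mark last y z       ≤⟨ +-mono-≤ (≤-reflexive e) (mark≤1 last y z) ⟩
                  lev z + 1                    ≡⟨ +-comm (lev z) 1 ⟩
                  suc (lev z)                  ∎)
                  where open ≤-Reasoning

  private
    scanned-all : ∀ {adj bkt lev last cur ks} → Search adj bkt lev last cur 0 ks → ∀ {v} → v < n → top < lev v
    scanned-all {lev = lev} s {v} v< with top <? lev v
    ... | yes lt = lt
    ... | no ¬lt = contradiction (queued v< (≮⇒≥ ¬lt)) (no-∈ (empty (lev≥1 v<)))
      where open Search s

  finished-adj : ∀ {adj bkt lev last cur ks} → Search adj bkt lev last cur 0 ks → ∀ x → adj x ≡ []
  finished-adj {cur = cur} s x = no-member none
    where
      open Search s
      none : ∀ y → y ∉ _
      none y m with x ≟ cur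
      ... | yes refl with () ← busy m
      ... | no ne = no-∈ (read x< (scanned-all s x<) ne) m
        where x< = adj₀-bound (adj⊆ m)

  finished-bkt : ∀ {adj bkt lev last cur ks} → Search adj bkt lev last cur 0 ks → ∀ ℓ → bkt ℓ ≡ []
  finished-bkt s zero    = no-member λ y m → contradiction (proj₂ (proj₂ (Search.entries s m))) λ ()
  finished-bkt s (suc ℓ) = Search.empty s (s≤s z≤n)

  finished-safe : ∀ {adj bkt lev last cur ks} → Search adj bkt lev last cur 0 ks →
                  ∀ {x y} → y ∈ adj₀ x → Inseparable (Kept ks) k x y
  finished-safe s {x} m with Search.safe s m (scanned-all s (adj₀-bound m))
  ... | inj₁ m′ = contradiction m′ (no-∈ (finished-adj s x))
  ... | inj₂ h  = h

  finished-size : ∀ {adj bkt lev last cur L ks} → Search adj bkt lev last cur L ks → length ks ≤ n * suc k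
  finished-size s = ≤-trans (m≤m+n _ _) (Search.kept# s)

  -- Amortised running time of the search

  unscanned# : (ℕ → ℕ) → ℕ
  unscanned# lev = sumTo n (λ v → 1 ∸ aboveBit top (lev v))

  -- An arc weighs two because its removal may create a bucket entry. An unscanned vertex weighs
  -- `top` because scanning it sends `L` back up to `top`.
  potential : (adj bkt : ℕ → List ℕ) (lev : ℕ → ℕ) (L : ℕ) → ℕ
  potential adj bkt lev L = 2 * size n adj + size (suc top) bkt + top * unscanned# lev + L

  module _ {adj bkt lev last cur L ks} (s : Search adj bkt lev last cur L ks) where
    open Search s

    private
      step : ∀ {a a′ b b′ u u′ L′} → suc a′ ≡ a → b′ ≤ suc b → u′ ≡ u →
             2 * a′ + b′ + top * u′ + L′ < 2 * a + b + top * u + L′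
      step {a′ = a′} {b} {b′} {u} {L′ = L′} refl le refl = +-monoˡ-< L′ (+-monoˡ-< (top * u) (begin-strict
        2 * a′ + b′          ≤⟨ +-monoʳ-≤ (2 * a′) le ⟩
        2 * a′ + suc b       ≡⟨ +-suc (2 * a′) b ⟩
        suc (2 * a′ + b)     <⟨ n<1+n _ ⟩
        2 + 2 * a′ + b       ≡⟨ cong (_+ b) (*-suc 2 a′) ⟨
        2 * suc a′ + b       ∎))
        where open ≤-Reasoning

    potential-skip : ∀ {w l} → adj cur ≡ w ∷ l →
                     potential (upd adj cur l) bkt lev L < potential adj bkt lev L
    potential-skip eq = step {u = unscanned# lev} {L′ = L} (size-pop n adj (current-bound s eq) eq) (n≤1+n _) refl

    potential-keep : ∀ {w l} → adj cur ≡ w ∷ l → lev w < top →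
                     potential (upd adj cur l) (upd bkt (suc (lev w)) (w ∷ bkt (suc (lev w))))
                               (upd lev w (suc (lev w))) L < potential adj bkt lev L
    potential-keep {w} eq lt = step {L′ = L} (size-pop n adj (current-bound s eq) eq)
      (≤-reflexive (size-push (suc top) bkt (s≤s lt))) same
      where
        f f′ : ℕ → ℕ
        f v  = 1 ∸ aboveBit top (lev v)
        f′ v = 1 ∸ aboveBit top (upd lev w (suc (lev w)) v)
        same : sumTo n f′ ≡ sumTo n f
        same = +-cancelʳ-≡ 1 _ _ (begin
          sumTo n f′ + 1   ≡⟨ cong (λ z → sumTo n f′ + (1 ∸ z)) (aboveBit-no (<⇒≤ lt)) ⟨
          sumTo n f′ + f w ≡⟨ sumTo-change n f f′ (head-bound s eq) (λ ne → cong (λ z → 1 ∸ aboveBit top z) (upd-≢ lev ne)) ⟩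
          sumTo n f + f′ w ≡⟨ cong (λ z → sumTo n f + (1 ∸ aboveBit top z)) (upd-≡ lev {w} refl) ⟩
          sumTo n f + (1 ∸ aboveBit top (suc (lev w))) ≡⟨ cong (λ z → sumTo n f + (1 ∸ z)) (aboveBit-no lt) ⟩
          sumTo n f + 1 ∎)
          where open ≡-Reasoning

    potential-drop : ∀ {y l} → bkt L ≡ y ∷ l → potential adj (upd bkt L l) lev L < potential adj bkt lev L
    potential-drop eq = +-monoˡ-< L (+-monoˡ-< (top * unscanned# lev) (+-monoʳ-< (2 * size n adj)
      (≤-reflexive (size-pop (suc top) bkt (s≤s L≤top) eq))))

    potential-scan : ∀ {y l} → bkt L ≡ y ∷ l → lev y ≤ top →
                     potential adj (upd bkt L l) (upd lev y (suc top)) top < potential adj bkt lev L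
    potential-scan {y} {l} eq le = begin-strict
      2 * size n adj + b + top * u′ + top    ≡⟨ +-assoc (2 * size n adj + b) (top * u′) top ⟩
      2 * size n adj + b + (top * u′ + top)  ≡⟨ cong (2 * size n adj + b +_) (trans (+-comm (top * u′) top) (trans (sym (*-suc top u′)) (cong (top *_) fewer))) ⟩
      2 * size n adj + b + top * unscanned# lev <⟨ +-monoˡ-< (top * unscanned# lev) (+-monoʳ-< (2 * size n adj)
        (≤-reflexive (size-pop (suc top) bkt (s≤s L≤top) eq))) ⟩
      2 * size n adj + size (suc top) bkt + top * unscanned# lev ≤⟨ m≤m+n _ L ⟩
      potential adj bkt lev L ∎
      where
        open ≤-Reasoning
        f f′ : ℕ → ℕ
        f v  = 1 ∸ aboveBit top (lev v)
        f′ v = 1 ∸ aboveBit top (upd lev y (suc top) v)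
        b u′ : ℕ
        b  = size (suc top) (upd bkt L l)
        u′ = sumTo n f′
        y<n : y < n
        y<n = proj₁ (entries (subst (y ∈_) (sym eq) (here refl)))
        fewer : suc u′ ≡ unscanned# lev
        fewer = trans (+-comm 1 u′) (trans
          (trans (cong (λ z → u′ + (1 ∸ z)) (sym (aboveBit-no le)))
            (trans (sumTo-change n f f′ y<n (λ ne → cong (λ z → 1 ∸ aboveBit top z) (upd-≢ lev ne)))
              (cong (λ z → sumTo n f + (1 ∸ z)) (aboveBit-yes {top} {upd lev y (suc top) y}
                (≤-reflexive (sym (upd-≡ lev {y} refl)))))))
          (+-identityʳ (sumTo n f)))

    potential-lower : L ≢ 0 → potential adj bkt lev (L ∸ 1) < potential adj bkt lev L
    potential-lower ne = +-monoʳ-< (2 * size n adj + size (suc top) bkt + top * unscanned# lev)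
      (≤-reflexive (suc-pred L {{≢-nonZero ne}}))

-- Partial depth-first search trees

-- The parent pointer of the root 0 is a loop, which `up` must not follow.
data Anc (par : ℕ → ℕ) (a : ℕ) : ℕ → Set where
  self : Anc par a a
  up   : ∀ {v} → v ≢ 0 → Anc par a (par v) → Anc par a v

Comparable : (ℕ → ℕ) → ℕ → ℕ → Set
Comparable par u v = Anc par u v ⊎ Anc par v u

anc-trans : ∀ {par a b c} → Anc par a b → Anc par b c → Anc par a c
anc-trans p self     = p
anc-trans p (up z q) = up z (anc-trans p q)

anc-linear : ∀ {par a b v} → Anc par a v → Anc par b v → Comparable par a b
anc-linear self     q        = inj₂ q
anc-linear (up z p) self     = inj₁ (up z p)
anc-linear (up _ p) (up _ q) = anc-linear p q

anc-child : ∀ {par w u} → Anc par w u → w ≢ u → ∃[ c ] c ≢ 0 × par c ≡ w × Anc par c u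
anc-child self ne = contradiction refl ne
anc-child {par} {w} (up {v} z p) ne with w ≟ par v
... | yes eq = v , z , sym eq , self
... | no ne′ with anc-child p ne′
...   | c , z′ , eq , q = c , z′ , eq , up z q

HasParent : ℕ → (par dep : ℕ → ℕ) → ℕ → Set
HasParent n par dep v = par v < n × dep v ≡ suc (dep (par v)) × dep (par v) ≢ 0

-- dep is one more than the depth, and 0 outside the forest.
record Forest (n : ℕ) (par dep : ℕ → ℕ) : Set where
  field
    root-dep : dep 0 ≡ 1
    root-par : par 0 ≡ 0
    parent   : ∀ {v} → v < n → v ≢ 0 → dep v ≢ 0 →
               HasParent n par dep v

module ForestProperties {n par dep} (F : Forest n par dep) where
  open Forest F

  anc-visited : ∀ {a v} → v < n → dep v ≢ 0 → Anc par a v → a < n × dep a ≢ 0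
  anc-visited v< dv self = v< , dv
  anc-visited v< dv (up z p) with parent v< z dv
  ... | p< , _ , dp = anc-visited p< dp p

  anc-dep : ∀ {a v} → v < n → dep v ≢ 0 → Anc par a v → dep a ≤ dep v
  anc-dep v< dv self = ≤-refl
  anc-dep v< dv (up z p) with parent v< z dv
  ... | p< , e , dp = ≤-trans (anc-dep p< dp p) (≤-trans (n≤1+n _) (≤-reflexive (sym e)))

  anc-≡ : ∀ {a v} → v < n → dep v ≢ 0 → Anc par a v → dep v ≤ dep a → a ≡ v
  anc-≡ v< dv self le = refl
  anc-≡ v< dv (up z p) le with parent v< z dv
  ... | p< , e , dp = contradiction (≤-trans (≤-reflexive (sym e)) (≤-trans le (anc-dep p< dp p))) (<-irrefl refl)

  anc-unique : ∀ {a b v} → v < n → dep v ≢ 0 → Anc par a v → Anc par b v → dep a ≡ dep b → a ≡ b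
  anc-unique v< dv p q e with anc-visited v< dv p | anc-visited v< dv q | anc-linear p q
  ... | _ | b< , db | inj₁ r = anc-≡ b< db r (≤-reflexive (sym e))
  ... | a< , da | _ | inj₂ r = sym (anc-≡ a< da r (≤-reflexive e))

  anc-below : ∀ {a b v} → v < n → dep v ≢ 0 → Anc par a v → Anc par b v → dep a ≤ dep b → Anc par a b
  anc-below v< dv p q le with anc-visited v< dv p | anc-linear p q
  ... | _ | inj₁ r = r
  ... | a< , da | inj₂ r with anc-≡ a< da r le
  ...   | refl = self

  anc-at : ∀ m {v d} → dep v ≤ m → v < n → dep v ≢ 0 → 1 ≤ d → d ≤ dep v → ∃[ a ] dep a ≡ d × Anc par a v
  anc-at m {v} {d} le v< dv 1≤ d≤ with d ≟ dep v
  ... | yes eq = v , sym eq , self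
  ... | no ne with v ≟ 0
  ...   | yes refl = contradiction (≤-antisym d≤ (≤-trans (≤-reflexive root-dep) 1≤)) ne
  anc-at zero le v< dv 1≤ d≤ | no ne | no z = contradiction (n≤0⇒n≡0 le) dv
  anc-at (suc m) le v< dv 1≤ d≤ | no ne | no z with parent v< z dv
  ... | p< , e , dp with anc-at m (≤-pred (≤-trans (≤-reflexive (sym e)) le)) p< dp 1≤
                           (≤-pred (≤-trans (≤∧≢⇒< d≤ ne) (≤-reflexive e)))
  ...   | a , ea , p = a , ea , up z p

  ancestor-at : ∀ {v d} → v < n → dep v ≢ 0 → 1 ≤ d → d ≤ dep v → ∃[ a ] dep a ≡ d × Anc par a v
  ancestor-at = anc-at _ ≤-refl

  -- The ancestors of v have pairwise distinct depths.
  dep≤n : ∀ {v} → v < n → dep v ≢ 0 → dep v ≤ n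
  dep≤n {v} v< dv = injective⇒≤ {f = f} inj
    where
      at : (i : Fin (dep v)) → ∃[ a ] dep a ≡ suc (toℕ i) × Anc par a v
      at i = ancestor-at v< dv (s≤s z≤n) (toℕ<n i)
      at< : ∀ i → proj₁ (at i) < n
      at< i = proj₁ (anc-visited v< dv (proj₂ (proj₂ (at i))))
      f : Fin (dep v) → Fin n
      f i = fromℕ< (at< i)
      inj : ∀ {i j} → f i ≡ f j → i ≡ j
      inj {i} {j} e = toℕ-injective (suc-injective (trans (sym (proj₁ (proj₂ (at i))))
        (trans (cong dep (trans (sym (toℕ-fromℕ< (at< i))) (trans (cong toℕ e) (toℕ-fromℕ< (at< j)))))
          (proj₁ (proj₂ (at j))))))

  module _ {t w} (t< : t < n) (dt : dep t ≢ 0) (dw : dep w ≡ 0) where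
    private
      par′ dep′ : ℕ → ℕ
      par′ = upd par w t
      dep′ = upd dep w (suc (dep t))

      visited-≢ : ∀ {v} → dep v ≢ 0 → w ≢ v
      visited-≢ dv refl = dv dw

    dep-extend : ∀ {v} → dep v ≢ 0 → dep′ v ≡ dep v
    dep-extend dv = upd-≢ dep (visited-≢ dv)

    visited-extend : ∀ {v} → dep v ≢ 0 → dep′ v ≢ 0
    visited-extend dv = dv ∘ trans (sym (dep-extend dv))

    par-extend : ∀ {v} → dep v ≢ 0 → par′ v ≡ par v
    par-extend dv = upd-≢ par (visited-≢ dv)

    anc-extend : ∀ {a v} → v < n → dep v ≢ 0 → Anc par a v → Anc par′ a v
    anc-extend v< dv self = self
    anc-extend v< dv (up z p) with parent v< z dv
    ... | p< , _ , dp = up z (subst (Anc par′ _) (sym (par-extend dv)) (anc-extend p< dp p))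

    forest-extend : Forest n par′ dep′
    forest-extend = record
      { root-dep = trans (dep-extend d0) root-dep
      ; root-par = trans (par-extend d0) root-par
      ; parent   = parent′
      }
      where
        d0 : dep 0 ≢ 0
        d0 e = 0≢1+n (trans (sym e) root-dep)
        parent′ : ∀ {v} → v < n → v ≢ 0 → dep′ v ≢ 0 → HasParent n par′ dep′ v
        parent′ {v} v< z dv with upd-view par w t v | upd-view dep w (suc (dep t)) v
        ... | inj₁ (eq , _) | inj₂ (ne , _) = contradiction eq ne
        ... | inj₂ (ne , _) | inj₁ (eq , _) = contradiction eq ne
        ... | inj₁ (_ , e) | inj₁ (_ , e′) rewrite e | e′ =
          t< , cong suc (sym (dep-extend dt)) , visited-extend dt
        ... | inj₂ (_ , e) | inj₂ (_ , e′) rewrite e | e′ with parent v< z dv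
        ...   | p< , ed , dp = p< , trans ed (cong suc (sym (dep-extend dp))) , visited-extend dp

-- Fixing k further levels by a search of the sparse graph

module Levels (n : ℕ) (E : ℕ → ℕ → Set) (E-sym : ∀ {u v} → E u v → E v u) (E-bound : ∀ {u v} → E u v → u < n) where

  -- A rooted tree whose vertices with dep ≤ D are in their final positions:
  -- an edge of the graph that is not yet a back edge joins two vertices of
  -- the same subtree hanging from level D.
  record Levelled (D : ℕ) (par dep : ℕ → ℕ) : Set where
    field
      forest  : Forest n par dep
      visited : ∀ {v} → v < n → dep v ≢ 0
      1≤D     : 1 ≤ D
      edge    : ∀ {u v} → E u v → Comparable par u v ⊎ (∃[ a ] dep a ≡ D × Anc par a u × Anc par a v)
      real    : ∀ {v} → v < n → v ≢ 0 → dep v ≤ D → E v (par v)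
      conn    : ∀ {v a} → v < n → D ≤ dep v → dep a ≡ D → Anc par a v →
                Star (λ x y → E x y × D ≤ dep x × D ≤ dep y) v a

  module Search {D k par₀ dep₀} (T : Levelled D par₀ dep₀) (adj₀ : ℕ → List ℕ)
    (arc-E : ∀ {x y} → y ∈ adj₀ x → E x y) (arc-sym : ∀ {x y} → y ∈ adj₀ x → x ∈ adj₀ y)
    (arc-deep : ∀ {x y} → y ∈ adj₀ x → D ≤ dep₀ x)
    (safe : ∀ {u v} → E u v → D ≤ dep₀ u → D ≤ dep₀ v → Inseparable (λ x y → y ∈ adj₀ x) k u v) where

    private
      module T = Levelled T
      module F₀ = ForestProperties T.forest

      Top : ℕ → ℕ → Set
      Top a v = dep₀ a ≡ D × Anc par₀ a v

      arc-bound : ∀ {x y} → y ∈ adj₀ x → x < n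
      arc-bound = E-bound ∘ arc-E

      anc-dep₀ : ∀ {a v} → v < n → Anc par₀ a v → dep₀ a ≤ dep₀ v
      anc-dep₀ v< = F₀.anc-dep v< (T.visited v<)

      anc-bound₀ : ∀ {a v} → v < n → Anc par₀ a v → a < n
      anc-bound₀ v< p = proj₁ (F₀.anc-visited v< (T.visited v<) p)

      top-of : ∀ {v} → v < n → D ≤ dep₀ v → ∃[ a ] Top a v
      top-of v< le = F₀.ancestor-at v< (T.visited v<) T.1≤D le

      -- An edge on the levels from D downwards stays within one hanging subtree: comparable ends
      -- share their ancestor on level D, and in the other case of `T.edge` that ancestor is unique.
      top-edge : ∀ {x y a} → E x y → D ≤ dep₀ y → Top a x → Top a y
      top-edge {x} {y} e le (da , p) with T.edge e
      ... | inj₁ (inj₁ q) = da , anc-trans p q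
      ... | inj₁ (inj₂ q) = da , F₀.anc-below (E-bound e) (T.visited (E-bound e)) p q (≤-trans (≤-reflexive da) le)
      ... | inj₂ (b , db , q , r)
        with refl ← F₀.anc-unique (E-bound e) (T.visited (E-bound e)) p q (trans da (sym db)) = da , r

      top-arc : ∀ {x y a} → y ∈ adj₀ x → Top a x → Top a y
      top-arc m = top-edge (arc-E m) (arc-deep (arc-sym m))

    -- The stack is seeded with all vertices of level D, so it holds several searches end to end.
    -- Only entries under the same vertex of level D form an ancestor chain, and by `top-arc` only
    -- these can be joined by an arc.
    Nested : (ℕ → ℕ) → List ℕ → Set
    Nested par = AllPairs (λ x z → ∀ a → Top a x → Top a z → Anc par z x)

    -- `dep` doubles as the visited flag. An unvisited vertex still carries its old parent pointer,
    -- which `Forest` ignores. `hangs` says that the rebuilt part of a subtree remains under the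
    -- same vertex of level D.
    record DFS (adj : ℕ → List ℕ) (st : List ℕ) (par dep : ℕ → ℕ) : Set where
      field
        adj⊆      : ∀ {x y} → y ∈ adj x → y ∈ adj₀ x
        forest    : Forest n par dep
        old       : ∀ {v} → v < n → dep₀ v ≤ D → dep v ≡ dep₀ v × par v ≡ par₀ v
        new       : ∀ {v} → v < n → D < dep₀ v → dep v ≢ 0 → v ∈ adj₀ (par v) × D < dep v
        active    : ∀ {z} → z ∈ st → z < n × dep z ≢ 0
        exhausted : ∀ {v} → v < n → dep v ≢ 0 → v ∈ st ⊎ adj v ≡ []
        unread    : ∀ {v y} → dep v ≡ 0 → y ∈ adj₀ v → y ∈ adj v
        consumed  : ∀ {v y} → dep v ≢ 0 → y ∈ adj₀ v → y ∈ adj v ⊎ (dep y ≢ 0 × Comparable par v y)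
        nested    : Nested par st
        hangs     : ∀ {v a} → v < n → dep v ≢ 0 → Top a v → Anc par a v

    start : ∀ {st dep} → (∀ {v} → v < n → dep₀ v ≤ D → dep v ≡ dep₀ v) →
            (∀ {v} → v < n → D < dep₀ v → dep v ≡ 0) →
            (∀ {v} → v ∈ st → v < n × dep₀ v ≡ D) → (∀ {v} → v < n → dep₀ v ≡ D → v ∈ st) →
            0 < n → DFS adj₀ st par₀ dep
    start {st} {dep} shallow deep st⊆ st⊇ 0<n = record
      { adj⊆ = λ m → m
      ; forest = record
        { root-dep = trans (shallow 0<n (≤-trans (≤-reflexive (Forest.root-dep T.forest)) T.1≤D)) (Forest.root-dep T.forest)
        ; root-par = Forest.root-par T.forest
        ; parent = parent′
        }
      ; old = λ v< le → shallow v< le , refl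
      ; new = λ v< lt dv → contradiction (deep v< lt) dv
      ; active = λ m → let v< , e = st⊆ m in v< , λ z → T.visited v< (trans (sym (shallow v< (≤-reflexive e))) z)
      ; exhausted = exhausted′
      ; unread = λ _ m → m
      ; consumed = λ _ m → inj₁ m
      ; nested = nested′ st (λ m → m)
      ; hangs = λ v< dv (da , p) → p
      }
      where
        visited⇒≤ : ∀ {v} → v < n → dep v ≢ 0 → dep₀ v ≤ D
        visited⇒≤ {v} v< dv with dep₀ v ≤? D
        ... | yes le = le
        ... | no gt  = contradiction (deep v< (≰⇒> gt)) dv
        parent′ : ∀ {v} → v < n → v ≢ 0 → dep v ≢ 0 → HasParent n par₀ dep v
        parent′ {v} v< z dv with Forest.parent T.forest v< z (T.visited v<)
        ... | p< , e , dp = p< , trans (shallow v< (visited⇒≤ v< dv)) (trans e (cong suc (sym same))) , dp ∘ trans (sym same)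
          where
            same : dep (par₀ v) ≡ dep₀ (par₀ v)
            same = shallow p< (≤-trans (n≤1+n _) (≤-trans (≤-reflexive (sym e)) (visited⇒≤ v< dv)))
        exhausted′ : ∀ {v} → v < n → dep v ≢ 0 → v ∈ st ⊎ adj₀ v ≡ []
        exhausted′ {v} v< dv with dep₀ v ≟ D
        ... | yes e = inj₁ (st⊇ v< e)
        ... | no ne = inj₂ (no-member λ y m → ne (≤-antisym (visited⇒≤ v< dv) (arc-deep m)))
        nested′ : ∀ l → (∀ {x} → x ∈ l → x ∈ st) → Nested par₀ l
        nested′ [] incl = []
        nested′ (x ∷ l) incl = tabulateAll (λ {z} m a (da , p) (_ , q) →
            let x< , dx = st⊆ (incl (here refl)) ; z< , dz = st⊆ (incl (there m))
                a≡x = F₀.anc-≡ x< (T.visited x<) p (≤-reflexive (trans dx (sym da)))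
                a≡z = F₀.anc-≡ z< (T.visited z<) q (≤-reflexive (trans dz (sym da)))
            in subst (λ y → Anc par₀ y x) (trans (sym a≡x) a≡z) self)
          ∷ nested′ l (incl ∘ there)

    module _ {adj t st par dep} (s : DFS adj (t ∷ st) par dep) where
      open DFS s
      private
        t< : t < n
        t< = proj₁ (active (here refl))
        dt : dep t ≢ 0
        dt = proj₂ (active (here refl))

      top-bound : t < n
      top-bound = t<

      top-dep≤n : dep t ≤ n
      top-dep≤n = ForestProperties.dep≤n forest t< dt

      backtrack : adj t ≡ [] → DFS adj st par dep
      backtrack empty = record
        { adj⊆ = adj⊆ ; forest = forest ; old = old ; new = new ; active = active ∘ there
        ; exhausted = exhausted′ ; unread = unread ; consumed = consumed
        ; nested = tail nested ; hangs = hangs }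
        where
          tail : ∀ {x l} → AllPairs _ (x ∷ l) → AllPairs _ l
          tail (_ ∷ ps) = ps
          exhausted′ : ∀ {v} → v < n → dep v ≢ 0 → v ∈ st ⊎ adj v ≡ []
          exhausted′ v< dv with exhausted v< dv
          ... | inj₁ (here refl) = inj₂ empty
          ... | inj₁ (there m)   = inj₁ m
          ... | inj₂ e           = inj₂ e

      module _ {w l} (eq : adj t ≡ w ∷ l) where
        private
          w∈ : w ∈ adj₀ t
          w∈ = adj⊆ (subst (w ∈_) (sym eq) (here refl))
          w< : w < n
          w< = arc-bound (arc-sym w∈)
          D≤t₀ : D ≤ dep₀ t
          D≤t₀ = arc-deep w∈

          unread′ : ∀ {v y} → dep v ≡ 0 → y ∈ adj₀ v → y ∈ upd adj t l v
          unread′ dv m with ∈-pop {adj} eq (unread dv m)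
          ... | inj₁ (refl , _) = contradiction dv dt
          ... | inj₂ m′         = m′

        head<n : w < n
        head<n = w<

        -- A visited `w` still on the stack is an ancestor of `t` by `nested`, both lying under the
        -- same vertex of level D. Otherwise `w` is exhausted, so the opposite arc has been read
        -- already and comparability was recorded at that time.
        revisit : dep w ≢ 0 → DFS (upd adj t l) (t ∷ st) par dep
        revisit dw = record
          { adj⊆ = λ m → adj⊆ (pop-⊆ {adj} eq m)
          ; forest = forest ; old = old ; new = new ; active = active
          ; exhausted = λ v< dv → map⊎ (λ m → m) (pop-empty {adj} eq) (exhausted v< dv)
          ; unread = unread′ ; consumed = consumed′ ; nested = nested ; hangs = hangs }
          where
            comparable : Comparable par t w
            comparable with exhausted w< dw
            ... | inj₁ (here refl) = inj₁ self
            ... | inj₁ (there m) with top-of t< D≤t₀ | nested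
            ...   | a , ta | ps ∷ _ = inj₂ (lookup ps m a ta (top-arc w∈ ta))
            comparable | inj₂ e with consumed dw (arc-sym w∈)
            ... | inj₁ m       = contradiction m (no-∈ e)
            ... | inj₂ (_ , c) = swap⊎ c

            consumed′ : ∀ {v y} → dep v ≢ 0 → y ∈ adj₀ v → y ∈ upd adj t l v ⊎ (dep y ≢ 0 × Comparable par v y)
            consumed′ dv m with consumed dv m
            ... | inj₂ c = inj₂ c
            ... | inj₁ m′ with ∈-pop {adj} eq m′
            ...   | inj₁ (refl , refl) = inj₂ (dw , comparable)
            ...   | inj₂ m″ = inj₁ m″

        module _ (dw : dep w ≡ 0) where
          private
            open ForestProperties forest
            par′ dep′ : ℕ → ℕ
            par′ = upd par w t
            dep′ = upd dep w (suc (dep t))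

            D<w : D < dep₀ w
            D<w with dep₀ w ≤? D
            ... | yes le = contradiction (trans (sym (proj₁ (old w< le))) dw) (T.visited w<)
            ... | no gt  = ≰⇒> gt

            D≤t : D ≤ dep t
            D≤t with dep₀ t ≤? D
            ... | yes le = ≤-trans D≤t₀ (≤-reflexive (sym (proj₁ (old t< le))))
            ... | no gt  = <⇒≤ (proj₂ (new t< (≰⇒> gt) dt))

            ext : ∀ {a v} → v < n → dep v ≢ 0 → Anc par a v → Anc par′ a v
            ext = anc-extend t< dt dw

            cmp-ext : ∀ {u v} → u < n → v < n → dep u ≢ 0 → dep v ≢ 0 → Comparable par u v → Comparable par′ u v
            cmp-ext u< v< du dv = map⊎ (ext v< dv) (ext u< du)

            new-anc : ∀ {a} → Anc par a t → Anc par′ a w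
            new-anc p = up w≢0 (subst (Anc par′ _) (sym (upd-≡ par {w} refl)) (ext t< dt p))
              where
                w≢0 : w ≢ 0
                w≢0 refl = 0≢1+n (trans (sym dw) (Forest.root-dep forest))

            back : ∀ {v} → dep′ v ≢ 0 → (v ≡ w) ⊎ (v ≢ w × dep v ≢ 0)
            back {v} dv with upd-view dep w (suc (dep t)) v
            ... | inj₁ (refl , _) = inj₁ refl
            ... | inj₂ (ne , e)   = inj₂ (ne ∘ sym , dv ∘ trans e)

          discover : DFS (upd adj t l) (w ∷ t ∷ st) par′ dep′
          discover = record
            { adj⊆ = λ m → adj⊆ (pop-⊆ {adj} eq m)
            ; forest = forest-extend t< dt dw
            ; old = old′ ; new = new′
            ; active = active′ ; exhausted = exhausted′
            ; unread = λ dv m → unread′ (was-unvisited dv) m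
            ; consumed = consumed′ ; nested = nested′ ; hangs = hangs′ }
            where
              old′ : ∀ {v} → v < n → dep₀ v ≤ D → dep′ v ≡ dep₀ v × par′ v ≡ par₀ v
              old′ v< le with old v< le
              ... | e , e′ = trans (dep-extend t< dt dw dv) e , trans (par-extend t< dt dw dv) e′
                where dv = T.visited v< ∘ trans (sym e)

              new′ : ∀ {v} → v < n → D < dep₀ v → dep′ v ≢ 0 → v ∈ adj₀ (par′ v) × D < dep′ v
              new′ {v} v< lt dv with back dv
              ... | inj₁ refl = subst (λ z → w ∈ adj₀ z) (sym (upd-≡ par {w} refl)) w∈ ,
                                subst (D <_) (sym (upd-≡ dep {w} refl)) (s≤s D≤t)
              ... | inj₂ (_ , dv′) with new v< lt dv′
              ...   | m , gt = subst (λ z → v ∈ adj₀ z) (sym (par-extend t< dt dw dv′)) m ,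
                               subst (D <_) (sym (dep-extend t< dt dw dv′)) gt

              dep′w : dep′ w ≢ 0
              dep′w e = 0≢1+n (trans (sym e) (upd-≡ dep {w} refl))

              was-unvisited : ∀ {v} → dep′ v ≡ 0 → dep v ≡ 0
              was-unvisited {v} e with dep v ≟ 0
              ... | yes z = z
              ... | no nz = contradiction e (visited-extend t< dt dw nz)

              active′ : ∀ {z} → z ∈ w ∷ t ∷ st → z < n × dep′ z ≢ 0
              active′ (here refl) = w< , dep′w
              active′ (there m) with active m
              ... | z< , dz = z< , visited-extend t< dt dw dz

              exhausted′ : ∀ {v} → v < n → dep′ v ≢ 0 → v ∈ w ∷ t ∷ st ⊎ upd adj t l v ≡ []
              exhausted′ v< dv with back dv
              ... | inj₁ refl = inj₁ (here refl)
              ... | inj₂ (_ , dv′) = map⊎ there (pop-empty {adj} eq) (exhausted v< dv′)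

              consumed′ : ∀ {v y} → dep′ v ≢ 0 → y ∈ adj₀ v → y ∈ upd adj t l v ⊎ (dep′ y ≢ 0 × Comparable par′ v y)
              consumed′ dv m with back dv
              ... | inj₁ refl = inj₁ (unread′ dw m)
              ... | inj₂ (_ , dv′) with consumed dv′ m
              ...   | inj₂ (dy , c) = inj₂ (visited-extend t< dt dw dy , cmp-ext (arc-bound m) (arc-bound (arc-sym m)) dv′ dy c)
              ...   | inj₁ m′ with ∈-pop {adj} eq m′
              ...     | inj₂ m″ = inj₁ m″
              ...     | inj₁ (refl , refl) = inj₂ (dep′w , inj₁ (new-anc self))

              nested′ : Nested par′ (w ∷ t ∷ st)
              nested′ = tabulateAll below ∷ extended (t ∷ st) (λ m → m) nested
                where
                  below : ∀ {z} → z ∈ t ∷ st → ∀ a → Top a w → Top a z → Anc par′ z w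
                  below (here refl) _ _ _ = new-anc self
                  below (there m) a tw tz with nested
                  ... | ps ∷ _ = new-anc (lookup ps m a (top-arc (arc-sym w∈) tw) tz)
                  extended : ∀ l → (∀ {z} → z ∈ l → z ∈ t ∷ st) →
                             Nested par l →
                             Nested par′ l
                  extended [] incl [] = []
                  extended (x ∷ l) incl (p ∷ ps) =
                    mapAll (λ f a tx tz → let x< , dx = active (incl (here refl)) in ext x< dx (f a tx tz)) p
                    ∷ extended l (incl ∘ there) ps

              hangs′ : ∀ {v a} → v < n → dep′ v ≢ 0 → Top a v → Anc par′ a v
              hangs′ v< dv ta with back dv
              ... | inj₁ refl = new-anc (hangs t< dt (top-arc (arc-sym w∈) ta))
              ... | inj₂ (_ , dv′) = ext v< dv′ (hangs v< dv′ ta)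

        potential-arc : ∀ {b} → b ≤ 1 → 2 * size n (upd adj t l) + (b + suc (length st)) < 2 * size n adj + suc (length st)
        potential-arc {b} b≤ = begin-strict
          2 * m′ + (b + suc (length st)) ≡⟨ +-assoc (2 * m′) b (suc (length st)) ⟨
          2 * m′ + b + suc (length st)   <⟨ +-monoˡ-< (suc (length st)) (begin-strict
            2 * m′ + b     <⟨ +-monoʳ-< (2 * m′) (s≤s b≤) ⟩
            2 * m′ + 2     ≡⟨ +-comm (2 * m′) 2 ⟩
            2 + 2 * m′     ≡⟨ *-suc 2 m′ ⟨
            2 * suc m′     ≡⟨ cong (2 *_) (size-pop n adj t< eq) ⟩
            2 * size n adj ∎) ⟩
          2 * size n adj + suc (length st) ∎
          where
            open ≤-Reasoning
            m′ = size n (upd adj t l)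

    module _ {adj par dep} (s : DFS adj [] par dep) where
      open DFS s

      private
        module F = ForestProperties forest

        arc-read : ∀ {u v} → dep u ≢ 0 → v ∈ adj₀ u → dep v ≢ 0 × Comparable par u v
        arc-read du m with exhausted (arc-bound m) du | consumed du m
        ... | inj₂ e | inj₁ m′ = contradiction m′ (no-∈ e)
        ... | inj₂ _ | inj₂ c  = c

        arc-visited : ∀ {S u v} → Conn (λ x y → y ∈ adj₀ x) S u v → dep u ≢ 0 → dep v ≢ 0
        arc-visited ε du = du
        arc-visited ((m , _) ◅ c) du = arc-visited c (proj₁ (arc-read du m))

        -- Inseparability with nothing removed replaces each graph edge by a walk of stored arcs,
        -- and along these the visits spread.
        path-visited : ∀ {v a} → Star (λ x y → E x y × D ≤ dep₀ x × D ≤ dep₀ y) v a → dep a ≢ 0 → dep v ≢ 0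
        path-visited ε da = da
        path-visited ((e , dx , dy) ◅ p) da =
          arc-visited (conn-sym arc-sym (safe e dx dy [] z≤n (λ ()) (λ ()))) (path-visited p da)

        old-dep : ∀ {v} → v < n → dep₀ v ≤ D → dep v ≢ 0
        old-dep v< le z = T.visited v< (trans (sym (proj₁ (old v< le))) z)

        visited : ∀ {v} → v < n → dep v ≢ 0
        visited {v} v< with dep₀ v ≤? D
        ... | yes le = old-dep v< le
        ... | no gt with top-of v< (<⇒≤ (≰⇒> gt))
        ...   | a , da , p = path-visited (T.conn v< (<⇒≤ (≰⇒> gt)) da p)
                (old-dep (anc-bound₀ v< p) (≤-reflexive da))

        deep : ∀ {v} → v < n → D ≤ dep₀ v → D ≤ dep v
        deep {v} v< le with dep₀ v ≤? D
        ... | yes le′ = ≤-trans le (≤-reflexive (sym (proj₁ (old v< le′))))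
        ... | no gt   = <⇒≤ (proj₂ (new v< (≰⇒> gt) (visited v<)))

        real : ∀ {v} → v < n → v ≢ 0 → E v (par v)
        real {v} v< z with dep₀ v ≤? D
        ... | yes le = subst (E v) (sym (proj₂ (old v< le))) (T.real v< z le)
        ... | no gt  = E-sym (arc-E (proj₁ (new v< (≰⇒> gt) (visited v<))))

        shallow-anc : ∀ {x z} → z < n → dep₀ z ≤ D → Anc par₀ x z → Anc par x z
        shallow-anc z< le self = self
        shallow-anc z< le (up nz p) with Forest.parent T.forest z< nz (T.visited z<)
        ... | p< , e , _ = up nz (subst (Anc par _) (sym (proj₂ (old z< le)))
                (shallow-anc p< (≤-trans (n≤1+n _) (≤-trans (≤-reflexive (sym e)) le)) p))

        -- Down to the ancestor of `z` on level D the pointers are unchanged; from there to `z` the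
        -- rebuilt path is given by `hangs`.
        keep-anc : ∀ {x z} → z < n → dep₀ x ≤ D → Anc par₀ x z → Anc par x z
        keep-anc {x} {z} z< le p with dep₀ z ≤? D
        ... | yes le′ = shallow-anc z< le′ p
        ... | no gt with top-of z< (<⇒≤ (≰⇒> gt))
        ...   | a , da , q = anc-trans
                (shallow-anc (anc-bound₀ z< q) (≤-reflexive da)
                  (F₀.anc-below z< (T.visited z<) p q (≤-trans le (≤-reflexive (sym da)))))
                (hangs z< (visited z<) (da , q))

      arcs-consumed : ∀ x → adj x ≡ []
      arcs-consumed x = no-member none
        where
          none : ∀ y → y ∉ adj x
          none y m with exhausted (arc-bound (adj⊆ m)) (visited (arc-bound (adj⊆ m)))
          ... | inj₂ e = no-∈ e m

      grows : ∀ {v} → v < n → D < dep₀ v → D < dep v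
      grows v< lt = proj₂ (new v< lt (visited v<))

      private
        D′ : ℕ
        D′ = D + k

        Goal : ℕ → ℕ → Set
        Goal u v = Comparable par u v ⊎ (∃[ a ] dep a ≡ D′ × Anc par a u × Anc par a v)

        -- Walking down from the common ancestor: if u and v part at a vertex w
        -- above level D + k, the path S from level D to w separates them.
        module _ {u v} (u< : u < n) (v< : v < n) (uv : Inseparable (λ x y → y ∈ adj₀ x) k u v) where

          -- Every arc joins comparable vertices, so the subtree of `c` can only be left towards a
          -- proper ancestor of `c`. Arcs never go above level D, and all such ancestors from level
          -- D on are in `S`.
          stays-below : ∀ {c S x y} → (∀ {z} → Anc par z (par c) → D ≤ dep z → z ∈ S) →
                        Conn (λ x y → y ∈ adj₀ x) S x y → x < n → Anc par c x → Anc par c y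
          stays-below onPath ε x< p = p
          stays-below {c} onPath ((_◅_) {x} {z} (m , _ , z∉) path) x< p = stays-below onPath path z< step
            where
              z< = arc-bound (arc-sym m)
              step : Anc par c z
              step with proj₂ (arc-read (visited x<) m)
              ... | inj₁ q = anc-trans p q
              ... | inj₂ q with anc-linear p q
              ...   | inj₁ r = r
              ...   | inj₂ self = self
              ...   | inj₂ (up _ r) = contradiction (onPath r (deep z< (arc-deep (arc-sym m)))) z∉

          walk : ∀ r w S → dep w + r ≡ D′ → length S + r ≡ suc k → Anc par w u → Anc par w v →
                 (∀ {z} → Anc par z w → D ≤ dep z → z ∈ S) → (∀ {z} → z ∈ S → Anc par z w) → Goal u v
          walk zero w S e _ p q _ _ = inj₂ (w , trans (sym (+-identityʳ (dep w))) e , p , q)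
          walk (suc r) w S e len p q onPath path with w ≟ u
          ... | yes refl = inj₁ (inj₁ q)
          ... | no w≢u with w ≟ v
          ...   | yes refl = inj₁ (inj₂ p)
          ...   | no w≢v with anc-child p w≢u | anc-child q w≢v
          ...     | c , c≢0 , refl , p′ | c′ , c′≢0 , e′ , q′ with F.anc-visited u< (visited u<) p′ | F.anc-visited v< (visited v<) q′
          ...       | c< , dc | c′< , dc′ with Forest.parent forest c< c≢0 dc | Forest.parent forest c′< c′≢0 dc′
          ...         | w< , ec , dw | _ , ec′ , _ with c ≟ c′
          ...           | yes refl = walk r c (c ∷ S)
                            (trans (cong (_+ r) ec) (trans (sym (+-suc (dep (par c)) r)) e))
                            (trans (sym (+-suc (length S) r)) len) p′ q′ onPath′ path′
            where
              onPath′ : ∀ {z} → Anc par z c → D ≤ dep z → z ∈ c ∷ S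
              onPath′ self le = here refl
              onPath′ (up _ a) le = there (onPath a le)
              path′ : ∀ {z} → z ∈ c ∷ S → Anc par z c
              path′ (here refl) = self
              path′ (there m)   = up c≢0 (path m)
          -- The path avoiding `S` puts `v` below `c` too; `c` and `c′` have the same depth, so they
          -- would coincide.
          ...           | no ne = contradiction (F.anc-unique v< (visited v<) below q′ (trans ec (trans (cong (suc ∘ dep) (sym e′)) (sym ec′)))) ne
            where
              short : length S ≤ k
              short = ≤-trans (m≤m+n (length S) r) (≤-reflexive (suc-injective (trans (sym (+-suc (length S) r)) len)))
              avoids : ∀ {z} → z < n → Anc par (par c) z → par c ≢ z → z ∉ S
              avoids z< a ne m = ne (F.anc-≡ z< (visited z<) a (F.anc-dep w< dw (path m)))
              below : Anc par c v
              below = stays-below onPath (uv S short (avoids u< p w≢u) (avoids v< q w≢v)) u< p′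

        edge : ∀ {u v} → E u v → Goal u v
        edge {u} {v} e with D ≤? dep₀ u | D ≤? dep₀ v
        ... | yes du | yes dv with top-of (E-bound e) du
        -- The walk starts with one vertex in `S` and `k` levels to go, so `S` has at most `k`
        -- elements whenever it must act as a separator, that is while a level remains.
        ...   | a , ta = walk u< v< (safe e du dv) k a (a ∷ [])
                (cong (_+ k) da) refl (hangs u< (visited u<) ta) (hangs v< (visited v<) (top-edge e dv ta))
                (λ p le → here (F.anc-≡ a< (visited a<) p (≤-trans (≤-reflexive da) le)))
                (λ { (here refl) → self })
          where
            u< = E-bound e
            v< = E-bound (E-sym e)
            a< = anc-bound₀ u< (proj₂ ta)
            da : dep a ≡ D
            da = trans (proj₁ (old a< (≤-reflexive (proj₁ ta)))) (proj₁ ta)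
        edge {u} {v} e | no du | _ with T.edge e
        ... | inj₂ (a , da , p , _) = contradiction (≤-trans (≤-reflexive (sym da)) (anc-dep₀ (E-bound e) p)) du
        ... | inj₁ (inj₁ p) = inj₁ (inj₁ (keep-anc (E-bound (E-sym e)) (<⇒≤ (≰⇒> du)) p))
        ... | inj₁ (inj₂ p) = inj₁ (inj₂ (keep-anc (E-bound e)
                (≤-trans (anc-dep₀ (E-bound e) p) (<⇒≤ (≰⇒> du))) p))
        edge {u} {v} e | yes _ | no dv with T.edge e
        ... | inj₂ (a , da , _ , p) = contradiction (≤-trans (≤-reflexive (sym da)) (anc-dep₀ (E-bound (E-sym e)) p)) dv
        ... | inj₁ (inj₂ p) = inj₁ (inj₂ (keep-anc (E-bound e) (<⇒≤ (≰⇒> dv)) p))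
        ... | inj₁ (inj₁ p) = inj₁ (inj₁ (keep-anc (E-bound (E-sym e))
                (≤-trans (anc-dep₀ (E-bound (E-sym e)) p) (<⇒≤ (≰⇒> dv))) p))

        connected : ∀ {v a} → v < n → dep a ≡ D′ → Anc par a v →
                    Star (λ x y → E x y × D′ ≤ dep x × D′ ≤ dep y) v a
        connected v< da self = ε
        connected v< da (up z p) with Forest.parent forest v< z (visited v<)
        ... | p< , e , _ = (real v< z , ≤-trans le (≤-trans (n≤1+n _) (≤-reflexive (sym e))) , le) ◅ connected p< da p
          where le = ≤-trans (≤-reflexive (sym da)) (F.anc-dep p< (visited p<) p)

      levelled : Levelled (D + k) par dep
      levelled = record
        { forest  = forest
        ; visited = visited
        ; 1≤D     = ≤-trans T.1≤D (m≤m+n D k)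
        ; edge    = edge
        ; real    = λ v< z _ → real v< z
        ; conn    = λ v< _ → connected v<
        }

  -- Before the first pass only the root is placed and all other vertices hang from it by fictitious
  -- edges. `real` tolerates these, as they end below level 1, and connectedness of the graph
  -- supplies `conn`.
  initial : ∀ {par dep} → 0 < n → (∀ v → par v ≡ 0) → dep 0 ≡ 1 → (∀ {v} → v < n → v ≢ 0 → dep v ≡ 2) →
            (∀ {v} → v < n → Star E v 0) → Levelled 1 par dep
  initial {par} {dep} 0<n par≡ dep0 dep2 path = record
    { forest = record { root-dep = dep0 ; root-par = par≡ 0 ; parent = parent }
    ; visited = λ v< z → contradiction (subst (1 ≤_) z (dep≥1 v<)) λ ()
    ; 1≤D = ≤-refl
    ; edge = λ e → inj₂ (0 , dep0 , below _ , below _)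
    ; real = λ v< z le → contradiction (subst (_≤ 1) (dep2 v< z) le) λ { (s≤s ()) }
    ; conn = λ v< _ da p → conn v< da p
    }
    where
      dep≥1 : ∀ {v} → v < n → 1 ≤ dep v
      dep≥1 {v} v< with v ≟ 0
      ... | yes refl = ≤-reflexive (sym dep0)
      ... | no z     = subst (1 ≤_) (sym (dep2 v< z)) (s≤s z≤n)
      parent : ∀ {v} → v < n → v ≢ 0 → dep v ≢ 0 → HasParent n par dep v
      parent {v} v< z _ rewrite par≡ v | dep0 = 0<n , dep2 v< z , λ ()
      below : ∀ v → Anc par 0 v
      below v with v ≟ 0
      ... | yes refl = self
      ... | no z     = up z (subst (Anc par 0) (sym (par≡ v)) self)
      anc-root : ∀ {a v} → v < n → dep a ≡ 1 → Anc par a v → a ≡ 0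
      anc-root {a} v< da self with a ≟ 0
      ... | yes e = e
      ... | no z  = contradiction (trans (sym (dep2 v< z)) da) λ ()
      anc-root {a} {v} v< da (up _ p) = anc-root (subst (_< n) (sym (par≡ v)) 0<n) da p
      star : ∀ {v w} → Star E v w → Star (λ x y → E x y × 1 ≤ dep x × 1 ≤ dep y) v w
      star ε = ε
      star (e ◅ p) = (e , dep≥1 (E-bound e) , dep≥1 (E-bound (E-sym e))) ◅ star p
      conn : ∀ {v a} → v < n → dep a ≡ 1 → Anc par a v → Star (λ x y → E x y × 1 ≤ dep x × 1 ≤ dep y) v a
      conn {v} v< da p with anc-root v< da p
      ... | refl = star (path v<)

-- The program and its sparsification phase

-- DEP holds the depth plus one, and 0 for unvisited vertices; LVL is the DEP
-- of the deepest level whose vertices are final.  HEAD, DST, NXT are the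
-- adjacency lists of the CNT buffered arcs; BH, BV, BN the NC nodes of the
-- buckets; KU, KV the KC edges kept.  LAST v is the vertex whose scan last
-- raised LEV v.
pattern IN = 0F
pattern PAR = 1F
pattern DEP = 2F
pattern LVL = 3F
pattern GO = 4F
pattern U = 5F
pattern V = 6F
pattern HEAD = 7F
pattern DST = 8F
pattern NXT = 9F
pattern CNT = suc NXT
pattern I = suc CNT
pattern LEV = suc I
pattern LAST = suc LEV
pattern BH = suc LAST
pattern BV = suc BH
pattern BN = suc BV
pattern NC = suc BN
pattern KU = suc NC
pattern KV = suc KU
pattern KC = suc KV
pattern CUR = suc KC
pattern L = suc CUR
pattern Y = suc L
pattern ST = suc Y
pattern SP = suc ST
pattern TMP = suc SP

Code : Mode → Set
Code = Cmd 27

Ex : Set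
Ex = Expr 27

var : Fin 27 → Ex
var x = x [ lit 0 ]

infix 10 _≔_
_≔_ : ∀ {μ} → Fin 27 → Ex → Code μ
x ≔ e = x [ lit 0 ]≔ e

infixl 16 _∔_ _∸′_
_∔_ _∸′_ : Ex → Ex → Ex
_∔_  = op add
_∸′_ = op sub

N K full : Ex
N    = var IN
K    = IN [ lit 1 ]
full = op mul (lit 4) (op mul N (lit 1 ∔ K))

push : ∀ {μ} (hd vl nx c : Fin 27) (i v : Ex) → Code μ
push hd vl nx c i v =
  c ≔ lit 1 ∔ var c ⨾ vl [ var c ]≔ v ⨾ nx [ var c ]≔ hd [ i ] ⨾ hd [ i ]≔ var c

insert : ∀ {μ} → Code μ
insert = push HEAD DST NXT CNT (var U) (var V) ⨾ push HEAD DST NXT CNT (var V) (var U)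

resetBody fetch keep take scan searchBody reinsertBody sparsify : Code local
resetBody =
  I ≔ var I ∸′ lit 1 ⨾ LEV [ var I ]≔ lit 1 ⨾ LAST [ var I ]≔ N ⨾ push BH BV BN NC (lit 1) (var I)

fetch = Y ≔ DST [ HEAD [ var CUR ] ] ⨾ HEAD [ var CUR ]≔ NXT [ HEAD [ var CUR ] ]

keep =
  LAST [ var Y ]≔ var CUR ⨾ TMP ≔ lit 1 ∔ LEV [ var Y ] ⨾ LEV [ var Y ]≔ var TMP ⨾
  KU [ var KC ]≔ var CUR ⨾ KV [ var KC ]≔ var Y ⨾ KC ≔ lit 1 ∔ var KC ⨾
  push BH BV BN NC (var TMP) (var Y)

take = Y ≔ BV [ BH [ var L ] ] ⨾ BH [ var L ]≔ BN [ BH [ var L ] ]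

scan = LEV [ var Y ]≔ lit 3 ∔ K ⨾ CUR ≔ var Y ⨾ L ≔ lit 2 ∔ K

searchBody =
  cond (HEAD [ var CUR ])
    (fetch ⨾
     cond (lit 2 ∔ K ∸′ LEV [ var Y ])
       (cond ((LAST [ var Y ] ∸′ var CUR) ∔ (var CUR ∸′ LAST [ var Y ])) keep skip)
       skip)
    (cond (BH [ var L ])
      (take ⨾ cond (lit 3 ∔ K ∸′ LEV [ var Y ]) scan skip)
      (L ≔ var L ∸′ lit 1))

reinsertBody =
  KC ≔ var KC ∸′ lit 1 ⨾ U ≔ KU [ var KC ] ⨾ V ≔ KV [ var KC ] ⨾ insert

sparsify =
  (NC ≔ lit 0 ⨾ I ≔ N) ⨾ while (var I) resetBody ⨾
  (KC ≔ lit 0 ⨾ CUR ≔ N ⨾ L ≔ lit 2 ∔ K) ⨾ while (var L) searchBody ⨾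
  CNT ≔ lit 0 ⨾ while (var KC) reinsertBody

edgeBody : Code local
edgeBody =
  cond (var LVL ∸′ DEP [ var U ]) skip
    (cond (var LVL ∸′ DEP [ var V ]) skip
      (insert ⨾ cond (full ∸′ var CNT) skip sparsify))

cutBody visit dfsBody round fillBody setup program : Code streaming
cutBody =
  I ≔ var I ∸′ lit 1 ⨾
  cond (DEP [ var I ] ∸′ var LVL)
    (DEP [ var I ]≔ lit 0)
    (cond (var LVL ∸′ DEP [ var I ]) skip (SP ≔ lit 1 ∔ var SP ⨾ ST [ var SP ]≔ var I))

visit =
  DEP [ var V ]≔ var TMP ⨾ PAR [ var V ]≔ var Y ⨾ SP ≔ lit 1 ∔ var SP ⨾ ST [ var SP ]≔ var V

dfsBody =
  Y ≔ ST [ var SP ] ⨾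
  cond (HEAD [ var Y ])
    ((TMP ≔ HEAD [ var Y ] ⨾ HEAD [ var Y ]≔ NXT [ var TMP ] ⨾ V ≔ DST [ var TMP ]) ⨾
     cond (DEP [ var V ]) skip
       -- The flag records within the same round that a vertex fell below the levels being fixed, so
       -- the outer loop stops without a further pass.
       (TMP ≔ lit 1 ∔ DEP [ var Y ] ⨾ visit ⨾ cond (var TMP ∸′ (var LVL ∔ K)) (GO ≔ lit 1) skip))
    (SP ≔ var SP ∸′ lit 1)

round =
  pass U V edgeBody ⨾
  (SP ≔ lit 0 ⨾ I ≔ N) ⨾ while (var I) cutBody ⨾
  GO ≔ lit 0 ⨾ while (var SP) dfsBody ⨾
  CNT ≔ lit 0 ⨾ LVL ≔ var LVL ∔ K

fillBody = I ≔ var I ∸′ lit 1 ⨾ DEP [ var I ]≔ lit 2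

setup =
  -- `PAR` is zero from the start, which makes vertex 0 the centre of a star. The flag `N ∸′ lit 1`
  -- vanishes for a single vertex, whose tree has height 0 and takes no pass.
  (LVL ≔ lit 1 ⨾ I ≔ N) ⨾ while (var I) fillBody ⨾ (DEP [ lit 0 ]≔ lit 1 ⨾ GO ≔ N ∸′ lit 1)

program = setup ⨾ while (var GO) round

-- The second list is read after the first push, exactly as `insert` does.
addEdge : ℕ → ℕ → (ℕ → List ℕ) → ℕ → List ℕ
addEdge u v adj = upd (upd adj u (v ∷ adj u)) v (u ∷ upd adj u (v ∷ adj u) v)

module _ {adj : ℕ → List ℕ} {u v : ℕ} where
  private
    adj₁ : ℕ → List ℕ
    adj₁ = upd adj u (v ∷ adj u)

  addEdge⁻ : ∀ {x y} → y ∈ addEdge u v adj x → (x ≡ u × y ≡ v) ⊎ (x ≡ v × y ≡ u) ⊎ y ∈ adj x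
  addEdge⁻ {x} {y} m with ∈-push⁻ {adj₁} {v} {u} {x} {y} m
  ... | inj₁ (refl , refl) = inj₂ (inj₁ (refl , refl))
  ... | inj₂ m′ with ∈-push⁻ {adj} {u} {v} {x} {y} m′
  ...   | inj₁ (refl , refl) = inj₁ (refl , refl)
  ...   | inj₂ m″ = inj₂ (inj₂ m″)

  addEdge-old : ∀ {x y} → y ∈ adj x → y ∈ addEdge u v adj x
  addEdge-old {x} m = ∈-push-old {adj₁} {v} {u} {x} (∈-push-old {adj} {u} {v} {x} m)

  addEdge-uv : v ∈ addEdge u v adj u
  addEdge-uv = ∈-push-old {adj₁} {v} {u} {u} (∈-push-new {adj} {u} {v})

  addEdge-vu : u ∈ addEdge u v adj v
  addEdge-vu = ∈-push-new {adj₁} {v} {u}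

record Buffer (n : ℕ) (hd vl nx : ℕ → ℕ) (c : ℕ) (adj : ℕ → List ℕ) : Set where
  field
    linked  : Linked hd vl nx c adj
    size≤   : size n adj ≤ c
    sym-arc : ∀ {x y} → y ∈ adj x → x ∈ adj y
    bound   : ∀ {x y} → y ∈ adj x → x < n

buffer-insert : ∀ {n hd vl nx c adj u v} → u < n → v < n → Buffer n hd vl nx c adj →
  Buffer n (upd (upd hd u (suc c)) v (suc (suc c)))
           (upd (upd vl (suc c) v) (suc (suc c)) u)
           (upd (upd nx (suc c) (hd u)) (suc (suc c)) (upd hd u (suc c) v))
           (suc (suc c)) (addEdge u v adj)
buffer-insert {n} {c = c} {adj} {u} {v} u< v< b = record
  { linked = linked-push v u (linked-push u v linked)
  ; size≤ = ≤-trans (≤-reflexive (trans (size-push n (upd adj u (v ∷ adj u)) v<) (cong suc (size-push n adj u<))))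
                    (s≤s (s≤s size≤))
  ; sym-arc = sym-arc′
  ; bound = bound′
  }
  where
    open Buffer b
    sym-arc′ : ∀ {x y} → y ∈ addEdge u v adj x → x ∈ addEdge u v adj y
    sym-arc′ {x} {y} m with addEdge⁻ {adj} {u} {v} {x} {y} m
    ... | inj₁ (refl , refl)        = addEdge-vu {adj} {u} {v}
    ... | inj₂ (inj₁ (refl , refl)) = addEdge-uv {adj} {u} {v}
    ... | inj₂ (inj₂ m′)            = addEdge-old {adj} {u} {v} (sym-arc m′)
    bound′ : ∀ {x y} → y ∈ addEdge u v adj x → x < n
    bound′ {x} {y} m with addEdge⁻ {adj} {u} {v} {x} {y} m
    ... | inj₁ (refl , _)        = u<
    ... | inj₂ (inj₁ (refl , _)) = v<
    ... | inj₂ (inj₂ m′)         = bound m′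

size-empty : ∀ n {ls : ℕ → List ℕ} → (∀ i → ls i ≡ []) → size n ls ≡ 0
size-empty n e = n≤0⇒n≡0 (≤-trans (sumTo-const n (λ {i} _ → ≤-reflexive (cong length (e i)))) (≤-reflexive (*-zeroʳ n)))

-- The machine has no equality test; the program adds both truncated differences instead.
distance-0 : ∀ {a b} → (a ∸ b) + (b ∸ a) ≡ 0 → a ≡ b
distance-0 {a} {b} e = ≤-antisym (m∸n≡0⇒m≤n (m+n≡0⇒m≡0 (a ∸ b) e)) (m∸n≡0⇒m≤n (m+n≡0⇒n≡0 (a ∸ b) e))

distance-≢0 : ∀ {a b} → (a ∸ b) + (b ∸ a) ≢ 0 → a ≢ b
distance-≢0 {a} ne refl = ne (cong₂ _+_ (n∸n≡0 a) (n∸n≡0 a))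

m∸n≢0⇒n<m′ : ∀ {m n} → m ∸ n ≢ 0 → n < m
m∸n≢0⇒n<m′ {m} {n} ne = ≰⇒> λ le → ne (m≤n⇒m∸n≡0 le)

-- The arrays that sparsification leaves alone.
Frame : Set₁
Frame = (inp par dep lvl go : ℕ → ℕ) → Set

holds : Frame → Store 27 → Set
holds P σ = P (σ IN) (σ PAR) (σ DEP) (σ LVL) (σ GO)

-- The word bound, and arithmetic of multiples of n(k + 1)

module Machine {n k : ℕ} (streams : ℕ → List (Edge n)) (1≤n : 1 ≤ n) (1≤k : 1 ≤ k) where

  keptIn : Store 27 → List (ℕ × ℕ)
  keptIn σ = pairs (σ KU) (σ KV) (σ KC 0)

  cells : ℕ
  cells = n * suc k

  -- The estimates for stored values never exceed `5 * cells`. The factor is rounded up to the cube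
  -- of 2, which is at most the cube of n once n is at least 2.
  W : ℕ
  W = 8 * cells

  n≤cells : n ≤ cells
  n≤cells = m≤m*n n (suc k)

  1+k≤cells : 1 + k ≤ cells
  1+k≤cells = m≤n*m (suc k) n {{>-nonZero 1≤n}}

  2≤cells : 2 ≤ cells
  2≤cells = ≤-trans (s≤s 1≤k) 1+k≤cells

  within : ∀ {x} i {_ : T (i ≤ᵇ 8)} → x ≤ i * cells → x ≤ W
  within i {i≤8} le = ≤-trans le (*-monoˡ-≤ cells (≤ᵇ⇒≤ i 8 i≤8))

  4≤W : 4 ≤ W
  4≤W = within 2 (*-monoʳ-≤ 2 2≤cells)

  open Logic {n} streams W 4≤W {27} public

  3+k≤W : 3 + k ≤ W
  3+k≤W = within 2 (≤-trans (+-mono-≤ 2≤cells 1+k≤cells) (≤-reflexive (cong (cells +_) (sym (+-identityʳ cells)))))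

  -- As a record it keeps the coefficient visible to unification: coefficients are added up along an
  -- expression, and the closed total is then compared with a numeral by computation.
  record _≲_ (x i : ℕ) : Set where
    constructor ⌈_⌉
    field bounded-by : x ≤ i * cells
  open _≲_ public

  infix  4 _≲_
  infixl 5 _⊹_
  _⊹_ : ∀ {x y i j} → x ≲ i → y ≲ j → x + y ≲ i + j
  _⊹_ {i = i} {j} ⌈ p ⌉ ⌈ q ⌉ = ⌈ ≤-trans (+-mono-≤ p q) (≤-reflexive (sym (*-distribʳ-+ cells i j))) ⌉

  constant : ∀ i → i ≲ i
  constant i = ⌈ m≤m*n i cells {{>-nonZero (≤-trans (s≤s z≤n) 2≤cells)}} ⌉

  times : ∀ i {m} b → m ≲ i → m * b ≲ i * b
  times i b ⌈ le ⌉ = ⌈ ≤-trans (*-monoˡ-≤ b le) (≤-reflexive (trans (*-assoc i cells b)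
    (trans (cong (i *_) (*-comm cells b)) (sym (*-assoc i b cells))))) ⌉

  exact : ∀ i → i * cells ≲ i
  exact i = ⌈ ≤-refl ⌉

  grow : ∀ {x i j} → i ≤ j → x ≲ i → x ≲ j
  grow le ⌈ p ⌉ = ⌈ ≤-trans p (*-monoˡ-≤ cells le) ⌉

  n≲1 : n ≲ 1
  n≲1 = ⌈ ≤-trans n≤cells (m≤m+n cells 0) ⌉

-- The sparsification code meets its specification

module Sparsification {n k : ℕ} (streams : ℕ → List (Edge n)) (1≤n : 1 ≤ n) (1≤k : 1 ≤ k) (P : Frame)
  (P-n : ∀ {σ} → holds P σ → σ IN 0 ≡ n) (P-k : ∀ {σ} → holds P σ → σ IN 1 ≡ k)
  (adj₀ : ℕ → List ℕ) (adj₀-sym : ∀ {x y} → y ∈ adj₀ x → x ∈ adj₀ y)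
  (adj₀-bound : ∀ {x y} → y ∈ adj₀ x → x < n) (c₀ : ℕ) where
  open Machine {n} {k} streams 1≤n 1≤k
  open MaximumAdjacency n k adj₀ adj₀-sym adj₀-bound

  -- `nodes` keeps the bucket storage linear in `cells`: the reset creates one node per vertex, the
  -- search one per kept edge.
  record Searching (m : ℕ) (σ : Store 27) : Set where
    field
      adj bkt : ℕ → List ℕ
      arcs    : Linked (σ HEAD) (σ DST) (σ NXT) c₀ adj
      buckets : Linked (σ BH) (σ BV) (σ BN) (σ NC 0) bkt
      search  : Search adj bkt (σ LEV) (σ LAST) (σ CUR 0) (σ L 0) (keptIn σ)
      nodes   : σ NC 0 ≤ n + σ KC 0
      pot     : potential adj bkt (σ LEV) (σ L 0) ≤ m
      frame   : holds P σ

  searchStep : ∀ m σ → Searching m σ → σ L 0 ≢ 0 →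
               Triple searchBody σ 0 100 (Below Searching m)
  searchStep m σ inv L≢0 with σ HEAD (σ CUR 0) ≟ 0
  ... | no h = slower (≤ᵇ⇒≤ _ 100 tt) (ifTrue h (blockThen (tt , tt) process))
    where
      open Searching inv
      w : ℕ
      w = σ DST (σ HEAD (σ CUR 0))
      popped : ∃[ l ] adj (σ CUR 0) ≡ w ∷ l ×
               Linked (upd (σ HEAD) (σ CUR 0) (σ NXT (σ HEAD (σ CUR 0)))) (σ DST) (σ NXT) c₀ (upd adj (σ CUR 0) l)
      popped = linked-pop (σ CUR 0) arcs h
      l = proj₁ popped
      eq = proj₁ (proj₂ popped)
      arcs′ = proj₂ (proj₂ popped)
      skipped : top ≤ σ LEV w ⊎ σ LAST w ≡ σ CUR 0 →
                Below Searching m (exec fetch σ)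
      skipped red = _ , <-≤-trans (potential-skip search eq) pot , record
        { adj = upd adj (σ CUR 0) l ; bkt = bkt ; arcs = arcs′ ; buckets = buckets
        ; search = scan-skip search eq red ; nodes = nodes ; pot = ≤-refl ; frame = frame }
      process : Triple _ (exec fetch σ) 0 _ (Below Searching m)
      process with (2 + σ IN 1) ∸ σ LEV w ≟ 0
      ... | yes e = slower (≤ᵇ⇒≤ _ 80 tt) (ifFalse e (block tt
            (skipped (inj₁ (subst (λ z → 2 + z ≤ σ LEV w) (P-k {σ} frame) (m∸n≡0⇒m≤n e))))))
      ... | no ne with (σ LAST w ∸ σ CUR 0) + (σ CUR 0 ∸ σ LAST w) ≟ 0
      ...   | yes e = slower (≤ᵇ⇒≤ _ 80 tt) (ifTrue ne (ifFalse e (block tt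
              (skipped (inj₂ (distance-0 e))))))
      ...   | no ne′ = slower (≤ᵇ⇒≤ _ 80 tt) (ifTrue ne (ifTrue ne′ (block {c = keep}
              (tt , lev≤W , tt , tt , tt , kc≤W , nc≤W , tt , tt , tt)
              (_ , <-≤-trans (potential-keep search eq lt) pot , record
                { adj = upd adj (σ CUR 0) l ; bkt = upd bkt (suc (σ LEV w)) (w ∷ bkt (suc (σ LEV w)))
                ; arcs = arcs′ ; buckets = linked-push (suc (σ LEV w)) w buckets
                ; search = subst (Search _ _ _ _ _ _) (sym (pairs-push (σ KU) (σ KV) (σ KC 0))) kept
                ; nodes = nodes′ ; pot = ≤-refl ; frame = frame }))))
        where
          lt : σ LEV w < top
          lt = subst (λ z → σ LEV w < 2 + z) (P-k {σ} frame) (m∸n≢0⇒n<m′ ne)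
          kept : Search (upd adj (σ CUR 0) l) (upd bkt (suc (σ LEV w)) (w ∷ bkt (suc (σ LEV w))))
                   (upd (σ LEV) w (suc (σ LEV w))) (upd (σ LAST) w (σ CUR 0)) (σ CUR 0) (σ L 0)
                   ((σ CUR 0 , w) ∷ keptIn σ)
          kept = scan-keep search eq lt (distance-≢0 ne′)
          lev≤W : suc (σ LEV w) ≤ W
          lev≤W = ≤-trans lt (≤-trans (n≤1+n _) 3+k≤W)
          kc : suc (σ KC 0) ≤ cells
          kc = ≤-trans (≤-reflexive (cong suc (sym (length-pairs (σ KU) (σ KV) (σ KC 0))))) (finished-size kept)
          kc≤W : suc (σ KC 0) ≤ W
          kc≤W = within 1 (≤-trans kc (m≤m+n cells 0))
          nodes′ : suc (σ NC 0) ≤ n + suc (σ KC 0)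
          nodes′ = ≤-trans (s≤s nodes) (≤-reflexive (sym (+-suc n (σ KC 0))))
          nc≤W : suc (σ NC 0) ≤ W
          nc≤W = within 2 (≤-trans nodes′ (+-mono-≤ n≤cells (≤-trans kc (m≤m+n cells 0))))
  ... | yes h with σ BH (σ L 0) ≟ 0
  ...   | yes b = slower (≤ᵇ⇒≤ _ 100 tt) (ifFalse h (ifFalse b (block {c = L ≔ var L ∸′ lit 1} tt
            (_ , <-≤-trans (potential-lower search L≢0) pot , record
              { adj = adj ; bkt = bkt ; arcs = arcs ; buckets = buckets
              ; search = lower search (linked-empty (σ CUR 0) arcs h) (linked-empty (σ L 0) buckets b)
              ; nodes = nodes ; pot = ≤-refl ; frame = frame }))))
    where open Searching inv
  ...   | no b = slower (≤ᵇ⇒≤ _ 100 tt) (ifFalse h (ifTrue b (blockThen (tt , tt) process)))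
    where
      open Searching inv
      idle : adj (σ CUR 0) ≡ []
      idle = linked-empty (σ CUR 0) arcs h
      y : ℕ
      y = σ BV (σ BH (σ L 0))
      popped : ∃[ l ] bkt (σ L 0) ≡ y ∷ l ×
               Linked (upd (σ BH) (σ L 0) (σ BN (σ BH (σ L 0)))) (σ BV) (σ BN) (σ NC 0) (upd bkt (σ L 0) l)
      popped = linked-pop (σ L 0) buckets b
      l = proj₁ popped
      eq = proj₁ (proj₂ popped)
      process : Triple (cond (lit 3 ∔ K ∸′ LEV [ var Y ]) scan skip) (exec take σ) 0 _ (Below Searching m)
      process with (3 + σ IN 1) ∸ σ LEV y ≟ 0
      ... | yes e = slower (≤ᵇ⇒≤ _ 80 tt) (ifFalse e (block tt
            (_ , <-≤-trans (potential-drop search eq) pot , record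
              { adj = adj ; bkt = upd bkt (σ L 0) l ; arcs = arcs ; buckets = proj₂ (proj₂ popped)
              ; search = pop-drop search idle eq (subst (λ z → 3 + z ≤ σ LEV y) (P-k {σ} frame) (m∸n≡0⇒m≤n e))
              ; nodes = nodes ; pot = ≤-refl ; frame = frame })))
      ... | no ne = slower (≤ᵇ⇒≤ _ 80 tt) (ifTrue ne (block {c = scan}
            (subst (λ z → 3 + z ≤ W) (sym k≡) 3+k≤W , tt , subst (λ z → 2 + z ≤ W) (sym k≡) (≤-trans (n≤1+n _) 3+k≤W))
            (_ , <-≤-trans (potential-scan search eq le) pot , record
              { adj = adj ; bkt = upd bkt (σ L 0) l ; arcs = arcs ; buckets = proj₂ (proj₂ popped)
              ; search = subst (λ z → Search adj (upd bkt (σ L 0) l) (upd (σ LEV) y (3 + z)) (σ LAST) y (2 + z) ks)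
                              (sym k≡) (pop-scan search idle eq le)
              ; nodes = nodes
              ; pot = ≤-reflexive (cong (λ z → potential adj (upd bkt (σ L 0) l) (upd (σ LEV) y (3 + z)) (2 + z)) k≡)
              ; frame = frame })))
        where
          k≡ : σ IN 1 ≡ k
          k≡ = P-k {σ} frame
          ks = keptIn σ
          le : σ LEV y ≤ top
          le = ≤-pred (subst (λ z → σ LEV y < 3 + z) k≡ (m∸n≢0⇒n<m′ ne))

  record Resetting (m : ℕ) (σ : Store 27) : Set where
    field
      bkt     : ℕ → List ℕ
      arcs    : Linked (σ HEAD) (σ DST) (σ NXT) c₀ adj₀
      buckets : Linked (σ BH) (σ BV) (σ BN) (σ NC 0) bkt
      levels  : ∀ {v} → v < n → σ I 0 ≤ v → σ LEV v ≡ 1 × σ LAST v ≡ n × v ∈ bkt 1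
      entries : ∀ {y ℓ} → y ∈ bkt ℓ → y < n × ℓ ≡ 1
      nodes   : σ NC 0 + σ I 0 ≡ n
      size≤   : size (suc top) bkt ≤ σ NC 0
      pot     : σ I 0 ≤ m
      frame   : holds P σ

  resetStep : ∀ m σ → Resetting m σ → σ I 0 ≢ 0 →
              Triple resetBody σ 0 60 (Below Resetting m)
  resetStep m σ inv I≢0 = slower (≤ᵇ⇒≤ _ 60 tt) (block {c = resetBody}
    (tt , tt , tt , nc≤W , tt , tt , tt)
    (i , <-≤-trans i< pot , record
      { bkt = upd bkt 1 (i ∷ bkt 1)
      ; arcs = arcs ; buckets = linked-push 1 i buckets
      ; levels = levels′ ; entries = entries′
      ; nodes = nodes′
      ; size≤ = ≤-trans (≤-reflexive (size-push (suc top) bkt (s≤s (s≤s z≤n)))) (s≤s size≤)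
      ; pot = ≤-refl ; frame = frame }))
    where
      open Resetting inv
      i : ℕ
      i = σ I 0 ∸ 1
      suc-i : suc i ≡ σ I 0
      suc-i = suc-pred (σ I 0) {{≢-nonZero I≢0}}
      i< : i < σ I 0
      i< = ≤-reflexive suc-i
      nodes′ : suc (σ NC 0) + i ≡ n
      nodes′ = trans (sym (+-suc (σ NC 0) i)) (trans (cong (σ NC 0 +_) suc-i) nodes)
      nc≤W : suc (σ NC 0) ≤ W
      nc≤W = within 1 (≤-trans (m+n≤o⇒m≤o (suc (σ NC 0)) (≤-reflexive nodes′)) (≤-trans n≤cells (m≤m+n cells 0)))
      i<n : i < n
      i<n = ≤-trans i< (m+n≤o⇒n≤o (σ NC 0) (≤-reflexive nodes))
      levels′ : ∀ {v} → v < n → i ≤ v → upd (σ LEV) i 1 v ≡ 1 × upd (σ LAST) i (σ IN 0) v ≡ n × v ∈ upd bkt 1 (i ∷ bkt 1) 1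
      levels′ {v} v< le with i ≟ v
      ... | yes refl = upd-≡ (σ LEV) {i} refl , trans (upd-≡ (σ LAST) {i} refl) (P-n {σ} frame) , ∈-push-new {bkt} {1}
      ... | no ne with levels v< (≤-trans (≤-reflexive (sym suc-i)) (≤∧≢⇒< le ne))
      ...   | a , b , c = trans (upd-≢ (σ LEV) ne) a , trans (upd-≢ (σ LAST) ne) b , ∈-push-old {bkt} {1} {i} {1} c
      entries′ : ∀ {y ℓ} → y ∈ upd bkt 1 (i ∷ bkt 1) ℓ → y < n × ℓ ≡ 1
      entries′ {y} {ℓ} m with ∈-push⁻ {bkt} {1} {i} {ℓ} {y} m
      ... | inj₁ (refl , refl) = i<n , refl
      ... | inj₂ m′ = entries m′

  -- `count` reserves two arcs for every kept edge still waiting, so the refilled buffer ends with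
  -- at most `2 * cells` arcs.
  record Reinserting (ks : List (ℕ × ℕ)) (m : ℕ) (σ : Store 27) : Set where
    field
      adj     : ℕ → List ℕ
      buffer  : Buffer n (σ HEAD) (σ DST) (σ NXT) (σ CNT 0) adj
      count   : σ CNT 0 + 2 * σ KC 0 ≤ 2 * cells
      idle    : ∀ ℓ → σ BH ℓ ≡ 0
      sound   : ∀ {x y} → y ∈ adj x → Kept ks x y
      rest    : ∀ {e} → e ∈ keptIn σ → e ∈ ks
      done    : ∀ {x y} → (x , y) ∈ ks → y ∈ adj x ⊎ (x , y) ∈ keptIn σ
      pot     : σ KC 0 ≤ m
      frame   : holds P σ

  reinsertStep : ∀ {ks} → (∀ {x y} → (x , y) ∈ ks → x < n × y < n) → ∀ m σ → Reinserting ks m σ → σ KC 0 ≢ 0 →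
                 Triple reinsertBody σ 0 60 (Below (Reinserting ks) m)
  reinsertStep {ks} ks-bound m σ inv KC≢0 = slower (≤ᵇ⇒≤ _ 60 tt) (block {c = reinsertBody}
    (tt , tt , tt , (≤-trans (n≤1+n _) cnt≤W , tt , tt , tt) , (cnt≤W , tt , tt , tt))
    (c , <-≤-trans (≤-reflexive suc-c) pot , record
      { adj = addEdge u v adj
      ; buffer = buffer-insert (proj₁ uv<) (proj₂ uv<) buffer
      ; count = count′
      ; idle = idle
      ; sound = sound′
      ; rest = λ {e} m → rest (subst (e ∈_) (sym split) (there m))
      ; done = done′
      ; pot = ≤-refl ; frame = frame }))
    where
      open Reinserting inv
      c u v : ℕ
      c = σ KC 0 ∸ 1
      u = σ KU c
      v = σ KV c
      suc-c : suc c ≡ σ KC 0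
      suc-c = suc-pred (σ KC 0) {{≢-nonZero KC≢0}}
      split : keptIn σ ≡ (u , v) ∷ pairs (σ KU) (σ KV) c
      split = cong (pairs (σ KU) (σ KV)) (sym suc-c)
      uv∈ : (u , v) ∈ ks
      uv∈ = rest (subst ((u , v) ∈_) (sym split) (here refl))
      uv< : u < n × v < n
      uv< = ks-bound uv∈
      count′ : suc (suc (σ CNT 0)) + 2 * c ≤ 2 * cells
      count′ = ≤-trans (≤-reflexive (trans (sym (trans (+-suc (σ CNT 0) (suc (2 * c))) (cong suc (+-suc (σ CNT 0) (2 * c)))))
                 (cong (σ CNT 0 +_) (trans (sym (*-suc 2 c)) (cong (2 *_) suc-c))))) count
      cnt≤W : suc (suc (σ CNT 0)) ≤ W
      cnt≤W = within 2 (m+n≤o⇒m≤o (suc (suc (σ CNT 0))) count′)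
      sound′ : ∀ {x y} → y ∈ addEdge u v adj x → Kept ks x y
      sound′ {x} {y} m with addEdge⁻ {adj} {u} {v} {x} {y} m
      ... | inj₁ (refl , refl)        = inj₁ uv∈
      ... | inj₂ (inj₁ (refl , refl)) = inj₂ uv∈
      ... | inj₂ (inj₂ m′)            = sound m′
      done′ : ∀ {x y} → (x , y) ∈ ks → y ∈ addEdge u v adj x ⊎ (x , y) ∈ pairs (σ KU) (σ KV) c
      done′ {x} {y} m with done m
      ... | inj₁ m′ = inj₁ (addEdge-old {adj} {u} {v} {x} m′)
      ... | inj₂ m′ with subst ((x , y) ∈_) split m′
      ...   | here refl = inj₁ (addEdge-uv {adj} {u} {v})
      ...   | there m″  = inj₂ m″

  record Sparsified (σ : Store 27) : Set where
    field
      adj    : ℕ → List ℕ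
      buffer : Buffer n (σ HEAD) (σ DST) (σ NXT) (σ CNT 0) adj
      count  : σ CNT 0 ≤ 2 * cells
      idle   : ∀ ℓ → σ BH ℓ ≡ 0
      adj⊆   : ∀ {x y} → y ∈ adj x → y ∈ adj₀ x
      safe   : ∀ {x y} → y ∈ adj₀ x → Inseparable (λ x y → y ∈ adj x) k x y
      frame  : holds P σ

  sparsify-time : ∀ a b c d e f g h i →
    a + (n * b + c + (d + (15 * cells * e + f + (g + (cells * h + i))))) ≲
    a + (1 * b + c + (d + (15 * e + f + (g + (1 * h + i)))))
  sparsify-time a b c d e f g h i =
    constant a ⊹ (times 1 b n≲1 ⊹ constant c ⊹ (constant d ⊹ (times 15 e (exact 15) ⊹ constant f ⊹
      (constant g ⊹ (times 1 h ⌈ m≤m+n cells 0 ⌉ ⊹ constant i)))))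

  sparsifying : ∀ {σ} → holds P σ → Linked (σ HEAD) (σ DST) (σ NXT) c₀ adj₀ → (∀ ℓ → σ BH ℓ ≡ 0) →
                size n adj₀ ≤ suc (4 * cells) → Triple sparsify σ 0 (2000 * cells) Sparsified
  sparsifying {σ} frame₀ arcs₀ idle₀ small = slower
    (bounded-by (grow (≤ᵇ⇒≤ _ 2000 tt) (sparsify-time (cost {μ = local} (NC ≔ lit 0 ⨾ I ≔ N)) (2 + 60) 2
               (cost {μ = local} (KC ≔ lit 0 ⨾ CUR ≔ N ⨾ L ≔ lit 2 ∔ K)) (2 + 100) 2 (cost {μ = local} (CNT ≔ lit 0)) (2 + 60) 2)))
    (blockThen {c = NC ≔ lit 0 ⨾ I ≔ N} (tt , tt)
      (loop (var I) resetBody tt 60 Resetting resetStep {n} resetting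
      thenₜ λ { {σ₁} (I≡0 , _ , r) → blockThen {c = KC ≔ lit 0 ⨾ CUR ≔ N ⨾ L ≔ lit 2 ∔ K}
        (tt , tt , subst (λ z → 2 + z ≤ W) (sym (P-k {σ₁} (Resetting.frame r))) (≤-trans (n≤1+n _) 3+k≤W))
      (loop (var L) searchBody tt 100 Searching searchStep (searching I≡0 r)
      thenₜ λ { {σ₂} (L≡0 , _ , s) → blockThen {c = CNT ≔ lit 0} tt
      (weaken {c = while (var KC) reinsertBody} (λ { (K≡0 , _ , f) → finish L≡0 s K≡0 f })
        (loop (var KC) reinsertBody tt 60 (Reinserting (pairs (σ₂ KU) (σ₂ KV) (σ₂ KC 0)))
          (reinsertStep (ks-bound s)) {cells} (reinserting L≡0 s))) }) }))
    where
      ended : ∀ {σ m} → σ L 0 ≡ 0 → (s : Searching m σ) →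
              Search (Searching.adj s) (Searching.bkt s) (σ LEV) (σ LAST) (σ CUR 0) 0 (keptIn σ)
      ended {σ} L≡0 s = subst (λ z → Search (Searching.adj s) (Searching.bkt s) (σ LEV) (σ LAST) (σ CUR 0) z
        (keptIn σ)) L≡0 (Searching.search s)

      no-adj : ∀ {σ m} → σ L 0 ≡ 0 → (s : Searching m σ) → ∀ x → Searching.adj s x ≡ []
      no-adj L≡0 s = finished-adj (ended L≡0 s)

      ks-bound : ∀ {m σ} → Searching m σ → ∀ {x y} → (x , y) ∈ keptIn σ → x < n × y < n
      ks-bound s m = let m′ = Search.kept⊆ (Searching.search s) m in adj₀-bound m′ , adj₀-bound (adj₀-sym m′)

      ks-size : ∀ {m σ} → Searching m σ → σ KC 0 ≤ cells
      ks-size {σ = σ} s = ≤-trans (≤-reflexive (sym (length-pairs (σ KU) (σ KV) (σ KC 0)))) (finished-size (Searching.search s))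

      resetting : Resetting n (exec {μ = local} (NC ≔ lit 0 ⨾ I ≔ N) σ)
      resetting = record
        { bkt = λ _ → [] ; arcs = arcs₀
        ; buckets = λ ℓ → subst (λ p → Chain (σ BV) (σ BN) 0 p []) (sym (idle₀ ℓ)) nil
        ; levels = λ v< le → contradiction v< (≤⇒≯ (≤-trans (≤-reflexive (sym (P-n {σ} frame₀))) le))
        ; entries = λ ()
        ; nodes = P-n {σ} frame₀
        ; size≤ = ≤-reflexive (size-empty (suc top) (λ _ → refl))
        ; pot = ≤-reflexive (P-n {σ} frame₀)
        ; frame = frame₀
        }

      -- The coefficient is 10 for the arcs, 1 for the bucket entries, 2 for the unscanned vertices
      -- and 2 for `L`.
      potential-start : ∀ bkt lev → size (suc top) bkt ≤ n → potential adj₀ bkt lev top ≤ 15 * cells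
      potential-start bkt lev le = bounded-by (arcs≲ ⊹ entries≲ ⊹ unscanned≲ ⊹ top≲)
        where
          arcs≲ : 2 * size n adj₀ ≲ 10
          arcs≲ = ⌈ begin
            2 * size n adj₀          ≤⟨ *-monoʳ-≤ 2 small ⟩
            2 * suc (4 * cells)      ≡⟨ *-suc 2 (4 * cells) ⟩
            2 + 2 * (4 * cells)      ≡⟨ cong (2 +_) (*-assoc 2 4 cells) ⟨
            2 + 8 * cells            ≤⟨ bounded-by (constant 2 ⊹ exact 8) ⟩
            10 * cells               ∎ ⌉
            where open ≤-Reasoning
          entries≲ : size (suc top) bkt ≲ 1
          entries≲ = ⌈ ≤-trans le (bounded-by n≲1) ⌉
          top≲ : top ≲ 2
          top≲ = constant 1 ⊹ ⌈ ≤-trans 1+k≤cells (m≤m+n cells 0) ⌉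
          unscanned≲ : top * unscanned# lev ≲ 2
          unscanned≲ = ⌈ begin
            top * unscanned# lev  ≤⟨ *-monoʳ-≤ top (sumTo-const n (λ {v} _ → m∸n≤m 1 (aboveBit top (lev v)))) ⟩
            top * (n * 1)         ≡⟨ cong (top *_) (*-identityʳ n) ⟩
            n + suc k * n         ≤⟨ +-mono-≤ n≤cells (≤-reflexive (*-comm (suc k) n)) ⟩
            cells + cells         ≡⟨ cong (cells +_) (+-identityʳ cells) ⟨
            2 * cells             ∎ ⌉
            where open ≤-Reasoning

      searching : ∀ {m σ} → σ I 0 ≡ 0 → Resetting m σ →
                  Searching (15 * cells) (exec {μ = local} (KC ≔ lit 0 ⨾ CUR ≔ N ⨾ L ≔ lit 2 ∔ K) σ)
      searching {σ = σ} I≡0 r = record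
        { adj = adj₀ ; bkt = bkt ; arcs = arcs ; buckets = buckets
        ; search = subst₂ (λ cur l → Search adj₀ bkt (σ LEV) (σ LAST) cur (2 + l) []) (sym (P-n {σ} frame)) (sym (P-k {σ} frame))
            (start (λ v< → proj₁ (at v<)) (λ v< → proj₁ (proj₂ (at v<))) (λ v< → proj₂ (proj₂ (at v<))) entries)
        ; nodes = ≤-trans nc≤n (m≤m+n n 0)
        ; pot = subst (λ l → potential adj₀ bkt (σ LEV) (2 + l) ≤ 15 * cells) (sym (P-k {σ} frame))
            (potential-start bkt (σ LEV) (≤-trans size≤ nc≤n))
        ; frame = frame
        }
        where
          open Resetting r
          at : ∀ {v} → v < n → σ LEV v ≡ 1 × σ LAST v ≡ n × v ∈ bkt 1
          at {v} v< = levels v< (subst (_≤ v) (sym I≡0) z≤n)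
          nc≤n : σ NC 0 ≤ n
          nc≤n = m+n≤o⇒m≤o (σ NC 0) (≤-reflexive nodes)

      reinserting : ∀ {m σ} → σ L 0 ≡ 0 → Searching m σ →
                    Reinserting (keptIn σ) cells (exec {μ = local} (CNT ≔ lit 0) σ)
      reinserting {σ = σ} L≡0 s = record
        { adj = adj
        ; buffer = record
          { linked = linked-reset arcs (no-adj L≡0 s)
          ; size≤ = ≤-reflexive (size-empty n (no-adj L≡0 s))
          ; sym-arc = λ m → contradiction m (no-∈ (no-adj L≡0 s _))
          ; bound = λ m → contradiction m (no-∈ (no-adj L≡0 s _))
          }
        ; count = *-monoʳ-≤ 2 (ks-size s)
        ; idle = λ ℓ → linked-nonempty ℓ buckets
            (finished-bkt (ended L≡0 s) ℓ)
        ; sound = λ m → contradiction m (no-∈ (no-adj L≡0 s _))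
        ; rest = λ m → m
        ; done = inj₂
        ; pot = ks-size s
        ; frame = frame
        }
        where open Searching s

      finish : ∀ {m m′ σ σ′} → σ L 0 ≡ 0 → Searching m σ → σ′ KC 0 ≡ 0 →
               Reinserting (keptIn σ) m′ σ′ → Sparsified σ′
      finish {σ = σ} {σ′} L≡0 s K≡0 r = record
        { adj = R.adj
        ; buffer = R.buffer
        ; count = m+n≤o⇒m≤o (σ′ CNT 0) R.count
        ; idle = R.idle
        ; adj⊆ = λ m → kept-arc (R.sound m)
        ; safe = λ m S len s∉ t∉ → conn-map kept-in
            (finished-safe (ended L≡0 s) m S len s∉ t∉)
        ; frame = R.frame
        }
        where
          module R = Reinserting r
          module S₀ = Searching s
          kept-arc : ∀ {x y} → Kept (keptIn σ) x y → y ∈ adj₀ x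
          kept-arc (inj₁ m) = Search.kept⊆ S₀.search m
          kept-arc (inj₂ m) = adj₀-sym (Search.kept⊆ S₀.search m)
          all-done : ∀ {x y} → (x , y) ∈ keptIn σ → y ∈ R.adj x
          all-done {x} {y} m with R.done m
          ... | inj₁ m′ = m′
          ... | inj₂ m′ with () ← subst (λ c → (x , y) ∈ pairs (σ′ KU) (σ′ KV) c) K≡0 m′
          kept-in : ∀ {x y} → Kept (keptIn σ) x y → y ∈ R.adj x
          kept-in (inj₁ m) = all-done m
          kept-in (inj₂ m) = Buffer.sym-arc R.buffer (all-done m)

-- Reading a stream and rebuilding the tree

Joins : ∀ {n} → Edge n → ℕ → ℕ → Set
Joins (u , v) x y = (toℕ u ≡ x × toℕ v ≡ y) ⊎ (toℕ u ≡ y × toℕ v ≡ x)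

Pending : ∀ {n} → List (Edge n) → ℕ → ℕ → Set
Pending es x y = Any (λ e → Joins e x y) es

module Rounds {n k : ℕ} (streams : ℕ → List (Edge n)) (1≤n : 1 ≤ n) (1≤k : 1 ≤ k)
  (E : ℕ → ℕ → Set) (E-sym : ∀ {u v} → E u v → E v u) (E-bound : ∀ {u v} → E u v → u < n)
  (stream-sound : ∀ q {u v} → (u , v) ∈ streams q → E (toℕ u) (toℕ v))
  (stream-complete : ∀ q {x y} → E x y → Pending (streams q) x y)
  (m : ℕ) (stream-length : ∀ q → length (streams q) ≡ m) where

  open Machine {n} {k} streams 1≤n 1≤k public
  open Levels n E E-sym E-bound public

  record Ready (D : ℕ) (inp par dep lvl go : ℕ → ℕ) : Set where
    field
      n≡   : inp 0 ≡ n
      k≡   : inp 1 ≡ k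
      level : lvl 0 ≡ D
      tree : Levelled (lvl 0) par dep
      more : ∃[ v ] v < n × lvl 0 < dep v

  Arc : (ℕ → List ℕ) → ℕ → ℕ → Set
  Arc adj x y = y ∈ adj x

  Covered : (lvl dep : ℕ → ℕ) → List (Edge n) → (ℕ → List ℕ) → Set
  Covered lvl dep es adj =
    ∀ {x y} → E x y → lvl 0 ≤ dep x → lvl 0 ≤ dep y → Pending es x y ⊎ Inseparable (Arc adj) k x y

  -- φ pays for a future sparsification: 2000 steps per stored arc.
  record Reading (D : ℕ) (es : List (Edge n)) (φ : ℕ) (σ : Store 27) : Set where
    field
      adj    : ℕ → List ℕ
      buffer : Buffer n (σ HEAD) (σ DST) (σ NXT) (σ CNT 0) adj
      count  : σ CNT 0 < 4 * cells
      pays   : 2000 * σ CNT 0 ≤ φ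
      idle   : ∀ ℓ → σ BH ℓ ≡ 0
      ready  : holds (Ready D) σ
      sound  : ∀ {u v} → (u , v) ∈ es → E (toℕ u) (toℕ v)
      arcs   : ∀ {x y} → y ∈ adj x → E x y × σ LVL 0 ≤ σ DEP x
      done   : Covered (σ LVL) (σ DEP) es adj

  -- Besides its own processing, an edge prepays 2000 for each of the two arcs it may add.
  edgeTime : ℕ
  edgeTime = 100 + 2 * 2000

  readStep : ∀ {D} u v es φ σ → Reading D ((u , v) ∷ es) φ σ →
             ∃[ t ] Triple edgeBody ((σ [ U , 0 ↦ toℕ u ]) [ V , 0 ↦ toℕ v ]) 0 t
               (λ σ′ → Σ[ φ′ ∈ ℕ ] t + φ′ ≤ edgeTime + φ × Reading D es φ′ σ′)
  readStep {D} u v es φ σ r = accept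
    where
      open Reading r
      σ₁ : Store 27
      σ₁ = (σ [ U , 0 ↦ toℕ u ]) [ V , 0 ↦ toℕ v ]
      x₀ y₀ : ℕ
      x₀ = toℕ u
      y₀ = toℕ v
      edge₀ : E x₀ y₀
      edge₀ = sound (here refl)

      Result : ℕ → Store 27 → Set
      Result t σ′ = Σ[ φ′ ∈ ℕ ] t + φ′ ≤ edgeTime + φ × Reading D es φ′ σ′

      ignored : (σ DEP x₀ < σ LVL 0 ⊎ σ DEP y₀ < σ LVL 0) → Reading D es φ σ₁
      ignored shallow = record
        { adj = adj ; buffer = buffer ; count = count ; pays = pays ; idle = idle ; ready = ready
        ; sound = sound ∘ there ; arcs = arcs ; done = done′ }
        where
          deep : ∀ {a b l} → l ≤ a → l ≤ b → ¬ (a < l ⊎ b < l)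
          deep la lb = λ { (inj₁ lt) → <⇒≱ lt la ; (inj₂ lt) → <⇒≱ lt lb }
          done′ : Covered (σ LVL) (σ DEP) es adj
          done′ e dx dy with done e dx dy
          ... | inj₂ h         = inj₂ h
          ... | inj₁ (there p) = inj₁ p
          ... | inj₁ (here (inj₁ (refl , refl))) = contradiction shallow (deep dx dy)
          ... | inj₁ (here (inj₂ (refl , refl))) = contradiction shallow (deep dy dx)

      cheap : ∀ {σ′ t} → t ≤ 100 → Reading D es φ σ′ → Result t σ′
      cheap le r = φ , +-monoˡ-≤ φ (≤-trans le (m≤m+n 100 (2 * 2000))) , r

      module _ (dx : σ LVL 0 ≤ σ DEP x₀) (dy : σ LVL 0 ≤ σ DEP y₀) where
        adj₁ : ℕ → List ℕ
        adj₁ = addEdge x₀ y₀ adj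

        σ₂ : Store 27
        σ₂ = exec {μ = local} insert σ₁

        buffer₁ : Buffer n (σ₂ HEAD) (σ₂ DST) (σ₂ NXT) (suc (suc (σ CNT 0))) adj₁
        buffer₁ = buffer-insert (toℕ<n u) (toℕ<n v) buffer

        arcs₁ : ∀ {x y} → y ∈ adj₁ x → E x y × σ LVL 0 ≤ σ DEP x
        arcs₁ {x} {y} m with addEdge⁻ {adj} {x₀} {y₀} {x} {y} m
        ... | inj₁ (refl , refl)        = edge₀ , dx
        ... | inj₂ (inj₁ (refl , refl)) = E-sym edge₀ , dy
        ... | inj₂ (inj₂ m′)            = arcs m′

        done₁ : Covered (σ LVL) (σ DEP) es adj₁
        done₁ e dx dy with done e dx dy
        ... | inj₂ h = inj₂ λ S len s t →
                conn-map (λ {a} {b} → addEdge-old {adj} {x₀} {y₀} {a} {b}) (h S len s t)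
        ... | inj₁ (there p) = inj₁ p
        ... | inj₁ (here (inj₁ (refl , refl))) = inj₂ λ S len s t → (addEdge-uv {adj} {x₀} {y₀} , s , t) ◅ ε
        ... | inj₁ (here (inj₂ (refl , refl))) = inj₂ λ S len s t → (addEdge-vu {adj} {x₀} {y₀} , s , t) ◅ ε

        -- All that must survive the sparsification is put into the frame: the facts mention only
        -- arrays that it leaves alone, together with the arc lists from before it.
        P : Frame
        P inp par dep lvl go = Ready D inp par dep lvl go ×
          (∀ {x y} → y ∈ adj₁ x → E x y × lvl 0 ≤ dep x) ×
          Covered lvl dep es adj₁

        -- Two arcs arrive at once, so the buffer may overshoot its capacity by one; `sparsifying`
        -- allows for this.
        cnt≤ : suc (suc (σ CNT 0)) ≤ suc (4 * cells)
        cnt≤ = s≤s count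

        cnt≤W : suc (suc (σ CNT 0)) ≤ W
        cnt≤W = within 5 (≤-trans cnt≤ (+-monoˡ-≤ (4 * cells) (≤-trans (s≤s z≤n) 2≤cells)))

        cap≡ : 4 * (σ IN 0 * (1 + σ IN 1)) ≡ 4 * cells
        cap≡ = cong₂ (λ a b → 4 * (a * (1 + b))) (Ready.n≡ ready) (Ready.k≡ ready)

        roomy : suc (suc (σ CNT 0)) < 4 * cells → Result 100 σ₂
        roomy lt = φ + 2 * 2000 , ≤-reflexive (trans (cong (100 +_) (+-comm φ (2 * 2000))) (sym (+-assoc 100 (2 * 2000) φ))) , record
          { adj = adj₁ ; buffer = buffer₁ ; count = lt
          ; pays = ≤-trans (≤-reflexive (trans (*-distribˡ-+ 2000 2 (σ CNT 0)) (+-comm (2000 * 2) (2000 * σ CNT 0)))) (+-monoˡ-≤ (2 * 2000) pays)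
          ; idle = idle ; ready = ready ; sound = sound ∘ there ; arcs = arcs₁ ; done = done₁ }

        module M = Sparsification streams 1≤n 1≤k P (λ p → Ready.n≡ (proj₁ p)) (λ p → Ready.k≡ (proj₁ p))
                     adj₁ (Buffer.sym-arc buffer₁) (Buffer.bound buffer₁) (suc (suc (σ CNT 0)))

        compressed : 4 * cells ≤ suc (suc (σ CNT 0)) → ∀ {σ′} → M.Sparsified σ′ → Result (100 + 2000 * cells) σ′
        compressed full {σ′} s = 2000 * (2 * cells) , afford , record
          { adj = S.adj ; buffer = S.buffer
          ; count = ≤-<-trans S.count (*-monoˡ-< cells {{>-nonZero (≤-trans (s≤s z≤n) 2≤cells)}} (m≤m+n 3 1))
          ; pays = *-monoʳ-≤ 2000 S.count
          ; idle = S.idle ; ready = proj₁ S.frame ; sound = sound ∘ there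
          ; arcs = λ m → proj₁ (proj₂ S.frame) (S.adj⊆ m)
          ; done = done₂ }
          where
            module S = M.Sparsified s
            done₂ : Covered (σ′ LVL) (σ′ DEP) es S.adj
            done₂ e dx dy with proj₂ (proj₂ S.frame) e dx dy
            ... | inj₁ p = inj₁ p
            ... | inj₂ h = inj₂ λ S len s t → conn-bind len (λ m → S.safe m) (h S len s t)
            -- A full buffer holds 2000 for each of `4 * cells` arcs. At most `2 * cells` arcs
            -- survive and keep their share; what is released covers the cost twice.
            afford : 100 + 2000 * cells + 2000 * (2 * cells) ≤ edgeTime + φ
            afford = begin
              100 + 2000 * cells + 2000 * (2 * cells)   ≡⟨ +-assoc 100 (2000 * cells) _ ⟩
              100 + (2000 * cells + 2000 * (2 * cells)) ≡⟨ cong (100 +_) (*-distribˡ-+ 2000 cells (2 * cells)) ⟨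
              100 + 2000 * (3 * cells)                  ≤⟨ +-monoʳ-≤ 100 (*-monoʳ-≤ 2000 (*-monoˡ-≤ cells (m≤m+n 3 1))) ⟩
              100 + 2000 * (4 * cells)                  ≤⟨ +-monoʳ-≤ 100 (*-monoʳ-≤ 2000 full) ⟩
              100 + 2000 * (2 + σ CNT 0)                ≡⟨ cong (100 +_) (*-distribˡ-+ 2000 2 (σ CNT 0)) ⟩
              100 + (2 * 2000 + 2000 * σ CNT 0)         ≤⟨ +-monoʳ-≤ 100 (+-monoʳ-≤ (2 * 2000) pays) ⟩
              100 + (2 * 2000 + φ)                      ≡⟨ +-assoc 100 (2 * 2000) φ ⟨
              edgeTime + φ                              ∎
              where open ≤-Reasoning

        insertion : ∃[ t ] Triple edgeBody σ₁ 0 t (Result t)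
        insertion with 4 * (σ IN 0 * (1 + σ IN 1)) ∸ suc (suc (σ CNT 0)) ≟ 0
        ... | no ne = 100 , slower (≤ᵇ⇒≤ _ 100 tt) (ifFalse (m≤n⇒m∸n≡0 dx) (ifFalse (m≤n⇒m∸n≡0 dy)
                (blockThen {c = insert} ((≤-trans (n≤1+n _) cnt≤W , tt , tt , tt) , (cnt≤W , tt , tt , tt))
                  (ifTrue ne (block tt (roomy (subst (suc (suc (σ CNT 0)) <_) cap≡ (m∸n≢0⇒n<m′ ne))))))))
        ... | yes e = 100 + 2000 * cells , slower
                (+-monoˡ-≤ (2000 * cells) (≤ᵇ⇒≤ (steps (var LVL ∸′ DEP [ var U ]) + (steps (var LVL ∸′ DEP [ var V ]) +
                   (cost {μ = local} insert + steps (full ∸′ var CNT)))) 100 tt))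
                (ifFalse (m≤n⇒m∸n≡0 dx) (ifFalse (m≤n⇒m∸n≡0 dy)
                (blockThen {c = insert} ((≤-trans (n≤1+n _) cnt≤W , tt , tt , tt) , (cnt≤W , tt , tt , tt))
                  (ifFalse e (weaken {c = sparsify} (compressed (subst (_≤ suc (suc (σ CNT 0))) cap≡ (m∸n≡0⇒m≤n e)))
                    (M.sparsifying {σ₂} (ready , arcs₁ , done₁) (Buffer.linked buffer₁) idle (≤-trans (Buffer.size≤ buffer₁) cnt≤)))))))

      accept : ∃[ t ] Triple edgeBody σ₁ 0 t (Result t)
      accept with σ LVL 0 ∸ σ DEP x₀ ≟ 0
      ... | no ne = 100 , slower (≤ᵇ⇒≤ _ 100 tt) (ifTrue ne (block tt
              (cheap ≤-refl (ignored (inj₁ (m∸n≢0⇒n<m′ ne))))))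
      ... | yes e with σ LVL 0 ∸ σ DEP y₀ ≟ 0
      ...   | no ne = 100 , slower (≤ᵇ⇒≤ _ 100 tt) (ifFalse e (ifTrue ne (block tt
              (cheap ≤-refl (ignored (inj₂ (m∸n≢0⇒n<m′ ne)))))))
      ...   | yes e′ = insertion (m∸n≡0⇒m≤n e) (m∸n≡0⇒m≤n e′)

  -- The cutting loop overwrites `DEP`, so the old depths live on only as the ghost array `dep₀`.
  -- The arrays listed are those which that loop does not write, so the record carries over
  -- unchanged.
  record Prepared (D : ℕ) (adj : ℕ → List ℕ) (dep₀ inp par lvl hd dst nx cnt bh : ℕ → ℕ) : Set where
    field
      n≡     : inp 0 ≡ n
      k≡     : inp 1 ≡ k
      level  : lvl 0 ≡ D
      tree   : Levelled (lvl 0) par dep₀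
      more   : ∃[ v ] v < n × lvl 0 < dep₀ v
      buffer : Buffer n hd dst nx (cnt 0) adj
      count  : cnt 0 < 4 * cells
      idle   : ∀ ℓ → bh ℓ ≡ 0
      arcs   : ∀ {x y} → y ∈ adj x → E x y × lvl 0 ≤ dep₀ x
      safe   : ∀ {x y} → E x y → lvl 0 ≤ dep₀ x → lvl 0 ≤ dep₀ y → Inseparable (Arc adj) k x y

  prepared : ℕ → (ℕ → List ℕ) → (ℕ → ℕ) → Store 27 → Set
  prepared D adj dep₀ σ = Prepared D adj dep₀ (σ IN) (σ PAR) (σ LVL) (σ HEAD) (σ DST) (σ NXT) (σ CNT) (σ BH)

  module _ (D : ℕ) (adj₀ : ℕ → List ℕ) (dep₀ : ℕ → ℕ) where

    record Cutting (m : ℕ) (σ : Store 27) : Set where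
      field
        prep    : prepared D adj₀ dep₀ σ
        shallow : ∀ {v} → v < n → σ I 0 ≤ v → dep₀ v ≤ σ LVL 0 → σ DEP v ≡ dep₀ v
        deep    : ∀ {v} → v < n → σ I 0 ≤ v → σ LVL 0 < dep₀ v → σ DEP v ≡ 0
        uncut   : ∀ {v} → v < σ I 0 → σ DEP v ≡ dep₀ v
        stack⊆  : ∀ {v} → v ∈ stack (σ ST) (σ SP 0) → v < n × dep₀ v ≡ σ LVL 0
        stack⊇  : ∀ {v} → v < n → σ I 0 ≤ v → dep₀ v ≡ σ LVL 0 → v ∈ stack (σ ST) (σ SP 0)
        height  : σ SP 0 + σ I 0 ≤ n
        pot     : σ I 0 ≤ m

    cutStep : ∀ m σ → Cutting m σ → σ I 0 ≢ 0 → Triple cutBody σ 0 60 (Below Cutting m)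
    cutStep m σ inv I≢0 = slower (≤ᵇ⇒≤ _ 60 tt) (blockThen {c = I ≔ var I ∸′ lit 1} tt branches)
      where
        open Cutting inv
        i : ℕ
        i = σ I 0 ∸ 1
        suc-i : suc i ≡ σ I 0
        suc-i = suc-pred (σ I 0) {{≢-nonZero I≢0}}
        i< : i < σ I 0
        i< = ≤-reflexive suc-i
        i<n : i < n
        i<n = ≤-trans i< (m+n≤o⇒n≤o (σ SP 0) height)
        i<m : i < m
        i<m = <-≤-trans i< pot
        above-i : ∀ {v} → i ≤ v → i ≢ v → σ I 0 ≤ v
        above-i le ne = ≤-trans (≤-reflexive (sym suc-i)) (≤∧≢⇒< le ne)
        height′ : suc (σ SP 0) + i ≤ n
        height′ = ≤-trans (≤-reflexive (trans (sym (+-suc (σ SP 0) i)) (cong (σ SP 0 +_) suc-i))) height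
        height″ : σ SP 0 + i ≤ n
        height″ = ≤-trans (n≤1+n _) height′
        dep-i : σ DEP i ≡ dep₀ i
        dep-i = uncut i<
        keep-shallow : ∀ {v} → v < n → i ≤ v → dep₀ v ≤ σ LVL 0 → σ DEP v ≡ dep₀ v
        keep-shallow {v} v< le d with i ≟ v
        ... | yes refl = dep-i
        ... | no ne    = shallow v< (above-i le ne) d
        keep-deep : dep₀ i ≤ σ LVL 0 → ∀ {v} → v < n → i ≤ v → σ LVL 0 < dep₀ v → σ DEP v ≡ 0
        keep-deep low {v} v< le d with i ≟ v
        ... | yes refl = contradiction d (≤⇒≯ low)
        ... | no ne    = deep v< (above-i le ne) d
        branches : Triple (cond (DEP [ var I ] ∸′ var LVL) (DEP [ var I ]≔ lit 0)
                     (cond (var LVL ∸′ DEP [ var I ]) skip (SP ≔ lit 1 ∔ var SP ⨾ ST [ var SP ]≔ var I)))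
                     (exec {μ = streaming} (I ≔ var I ∸′ lit 1) σ) 0 40 (Below Cutting m)
        branches with σ DEP i ∸ σ LVL 0 ≟ 0
        ... | no ne = slower (≤ᵇ⇒≤ _ 40 tt) (ifTrue ne (block {c = DEP [ var I ]≔ lit 0} tt (i , i<m , record
              { prep = prep
              ; shallow = λ {v} v< le d → cut-shallow v< le d (upd-view (σ DEP) i 0 v)
              ; deep = λ {v} v< le d → cut-deep v< le d (upd-view (σ DEP) i 0 v)
              ; uncut = λ {v} lt → trans (upd-≢ (σ DEP) (>⇒≢ lt)) (uncut (<-trans lt i<))
              ; stack⊆ = stack⊆
              ; stack⊇ = cut-stack
              ; height = height″ ; pot = ≤-refl })))
          where
            gt : σ LVL 0 < dep₀ i
            gt = subst (σ LVL 0 <_) dep-i (m∸n≢0⇒n<m′ ne)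
            cut-shallow : ∀ {v x} → v < n → i ≤ v → dep₀ v ≤ σ LVL 0 →
                          (i ≡ v × x ≡ 0) ⊎ (i ≢ v × x ≡ σ DEP v) → x ≡ dep₀ v
            cut-shallow v< le d (inj₁ (refl , _)) = contradiction gt (≤⇒≯ d)
            cut-shallow v< le d (inj₂ (ne , e))   = trans e (shallow v< (above-i le ne) d)
            cut-deep : ∀ {v x} → v < n → i ≤ v → σ LVL 0 < dep₀ v →
                       (i ≡ v × x ≡ 0) ⊎ (i ≢ v × x ≡ σ DEP v) → x ≡ 0
            cut-deep v< le d (inj₁ (_ , e))  = e
            cut-deep v< le d (inj₂ (ne , e)) = trans e (deep v< (above-i le ne) d)
            cut-stack : ∀ {v} → v < n → i ≤ v → dep₀ v ≡ σ LVL 0 → v ∈ stack (σ ST) (σ SP 0)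
            cut-stack {v} v< le d with i ≟ v
            ... | yes refl = contradiction gt (≤⇒≯ (≤-reflexive d))
            ... | no ne′   = stack⊇ v< (above-i le ne′) d
        ... | yes e with σ LVL 0 ∸ σ DEP i ≟ 0
        ...   | no ne = slower (≤ᵇ⇒≤ _ 40 tt) (ifFalse e (ifTrue ne (block tt (i , i<m , record
                { prep = prep
                ; shallow = keep-shallow
                ; deep = keep-deep (<⇒≤ lt)
                ; uncut = λ lt → uncut (<-trans lt i<)
                ; stack⊆ = stack⊆
                ; stack⊇ = keep-stack
                ; height = height″ ; pot = ≤-refl }))))
          where
            lt : dep₀ i < σ LVL 0
            lt = subst (_< σ LVL 0) dep-i (m∸n≢0⇒n<m′ ne)
            keep-stack : ∀ {v} → v < n → i ≤ v → dep₀ v ≡ σ LVL 0 → v ∈ stack (σ ST) (σ SP 0)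
            keep-stack {v} v< le d with i ≟ v
            ... | yes refl = contradiction d (<⇒≢ lt)
            ... | no ne′   = stack⊇ v< (above-i le ne′) d
        ...   | yes e′ = slower (≤ᵇ⇒≤ _ 40 tt) (ifFalse e (ifFalse e′ (block {c = SP ≔ lit 1 ∔ var SP ⨾ ST [ var SP ]≔ var I}
                (sp≤W , tt) (i , i<m , record
                { prep = prep
                ; shallow = keep-shallow
                ; deep = keep-deep (≤-reflexive level)
                ; uncut = λ lt → uncut (<-trans lt i<)
                ; stack⊆ = λ {v} m → push⊆ (subst (v ∈_) pushed m)
                ; stack⊇ = λ {v} v< le d → subst (v ∈_) (sym pushed) (push⊇ v< le d)
                ; height = height′ ; pot = ≤-refl }))))
          where
            level : dep₀ i ≡ σ LVL 0
            level = trans (sym dep-i) (≤-antisym (m∸n≡0⇒m≤n e) (m∸n≡0⇒m≤n e′))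
            sp≤W : suc (σ SP 0) ≤ W
            sp≤W = within 1 (≤-trans (m+n≤o⇒m≤o (suc (σ SP 0)) height′) (≤-trans n≤cells (m≤m+n cells 0)))
            pushed : stack (upd (σ ST) (suc (σ SP 0)) i) (suc (σ SP 0)) ≡ i ∷ stack (σ ST) (σ SP 0)
            pushed = stack-push (σ ST) (σ SP 0)
            push⊆ : ∀ {v} → v ∈ i ∷ stack (σ ST) (σ SP 0) → v < n × dep₀ v ≡ σ LVL 0
            push⊆ (here refl) = i<n , level
            push⊆ (there m)   = stack⊆ m
            push⊇ : ∀ {v} → v < n → i ≤ v → dep₀ v ≡ σ LVL 0 → v ∈ i ∷ stack (σ ST) (σ SP 0)
            push⊇ {v} v< le d with i ≟ v
            ... | yes refl = here refl
            ... | no ne    = there (stack⊇ v< (above-i le ne) d)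

  length-stack : ∀ f c → length (stack f c) ≡ c
  length-stack f zero    = refl
  length-stack f (suc c) = cong suc (length-stack f c)

  -- The depth-first search loop

  module Descent {D : ℕ} {par₀ dep₀ : ℕ → ℕ} (T : Levelled D par₀ dep₀) (adj₀ : ℕ → List ℕ) (c₀ : ℕ)
    (arc-E : ∀ {x y} → y ∈ adj₀ x → E x y) (arc-sym : ∀ {x y} → y ∈ adj₀ x → x ∈ adj₀ y)
    (arc-deep : ∀ {x y} → y ∈ adj₀ x → D ≤ dep₀ x)
    (safe : ∀ {u v} → E u v → D ≤ dep₀ u → D ≤ dep₀ v → Inseparable (Arc adj₀) k u v) where

    open Search {D} {k} {par₀} {dep₀} T adj₀ arc-E arc-sym arc-deep safe public

    -- A push is always preceded by the removal of an arc, so `height` bounds the stack pointer and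
    -- with it the space. `more` and `final` give the flag `GO` its exact meaning, which decides the
    -- number of passes.
    record Descending (m : ℕ) (σ : Store 27) : Set where
      field
        adj    : ℕ → List ℕ
        linked : Linked (σ HEAD) (σ DST) (σ NXT) c₀ adj
        dfs    : DFS adj (stack (σ ST) (σ SP 0)) (σ PAR) (σ DEP)
        n≡     : σ IN 0 ≡ n
        k≡     : σ IN 1 ≡ k
        level  : σ LVL 0 ≡ D
        idle   : ∀ ℓ → σ BH ℓ ≡ 0
        more   : σ GO 0 ≢ 0 → ∃[ v ] v < n × D + k < σ DEP v
        final   : σ GO 0 ≡ 0 → ∀ {v} → v < n → σ DEP v ≤ D + k
        height : σ SP 0 + size n adj ≤ n + 4 * cells
        pot    : 2 * size n adj + σ SP 0 ≤ m

    descendStep : ∀ m σ → Descending m σ → σ SP 0 ≢ 0 →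
                  Triple dfsBody σ 0 100 (Below Descending m)
    descendStep m σ inv SP≢0 = slower (≤ᵇ⇒≤ _ 100 tt) (blockThen {c = Y ≔ ST [ var SP ]} tt branches)
      where
        open Descending inv
        s t : ℕ
        s = σ SP 0 ∸ 1
        t = σ ST (σ SP 0)
        suc-s : suc s ≡ σ SP 0
        suc-s = suc-pred (σ SP 0) {{≢-nonZero SP≢0}}
        st : List ℕ
        st = stack (σ ST) s
        split : stack (σ ST) (σ SP 0) ≡ t ∷ st
        split = trans (cong (stack (σ ST)) (sym suc-s)) (cong (λ z → σ ST z ∷ st) suc-s)
        dfs₁ : DFS adj (t ∷ st) (σ PAR) (σ DEP)
        dfs₁ = subst (λ z → DFS adj z (σ PAR) (σ DEP)) split dfs
        sp≡ : suc (length st) ≡ σ SP 0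
        sp≡ = trans (cong suc (length-stack (σ ST) s)) suc-s

        Result : Store 27 → Set
        Result = Below Descending m

        module Follow (h : σ HEAD t ≢ 0) where
          w : ℕ
          w = σ DST (σ HEAD t)
          popped : ∃[ l ] adj t ≡ w ∷ l × Linked (upd (σ HEAD) t (σ NXT (σ HEAD t))) (σ DST) (σ NXT) c₀ (upd adj t l)
          popped = linked-pop t linked h
          l : List ℕ
          l = proj₁ popped
          eq : adj t ≡ w ∷ l
          eq = proj₁ (proj₂ popped)
          linked′ = proj₂ (proj₂ popped)
          adj′ : ℕ → List ℕ
          adj′ = upd adj t l
          w<n : w < n
          w<n = head<n dfs₁ eq
          size′ : suc (size n adj′) ≡ size n adj
          size′ = size-pop n adj (top-bound dfs₁) eq
          pot′ : ∀ {b} → b ≤ 1 → 2 * size n adj′ + (b + σ SP 0) < m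
          pot′ {b} le = <-≤-trans (subst (λ z → 2 * size n adj′ + (b + z) < 2 * size n adj + z) sp≡
                          (potential-arc dfs₁ eq le)) pot
          height′ : suc (σ SP 0) + size n adj′ ≤ n + 4 * cells
          height′ = ≤-trans (≤-reflexive (trans (sym (+-suc (σ SP 0) (size n adj′))) (cong (σ SP 0 +_) size′))) height

          advance : Store 27
          advance = exec {μ = streaming} (TMP ≔ HEAD [ var Y ] ⨾ HEAD [ var Y ]≔ NXT [ var TMP ] ⨾ V ≔ DST [ var TMP ])
                      (exec {μ = streaming} (Y ≔ ST [ var SP ]) σ)

          revisited : σ DEP w ≢ 0 → Result advance
          revisited dw = _ , pot′ {0} z≤n , record
            { adj = adj′ ; linked = linked′
            ; dfs = subst (λ z → DFS adj′ z (σ PAR) (σ DEP)) (sym split) (revisit dfs₁ eq dw)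
            ; n≡ = n≡ ; k≡ = k≡ ; level = level ; idle = idle ; more = more ; final = final
            ; height = ≤-trans (n≤1+n _) height′ ; pot = ≤-refl }

          module Fresh (dw : σ DEP w ≡ 0) where
            d : ℕ
            d = suc (σ DEP t)
            d≤W : d ≤ W
            d≤W = within 2 (≤-trans (s≤s (top-dep≤n dfs₁)) (+-mono-≤ {1} (≤-trans (s≤s z≤n) 2≤cells) (≤-trans n≤cells (m≤m+n cells 0))))
            sp≤W : suc (σ SP 0) ≤ W
            sp≤W = within 5 (≤-trans (m+n≤o⇒m≤o (suc (σ SP 0)) height′) (+-monoˡ-≤ (4 * cells) n≤cells))
            advanced visited : Store 27
            advanced = exec {μ = streaming} (TMP ≔ lit 1 ∔ DEP [ var Y ]) advance
            visited  = exec visit advanced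

            dfs′ : DFS adj′ (stack (upd (σ ST) (suc (σ SP 0)) w) (suc (σ SP 0))) (upd (σ PAR) w t) (upd (σ DEP) w d)
            dfs′ = subst (λ z → DFS adj′ z (upd (σ PAR) w t) (upd (σ DEP) w d))
                     (sym (trans (stack-push (σ ST) (σ SP 0)) (cong (w ∷_) split)))
                     (discover dfs₁ eq dw)

            deeper : D + k < d → Result (exec {μ = streaming} (GO ≔ lit 1) visited)
            deeper gt = _ , pot′ {1} ≤-refl , record
              { adj = adj′ ; linked = linked′ ; dfs = dfs′
              ; n≡ = n≡ ; k≡ = k≡ ; level = level ; idle = idle
              ; more = λ _ → w , w<n , subst (D + k <_) (sym (upd-≡ (σ DEP) {w} refl)) gt
              ; final = λ ()
              ; height = height′ ; pot = ≤-refl }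

            near : d ≤ D + k → Result visited
            near le = _ , pot′ {1} ≤-refl , record
              { adj = adj′ ; linked = linked′ ; dfs = dfs′
              ; n≡ = n≡ ; k≡ = k≡ ; level = level ; idle = idle
              ; more = more′ ; final = final′
              ; height = height′ ; pot = ≤-refl }
              where
                more′ : σ GO 0 ≢ 0 → ∃[ v ] v < n × D + k < upd (σ DEP) w d v
                more′ g with more g
                ... | v , v< , lt = v , v< , subst (D + k <_) (sym (upd-≢ (σ DEP) {w} {d} {v} (λ { refl → contradiction (subst (D + k <_) dw lt) λ () }))) lt
                final′ : σ GO 0 ≡ 0 → ∀ {v} → v < n → upd (σ DEP) w d v ≤ D + k
                final′ g {v} v< with upd-view (σ DEP) w d v
                ... | inj₁ (_ , e) = subst (_≤ D + k) (sym e) le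
                ... | inj₂ (_ , e) = subst (_≤ D + k) (sym e) (final g v<)

            level′ : σ LVL 0 + σ IN 1 ≡ D + k
            level′ = cong₂ _+_ level k≡

            flag : Triple (cond (var TMP ∸′ (var LVL ∔ K)) (GO ≔ lit 1) skip) visited 0 20 Result
            flag with d ∸ (σ LVL 0 + σ IN 1) ≟ 0
            ... | no ne = slower (≤ᵇ⇒≤ _ 20 tt) (ifTrue ne (block {c = GO ≔ lit 1} tt
                    (deeper (subst (_< d) level′ (m∸n≢0⇒n<m′ ne)))))
            ... | yes e = slower (≤ᵇ⇒≤ _ 20 tt) (ifFalse e (block tt
                    (near (subst (d ≤_) level′ (m∸n≡0⇒m≤n e)))))

        branches : Triple _ (exec {μ = streaming} (Y ≔ ST [ var SP ]) σ) 0 90 Result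
        branches with σ HEAD t ≟ 0
        ... | yes h = slower (≤ᵇ⇒≤ _ 90 tt) (ifFalse h (block {c = SP ≔ var SP ∸′ lit 1} tt
              (2 * size n adj + s , <-≤-trans (+-monoʳ-< (2 * size n adj) (≤-reflexive suc-s)) pot , record
              { adj = adj ; linked = linked ; dfs = backtrack dfs₁ (linked-empty t linked h)
              ; n≡ = n≡ ; k≡ = k≡ ; level = level ; idle = idle ; more = more ; final = final
              ; height = ≤-trans (+-monoˡ-≤ (size n adj) (m∸n≤m (σ SP 0) 1)) height ; pot = ≤-refl })))
        ... | no h = slower (≤ᵇ⇒≤ _ 90 tt) (ifTrue h (blockThen (tt , tt , tt) process))
          where
            open Follow h
            process : Triple _ advance 0 70 Result
            process with σ DEP w ≟ 0
            ... | no dw  = slower (≤ᵇ⇒≤ _ 70 tt) (ifTrue dw (block tt (revisited dw)))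
            ... | yes dw = slower (≤ᵇ⇒≤ _ 70 tt) (ifFalse dw
                    (blockThen {c = TMP ≔ lit 1 ∔ DEP [ var Y ]} (Fresh.d≤W dw)
                      (blockThen {c = visit} (tt , tt , Fresh.sp≤W dw , tt) (Fresh.flag dw))))

-- The complete run

module Run {n k : ℕ} (streams : ℕ → List (Edge n)) (1≤n : 1 ≤ n) (1≤k : 1 ≤ k)
  (E : ℕ → ℕ → Set) (E-sym : ∀ {u v} → E u v → E v u) (E-bound : ∀ {u v} → E u v → u < n)
  (stream-sound : ∀ q {u v} → (u , v) ∈ streams q → E (toℕ u) (toℕ v))
  (stream-complete : ∀ q {x y} → E x y → Pending (streams q) x y)
  (m : ℕ) (stream-length : ∀ q → length (streams q) ≡ m)
  (root-path : ∀ {v} → v < n → Star E v 0) where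

  open Rounds {n} {k} streams 1≤n 1≤k E E-sym E-bound stream-sound stream-complete m stream-length public
  open Execution streams using (_,_⇓_; seq⇓; whileTrue⇓; whileFalse⇓)

  record Resting (σ : Store 27) : Set where
    field
      n≡    : σ IN 0 ≡ n
      k≡    : σ IN 1 ≡ k
      tree  : Levelled (σ LVL 0) (σ PAR) (σ DEP)
      heads : ∀ i → σ HEAD i ≡ 0
      none  : σ CNT 0 ≡ 0
      idle  : ∀ ℓ → σ BH ℓ ≡ 0
      more  : σ GO 0 ≢ 0 → ∃[ v ] v < n × σ LVL 0 < σ DEP v
      final : σ GO 0 ≡ 0 → ∀ {v} → v < n → σ DEP v ≤ σ LVL 0

  reading : ∀ {σ} → Resting σ → σ GO 0 ≢ 0 → ∀ q → Reading (σ LVL 0) (streams q) 0 σ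
  reading {σ} r go q = record
    { adj = λ _ → []
    ; buffer = record
      { linked = λ i → subst (λ p → Chain (σ DST) (σ NXT) (σ CNT 0) p []) (sym (heads i)) nil
      ; size≤ = ≤-trans (≤-reflexive (size-empty n (λ _ → refl))) z≤n
      ; sym-arc = λ ()
      ; bound = λ () }
    ; count = subst (_< 4 * cells) (sym none) (≤-trans (≤-trans (s≤s z≤n) 2≤cells) (m≤n*m cells 4))
    ; pays = ≤-reflexive (trans (cong (2000 *_) none) (*-zeroʳ 2000))
    ; idle = idle
    ; ready = record { n≡ = n≡ ; k≡ = k≡ ; level = refl ; tree = tree ; more = more go }
    ; sound = stream-sound q
    ; arcs = λ ()
    ; done = λ e _ _ → inj₁ (stream-complete q e)
    }
    where open Resting r

  cutting : ∀ {D φ σ} (r : Reading D [] φ σ) →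
            Cutting D (Reading.adj r) (σ DEP) n (exec {μ = streaming} (SP ≔ lit 0 ⨾ I ≔ N) σ)
  cutting {D} {φ} {σ} r = record
    { prep = record
      { n≡ = Ready.n≡ ready ; k≡ = Ready.k≡ ready ; level = Ready.level ready ; tree = Ready.tree ready
      ; more = Ready.more ready ; buffer = buffer ; count = count ; idle = idle ; arcs = arcs
      ; safe = λ e dx dy → settled (done e dx dy) }
    ; shallow = λ v< le → contradiction v< (≤⇒≯ (≤-trans (≤-reflexive (sym (Ready.n≡ ready))) le))
    ; deep = λ v< le → contradiction v< (≤⇒≯ (≤-trans (≤-reflexive (sym (Ready.n≡ ready))) le))
    ; uncut = λ _ → refl
    ; stack⊆ = λ ()
    ; stack⊇ = λ v< le → contradiction v< (≤⇒≯ (≤-trans (≤-reflexive (sym (Ready.n≡ ready))) le))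
    ; height = ≤-reflexive (Ready.n≡ ready)
    ; pot = ≤-reflexive (Ready.n≡ ready)
    }
    where
      open Reading r
      settled : ∀ {x y} → Pending {n} [] x y ⊎ Inseparable (Arc adj) k x y → Inseparable (Arc adj) k x y
      settled (inj₂ h) = h

  Advanced : ℕ → Store 27 → Set
  Advanced D σ = Resting σ × σ LVL 0 ≡ D + k × ∃[ v ] v < n × D < σ DEP v

  -- D is σ LVL 0; the two are only propositionally equal after the cutting loop.
  module AfterCut {D m′ adj₀ dep₀ σ} (c : Cutting D adj₀ dep₀ m′ σ) (I≡0 : σ I 0 ≡ 0) where
    open Cutting c
    open Prepared prep

    open Descent {σ LVL 0} {σ PAR} {dep₀} tree adj₀ (σ CNT 0) (proj₁ ∘ arcs) (Buffer.sym-arc buffer) (proj₂ ∘ arcs) safe public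

    from-0 : ∀ v → σ I 0 ≤ v
    from-0 v = subst (_≤ v) (sym I≡0) z≤n

    D≤ : σ LVL 0 ≤ n
    D≤ with more
    ... | v , v< , lt = ≤-trans (<⇒≤ lt) (ForestProperties.dep≤n (Levelled.forest tree) v< (Levelled.visited tree v<))

    descending : Descending (9 * cells) (exec {μ = streaming} (GO ≔ lit 0) σ)
    descending = record
      { adj = adj₀ ; linked = Buffer.linked buffer
      ; dfs = start (λ {v} v< le → shallow v< (from-0 v) le) (λ {v} v< lt → deep v< (from-0 v) lt)
                stack⊆ (λ {v} v< e → stack⊇ v< (from-0 v) e) 1≤n
      ; n≡ = n≡ ; k≡ = k≡ ; level = refl ; idle = idle
      ; more = λ go → contradiction refl go
      ; final = λ _ {v} v< → low v<
      ; height = +-mono-≤ sp≤ size≤4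
      ; pot = ≤-trans (+-mono-≤ (*-monoʳ-≤ 2 size≤4) (≤-trans sp≤ n≤cells)) (≤-reflexive
                (trans (cong (_+ cells) (sym (*-assoc 2 4 cells))) (+-comm (8 * cells) cells)))
      }
      where
        sp≤ : σ SP 0 ≤ n
        sp≤ = m+n≤o⇒m≤o (σ SP 0) height
        size≤4 : size n adj₀ ≤ 4 * cells
        size≤4 = ≤-trans (Buffer.size≤ buffer) (<⇒≤ count)
        -- Cut vertices have `DEP` zero, so the lowered flag is truthful at the start of the search.
        low : ∀ {v} → v < n → σ DEP v ≤ σ LVL 0 + k
        low {v} v< with dep₀ v ≤? σ LVL 0
        ... | yes le = ≤-trans (≤-reflexive (shallow v< (from-0 v) le)) (≤-trans le (m≤m+n _ k))
        ... | no gt  = ≤-trans (≤-reflexive (deep v< (from-0 v) (≰⇒> gt))) z≤n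

    finish : ∀ {m″ σ′} → Descending m″ σ′ → σ′ SP 0 ≡ 0 →
             Triple {streaming} (CNT ≔ lit 0 ⨾ LVL ≔ var LVL ∔ K) σ′ 0 20 (Advanced D)
    finish {σ′ = σ′} d SP≡0 = slower (≤ᵇ⇒≤ _ 20 tt) (block {c = CNT ≔ lit 0 ⨾ LVL ≔ var LVL ∔ K}
      (tt , ≤-trans (≤-reflexive lvl≡) lvl≤W)
      (record
        { n≡ = F.n≡ ; k≡ = F.k≡
        ; tree = subst (λ z → Levelled z (σ′ PAR) (σ′ DEP)) (sym lvl≡) (levelled dfs₀)
        ; heads = λ i → linked-nonempty i F.linked (arcs-consumed dfs₀ i)
        ; none = refl
        ; idle = F.idle
        ; more = λ go → subst (λ z → ∃[ v ] v < n × z < σ′ DEP v) (sym lvl≡) (F.more go)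
        ; final = λ go {v} v< → subst (σ′ DEP v ≤_) (sym lvl≡) (F.final go v<)
        }
      , trans lvl≡ (cong (_+ k) level)
      , deepest))
      where
        module F = Descending d
        lvl≡ : σ′ LVL 0 + σ′ IN 1 ≡ σ LVL 0 + k
        lvl≡ = cong₂ _+_ F.level F.k≡
        lvl≤W : σ LVL 0 + k ≤ W
        lvl≤W = within 2 (+-mono-≤ (≤-trans D≤ n≤cells) (≤-trans (≤-trans (n≤1+n k) 1+k≤cells) (m≤m+n cells 0)))
        dfs₀ : DFS F.adj [] (σ′ PAR) (σ′ DEP)
        dfs₀ = subst (λ z → DFS F.adj (stack (σ′ ST) z) (σ′ PAR) (σ′ DEP)) SP≡0 F.dfs
        -- A vertex below level D before the round may move but stays below D. The last round thus
        -- certifies a height above its starting level, which is the lower bound behind the pass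
        -- count.
        deepest : ∃[ v ] v < n × D < σ′ DEP v
        deepest with more
        ... | v , v< , lt = v , v< , subst (_< σ′ DEP v) level (grows dfs₀ v< lt)

  abstract
    roundTime : ℕ
    roundTime = 1 + (m * (2 + edgeTime) + 0) + 1100 * cells

    roundTime≡ : roundTime ≡ 1 + (m * (2 + edgeTime) + 0) + 1100 * cells
    roundTime≡ = refl

  roundTime′ : ∀ a b c d e f g →
    a + (n * b + c + (d + (9 * cells * e + f + g))) ≲ a + (1 * b + c + (d + (9 * e + f + g)))
  roundTime′ a b c d e f g =
    constant a ⊹ (times 1 b n≲1 ⊹ constant c ⊹ (constant d ⊹ (times 9 e (exact 9) ⊹ constant f ⊹ constant g)))

  abstract
    roundRuns : ∀ {σ} → Resting σ → σ GO 0 ≢ 0 → Triple round σ 1 roundTime (Advanced (σ LVL 0))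
    roundRuns {σ} rest go = slower
      (≤-trans (+-monoʳ-≤ (1 + (m * (2 + edgeTime) + 0)) (bounded-by (grow (≤ᵇ⇒≤ _ 1100 tt)
        (roundTime′ (cost {μ = streaming} (SP ≔ lit 0 ⨾ I ≔ N)) (2 + 60) 2 (cost {μ = streaming} (GO ≔ lit 0)) (2 + 100) 2 20)))) (≤-reflexive (sym roundTime≡)))
      (onePass U V edgeBody edgeTime (≤-trans n≤cells (within 1 (m≤m+n cells 0))) (Reading (σ LVL 0)) readStep
         (reading rest go) stream-length
       thenₜ λ { {σ₁} (φ , r) → blockThen {c = SP ≔ lit 0 ⨾ I ≔ N} (tt , tt)
      (loop (var I) cutBody tt 60 (Cutting (σ LVL 0) (Reading.adj r) (σ₁ DEP)) (cutStep (σ LVL 0) (Reading.adj r) (σ₁ DEP)) (cutting r)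
       thenₜ λ { {σ₂} (I≡0 , _ , c) → blockThen {c = GO ≔ lit 0} tt
      (loop (var SP) dfsBody tt 100 (AfterCut.Descending c I≡0) (AfterCut.descendStep c I≡0) (AfterCut.descending c I≡0)
       thenₜ λ { (SP≡0 , _ , d) → AfterCut.finish c I≡0 d SP≡0 }) }) })

  -- `tall` concerns the final tree, while later rounds may move the vertices below the fixed
  -- levels. Its witness is therefore taken from the last round, after which `still` says that the
  -- store no longer changes.
  record Finished (D : ℕ) (s : State 27) : Set where
    field
      {final} : State 27
      rounds  : ℕ
      run     : while (var GO) round , s ⇓ final
      fit     : Fits final
      passes≡ : State.passes final ≡ rounds + State.passes s
      time≤   : State.time final ≤ State.time s + (rounds * (2 + roundTime) + 2)
      resting : Resting (State.store final)
      stopped : State.store final GO 0 ≡ 0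
      level   : State.store final LVL 0 ≡ D + rounds * k
      still   : rounds ≡ 0 → State.store final ≡ State.store s
      tall    : ∀ {r} → rounds ≡ suc r → ∃[ v ] v < n × D + r * k < State.store final DEP v

  round-time : ∀ {a b t} q r → a ≤ b + (q * (2 + r) + 2) → b ≤ t + 2 + r → a ≤ t + (suc q * (2 + r) + 2)
  round-time {a} {b} {t} q r p₁ p₂ = begin
    a                                  ≤⟨ p₁ ⟩
    b + (q * (2 + r) + 2)              ≤⟨ +-monoˡ-≤ _ p₂ ⟩
    t + 2 + r + (q * (2 + r) + 2)      ≡⟨ cong (_+ (q * (2 + r) + 2)) (+-assoc t 2 r) ⟩
    t + (2 + r) + (q * (2 + r) + 2)    ≡⟨ +-assoc t (2 + r) _ ⟩
    t + (2 + r + (q * (2 + r) + 2))    ≡⟨ cong (t +_) (+-assoc (2 + r) (q * (2 + r)) 2) ⟨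
    t + (suc q * (2 + r) + 2)          ∎
    where open ≤-Reasoning

  noRound : ∀ {s} → State.store s GO 0 ≡ 0 → Resting (State.store s) → Fits s → Finished (State.store s LVL 0) s
  noRound {s} e rest f = record
    { rounds = 0 ; run = whileFalse⇓ e ; fit = charge-fits (var GO) tt f ; passes≡ = refl
    ; time≤ = ≤-refl ; resting = rest ; stopped = e ; level = sym (+-identityʳ _)
    ; still = λ _ → refl ; tall = λ () }

  oneMore : ∀ {s} → State.store s GO 0 ≢ 0 →
            (o : Outcome round (charge (var GO) s) 1 roundTime (Advanced (State.store s LVL 0))) →
            Finished (State.store (Outcome.final o) LVL 0) (Outcome.final o) → Finished (State.store s LVL 0) s
  oneMore {s} ne o later = record
    { rounds = suc R.rounds
    ; run = whileTrue⇓ ne O.run R.run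
    ; fit = R.fit
    ; passes≡ = trans R.passes≡ (trans (cong (R.rounds +_) O.passes≡) (+-suc R.rounds (State.passes s)))
    ; time≤ = round-time R.rounds roundTime R.time≤ O.time≤
    ; resting = R.resting
    ; stopped = R.stopped
    ; level = trans R.level (trans (cong (_+ R.rounds * k) lvl₁) (+-assoc D k (R.rounds * k)))
    ; still = λ ()
    ; tall = λ { refl → tall′ R.rounds refl }
    }
    where
      module O = Outcome o
      module R = Finished later
      D : ℕ
      D = State.store s LVL 0
      lvl₁ : State.store O.final LVL 0 ≡ D + k
      lvl₁ = proj₁ (proj₂ O.post)
      tall′ : ∀ q → R.rounds ≡ q → ∃[ u ] u < n × D + R.rounds * k < State.store R.final DEP u
      tall′ zero e = proj₁ (proj₂ (proj₂ O.post)) , proj₁ (proj₂ (proj₂ (proj₂ O.post))) ,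
        subst₂ (λ z τ → z < τ DEP (proj₁ (proj₂ (proj₂ O.post))))
          (trans (sym (+-identityʳ D)) (cong (λ z → D + z * k) (sym e))) (sym (R.still e))
          (proj₂ (proj₂ (proj₂ (proj₂ O.post))))
      tall′ (suc q) e with R.tall e
      ... | u , u< , lt′ = u , u< , subst (_< State.store R.final DEP u)
        (trans (cong (_+ q * k) lvl₁) (trans (+-assoc D k (q * k)) (cong (λ z → D + z * k) (sym e)))) lt′

  -- The fuel suffices because each round raises `LVL` by `k`, while a raised flag exhibits a vertex
  -- with `DEP` beyond `LVL`, and no `DEP` exceeds `n`.
  allRounds : ∀ fuel {s} → Resting (State.store s) → n ≤ State.store s LVL 0 + fuel → Fits s →
              Finished (State.store s LVL 0) s
  afterTest : ∀ fuel {s} → Dec (State.store s GO 0 ≡ 0) → Resting (State.store s) →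
              n ≤ State.store s LVL 0 + fuel → Fits s → Finished (State.store s LVL 0) s
  allRounds fuel {s} = afterTest fuel {s} (State.store s GO 0 ≟ 0)
  afterTest fuel (yes e) rest enough f = noRound e rest f
  afterTest zero (no ne) rest enough f = contradiction (<-≤-trans (proj₂ (proj₂ beyond)) (≤-trans
    (ForestProperties.dep≤n (Levelled.forest (Resting.tree rest)) (proj₁ (proj₂ beyond))
      (Levelled.visited (Resting.tree rest) (proj₁ (proj₂ beyond))))
    (≤-trans enough (≤-reflexive (+-identityʳ _))))) (<-irrefl refl)
    where beyond = Resting.more rest ne
  afterTest (suc fuel) {s} (no ne) rest enough f = oneMore ne next
    (allRounds fuel (proj₁ (Outcome.post next)) enough′ (Outcome.fit next))
    where
      next : Outcome round (charge (var GO) s) 1 roundTime (Advanced (State.store s LVL 0))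
      next = roundRuns rest ne (charge-fits (var GO) tt f)
      D = State.store s LVL 0
      enough′ : n ≤ State.store (Outcome.final next) LVL 0 + fuel
      enough′ = ≤-trans enough (≤-trans (≤-reflexive (+-suc D fuel))
        (≤-trans (+-monoˡ-≤ fuel (≤-trans (≤-reflexive (+-comm 1 D)) (+-monoʳ-≤ D 1≤k)))
          (≤-reflexive (cong (_+ fuel) (sym (proj₁ (proj₂ (Outcome.post next))))))))

  -- Set-up and the run as a whole

  record Filling (i : ℕ) (σ : Store 27) : Set where
    field
      n≡     : σ IN 0 ≡ n
      k≡     : σ IN 1 ≡ k
      level  : σ LVL 0 ≡ 1
      pars   : ∀ v → σ PAR v ≡ 0
      heads  : ∀ v → σ HEAD v ≡ 0
      none   : σ CNT 0 ≡ 0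
      idle   : ∀ ℓ → σ BH ℓ ≡ 0
      filled : ∀ {v} → v < n → σ I 0 ≤ v → σ DEP v ≡ 2
      pot    : σ I 0 ≤ i

  fillStep : ∀ i σ → Filling i σ → σ I 0 ≢ 0 → Triple fillBody σ 0 20 (Below Filling i)
  fillStep i σ inv I≢0 = slower (≤ᵇ⇒≤ _ 20 tt) (block {c = fillBody} (tt , tt)
    (j , <-≤-trans (≤-reflexive suc-j) pot , record
      { n≡ = n≡ ; k≡ = k≡ ; level = level ; pars = pars ; heads = heads ; none = none ; idle = idle
      ; filled = filled′ ; pot = ≤-refl }))
    where
      open Filling inv
      j : ℕ
      j = σ I 0 ∸ 1
      suc-j : suc j ≡ σ I 0
      suc-j = suc-pred (σ I 0) {{≢-nonZero I≢0}}
      filled′ : ∀ {v} → v < n → j ≤ v → upd (σ DEP) j 2 v ≡ 2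
      filled′ {v} v< le with upd-view (σ DEP) j 2 v
      ... | inj₁ (_ , e)  = e
      ... | inj₂ (ne , e) = trans e (filled v< (≤-trans (≤-reflexive (sym suc-j)) (≤∧≢⇒< le ne)))

  zeroStore start-store : Store 27
  zeroStore   = λ _ _ → 0
  start-store = (zeroStore [ IN , 0 ↦ n ]) [ IN , 1 ↦ k ]

  start-fits : Fits (state start-store 0 0 2 (n ⊔ k))
  start-fits = fits (⊔-lub n≤W k≤W) (s≤s (≤-trans (m≤m+n 1 3) 4≤W))
    (update-cells IN 1 k≤W (update-cells IN 0 n≤W (λ _ _ → z≤n)))
    where
      n≤W : n ≤ W
      n≤W = within 1 (bounded-by n≲1)
      k≤W : k ≤ W
      k≤W = ≤-trans (m≤n+m k 3) 3+k≤W

  abstract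
    setupRuns : Triple setup start-store 0 (60 * cells) (λ σ → Resting σ × σ LVL 0 ≡ 1)
    setupRuns = slower (bounded-by (grow (≤ᵇ⇒≤ _ 60 tt)
        (constant (cost {μ = streaming} (LVL ≔ lit 1 ⨾ I ≔ N)) ⊹ (times 1 (2 + 20) n≲1 ⊹ constant 2 ⊹ constant (cost {μ = streaming} (DEP [ lit 0 ]≔ lit 1 ⨾ GO ≔ N ∸′ lit 1))))))
      (blockThen {c = LVL ≔ lit 1 ⨾ I ≔ N} (tt , tt)
      (loop (var I) fillBody tt 20 Filling fillStep {n} filling
       thenₜ λ { (I≡0 , _ , f) → block {c = DEP [ lit 0 ]≔ lit 1 ⨾ GO ≔ N ∸′ lit 1} (tt , tt) (resting I≡0 f , Filling.level f) }))
      where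
        filling : Filling n (exec {μ = streaming} (LVL ≔ lit 1 ⨾ I ≔ N) start-store)
        filling = record
          { n≡ = refl ; k≡ = refl ; level = refl ; pars = λ _ → refl ; heads = λ _ → refl ; none = refl
          ; idle = λ _ → refl ; filled = λ v< le → contradiction v< (≤⇒≯ le) ; pot = ≤-refl }

        resting : ∀ {i σ} → σ I 0 ≡ 0 → Filling i σ →
                  Resting (exec {μ = streaming} (DEP [ lit 0 ]≔ lit 1 ⨾ GO ≔ N ∸′ lit 1) σ)
        resting {σ = σ} I≡0 f = record
          { n≡ = n≡ ; k≡ = k≡
          ; tree = subst (λ z → Levelled z (σ PAR) (upd (σ DEP) 0 1)) (sym level)
              (initial 1≤n pars refl (λ v< ne → below v< ne) root-path)
          ; heads = heads ; none = none ; idle = idle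
          ; more = λ go → 1 , subst (1 <_) n≡ (m∸n≢0⇒n<m′ go) ,
              subst₂ _<_ (sym level) (sym (below (subst (1 <_) n≡ (m∸n≢0⇒n<m′ go)) λ ())) ≤-refl
          ; final = λ go {v} v< → low v< (subst (_≤ 1) n≡ (m∸n≡0⇒m≤n go))
          }
          where
            open Filling f
            below : ∀ {v} → v < n → v ≢ 0 → upd (σ DEP) 0 1 v ≡ 2
            below {v} v< ne = trans (upd-≢ (σ DEP) (ne ∘ sym)) (filled v< (subst (_≤ v) (sym I≡0) z≤n))
            low : ∀ {v} → v < n → n ≤ 1 → upd (σ DEP) 0 1 v ≤ σ LVL 0
            low {zero}  _  _  = ≤-reflexive (sym level)
            low {suc v} v< n≤ = contradiction (≤-trans v< n≤) λ { (s≤s ()) }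

  record Complete (s : State 27) : Set where
    field
      rounds  : ℕ
      run     : program , state start-store 0 0 2 (n ⊔ k) ⇓ s
      fit     : Fits s
      passes≡ : State.passes s ≡ rounds
      time≤   : State.time s ≤ 60 * cells + (rounds * (2 + roundTime) + 2)
      tree    : Levelled (1 + rounds * k) (State.store s PAR) (State.store s DEP)
      final   : ∀ {v} → v < n → State.store s DEP v ≤ 1 + rounds * k
      tall    : ∀ {r} → rounds ≡ suc r → ∃[ v ] v < n × 1 + r * k < State.store s DEP v

  complete : Σ[ s ∈ State 27 ] Complete s
  complete with setupRuns start-fits
  ... | outcome {s₁} r₁ f₁ p₁ t₁ (rest , lvl≡1) = R.final , record
    { rounds = R.rounds
    ; run = seq⇓ r₁ R.run
    ; fit = R.fit
    ; passes≡ = trans R.passes≡ (trans (cong (R.rounds +_) p₁) (+-identityʳ R.rounds))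
    ; time≤ = ≤-trans R.time≤ (+-monoˡ-≤ _ t₁)
    ; tree = subst (λ z → Levelled z (State.store R.final PAR) (State.store R.final DEP)) lvl≡ (Resting.tree R.resting)
    ; final = λ {v} v< → subst (State.store R.final DEP v ≤_) lvl≡ (Resting.final R.resting R.stopped v<)
    ; tall = λ {r} e → subst (λ z → ∃[ v ] v < n × z + r * k < State.store R.final DEP v) lvl≡1 (R.tall e)
    }
    where
      module R = Finished (allRounds n rest (m≤n+m n _) f₁)
      lvl≡ : State.store R.final LVL 0 ≡ 1 + R.rounds * k
      lvl≡ = trans R.level (cong (_+ R.rounds * k) lvl≡1)

-- Graphs and rooted trees on Fin n

edgeSetoid : ℕ → Setoid _ _
edgeSetoid n = record
  { Carrier = Edge n
  ; _≈_ = _≈ᵉ_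
  ; isEquivalence = record
    { refl = inj₁ refl
    ; sym = λ { (inj₁ refl) → inj₁ refl ; (inj₂ refl) → inj₂ refl }
    ; trans = λ { (inj₁ refl) q → q ; (inj₂ refl) (inj₁ refl) → inj₂ refl ; (inj₂ refl) (inj₂ refl) → inj₁ refl }
    }
  }

AdjacentIn : ∀ {n} → Graph n → ℕ → ℕ → Set
AdjacentIn G x y = ∃[ u ] ∃[ v ] toℕ u ≡ x × toℕ v ≡ y × Graph.Adj G u v

adjacent-sym : ∀ {n} {G : Graph n} {x y} → AdjacentIn G x y → AdjacentIn G y x
adjacent-sym (u , v , e , e′ , a) = v , u , e′ , e , swap⊎ a

adjacent-bound : ∀ {n} {G : Graph n} {x y} → AdjacentIn G x y → x < n
adjacent-bound (u , v , refl , e′ , a) = toℕ<n u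

adjacent⇒Adj : ∀ {n} {G : Graph n} {u v} → AdjacentIn G (toℕ u) (toℕ v) → Graph.Adj G u v
adjacent⇒Adj (u , v , e , e′ , a) with refl ← toℕ-injective e | refl ← toℕ-injective e′ = a

order-sound : ∀ {n} {G : Graph n} {es} → EdgeOrder G es → ∀ {u v} → (u , v) ∈ es → AdjacentIn G (toℕ u) (toℕ v)
order-sound {n} {G} perm {u} {v} m = found (∈-resp-↭ (edgeSetoid n) perm (mapAny inj₁ m)) (λ _ e∈ → e∈)
  where
    found : ∀ {l} → Any ((u , v) ≈ᵉ_) l → (∀ e → e ∈ l → e ∈ Graph.edges G) → AdjacentIn G (toℕ u) (toℕ v)
    found (here (inj₁ refl)) incl = u , v , refl , refl , inj₁ (incl _ (here refl))
    found (here (inj₂ refl)) incl = u , v , refl , refl , inj₂ (incl _ (here refl))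
    found (there a) incl = found a (λ e → incl e ∘ there)

order-complete : ∀ {n} {G : Graph n} {es} → EdgeOrder G es → ∀ {x y} → AdjacentIn G x y → Pending es x y
order-complete {n} {G} perm (u , v , refl , refl , a) =
  mapAny joins (∈-resp-↭ (edgeSetoid n) (↭-sym (edgeSetoid n) perm) (stored a))
  where
    stored : Graph.Adj G u v → Any ((u , v) ≈ᵉ_) (Graph.edges G)
    stored (inj₁ m) = mapAny inj₁ m
    stored (inj₂ m) = mapAny (λ { refl → inj₂ refl }) m
    joins : ∀ {e} → (u , v) ≈ᵉ e → Joins e (toℕ u) (toℕ v)
    joins (inj₁ refl) = inj₁ (refl , refl)
    joins (inj₂ refl) = inj₂ (refl , refl)

order-length : ∀ {n} {G : Graph n} {es} → EdgeOrder G es → length es ≡ Graph.size G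
order-length {n} = xs↭ys⇒|xs|≡|ys| (edgeSetoid n)

module Tree {n : ℕ} (G : Graph n) (1≤n : 1 ≤ n) {D : ℕ} {par dep : ℕ → ℕ} where
  open Levels n (AdjacentIn G) (adjacent-sym {G = G}) (adjacent-bound {G = G})

  module _ (T : Levelled D par dep) where
    private
      module T = Levelled T
      module F = ForestProperties T.forest
      open Forest T.forest

      root : Fin n
      root = fromℕ< 1≤n

      toℕ-root : toℕ root ≡ 0
      toℕ-root = toℕ-fromℕ< 1≤n

      ≢root : ∀ {v} → v ≢ root → toℕ v ≢ 0
      ≢root ne e = ne (toℕ-injective (trans e (sym toℕ-root)))

      par< : ∀ v → par (toℕ v) < n
      par< v with toℕ v ≟ 0
      ... | yes e = subst (_< n) (sym (trans (cong par e) root-par)) 1≤n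
      ... | no ne = proj₁ (parent (toℕ<n v) ne (T.visited (toℕ<n v)))

      up-par : Fin n → Fin n
      up-par v = fromℕ< (par< v)

      toℕ-par : ∀ v → toℕ (up-par v) ≡ par (toℕ v)
      toℕ-par v = toℕ-fromℕ< (par< v)

      Step : Fin n → Fin n → Set
      Step v p = v ≢ root × up-par v ≡ p

      dep-par : ∀ {v} → v ≢ root → dep (toℕ v) ≡ suc (dep (toℕ (up-par v)))
      dep-par {v} ne = trans (proj₁ (proj₂ (parent (toℕ<n v) (≢root ne) (T.visited (toℕ<n v)))))
                             (cong (suc ∘ dep) (sym (toℕ-par v)))

      climb : ∀ d v → dep (toℕ v) ≡ suc d → Star Step v root
      climb d v e with v ≟ᶠ root
      climb d v e       | yes refl = ε
      climb zero v e    | no ne = contradiction (suc-injective (trans (sym (dep-par ne)) e)) (T.visited (toℕ<n (up-par v)))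
      climb (suc d) v e | no ne = (ne , refl) ◅ climb d (up-par v) (suc-injective (trans (sym (dep-par ne)) e))

      -- `RootedTree.depth` folds the very path given as `rooted`, so the length of `climb` has to
      -- be computed.
      climb-length : ∀ d v (e : dep (toℕ v) ≡ suc d) → fold {T = Step} (λ _ _ → ℕ) (λ _ → suc) 0 (climb d v e) ≡ d
      climb-length d v e with v ≟ᶠ root
      climb-length d v e | yes refl = suc-injective (trans (sym root-dep) (trans (cong dep (sym toℕ-root)) e))
      climb-length zero v e | no ne = contradiction (suc-injective (trans (sym (dep-par ne)) e)) (T.visited (toℕ<n (up-par v)))
      climb-length (suc d) v e | no ne = cong suc (climb-length d (up-par v) _)

      dep≡ : ∀ v → dep (toℕ v) ≡ suc (dep (toℕ v) ∸ 1)
      dep≡ v = sym (suc-pred (dep (toℕ v)) {{≢-nonZero (T.visited (toℕ<n v))}})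

    tree : RootedTree n
    tree = record
      { root = root
      ; parent = up-par
      ; parentRoot = toℕ-injective (trans (toℕ-par root) (trans (cong par toℕ-root) (trans root-par (sym toℕ-root))))
      ; rooted = λ v → climb (dep (toℕ v) ∸ 1) v (dep≡ v)
      }

    parent-agrees : ∀ v → par (toℕ v) ≡ toℕ (RootedTree.parent tree v)
    parent-agrees v = sym (toℕ-par v)

    private
      depth≡ : ∀ v → RootedTree.depth tree v ≡ dep (toℕ v) ∸ 1
      depth≡ v = climb-length (dep (toℕ v) ∸ 1) v (dep≡ v)

    height≤ : ∀ {b} → (∀ {v} → v < n → dep v ≤ suc b) → RootedTree.height tree ≤ b
    height≤ {b} low = foldr-preservesᵇ {P = _≤ b} ⊔-lub z≤n
      (map⁺ (universal (λ v → ≤-trans (≤-reflexive (depth≡ v)) (∸-monoˡ-≤ 1 (low (toℕ<n v)))) (allFin n)))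

    height> : ∀ {b v} → v < n → suc b < dep v → b < RootedTree.height tree
    height> {b} {v} v< lt = <-≤-trans (≤-trans (∸-monoˡ-≤ 1 lt) (≤-reflexive (sym (trans (depth≡ (fromℕ< v<)) (cong (λ z → dep z ∸ 1) (toℕ-fromℕ< v<))))))
      (lookup (foldr-forcesᵇ {P = _≤ RootedTree.height tree} (λ x y le → m⊔n≤o⇒m≤o x y le , m⊔n≤o⇒n≤o x y le) 0
        (map (RootedTree.depth tree) (allFin n)) ≤-refl) (∈-map⁺ (RootedTree.depth tree) (∈-allFin (fromℕ< v<))))

    height<n : RootedTree.height tree < n
    height<n = ≤-trans (s≤s (height≤ {n ∸ 1} λ v< → ≤-trans (F.dep≤n v< (T.visited v<)) (≤-reflexive (sym suc-n)))) (≤-reflexive suc-n)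
      where
        suc-n : suc (n ∸ 1) ≡ n
        suc-n = suc-pred n {{>-nonZero 1≤n}}

    -- When no vertex lies below level D, a common ancestor on level D of both ends of an edge must
    -- be an end itself, so every edge joins comparable vertices.
    isDFSTree : (∀ {v} → v < n → dep v ≤ D) → IsDFSTree G tree
    isDFSTree low = record
      { spanning = λ { (inj₁ s) → real s ; (inj₂ s) → swap⊎ (real s) }
      ; backEdges = λ {u} {v} a _ → back u v (T.edge (u , v , refl , refl , a))
      }
      where
        real : ∀ {u v} → Step u v → Graph.Adj G u v
        real {u} (ne , refl) = adjacent⇒Adj {G = G} (subst (AdjacentIn G (toℕ u)) (sym (toℕ-par u))
          (T.real (toℕ<n u) (≢root ne) (low (toℕ<n u))))

        ancestor : ∀ {x y} → Anc par x y → ∀ a v → toℕ a ≡ x → toℕ v ≡ y → Star Step v a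
        ancestor self a v refl e with refl ← toℕ-injective e = ε
        ancestor (up z p) a v e refl = (z ∘ (λ { refl → toℕ-root }) , refl) ◅ ancestor p a (up-par v) e (toℕ-par v)

        back : ∀ u v → Comparable par (toℕ u) (toℕ v) ⊎ (∃[ a ] dep a ≡ D × Anc par a (toℕ u) × Anc par a (toℕ v)) →
               Star Step v u ⊎ Star Step u v
        back u v (inj₁ (inj₁ p)) = inj₁ (ancestor p u v refl refl)
        back u v (inj₁ (inj₂ p)) = inj₂ (ancestor p v u refl refl)
        back u v (inj₂ (a , da , p , q))
          with F.anc-≡ (toℕ<n u) (T.visited (toℕ<n u)) p (≤-trans (low (toℕ<n u)) (≤-reflexive (sym da)))
        ... | refl = inj₁ (ancestor q u v refl refl)

-- Number of passes, total time and word size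

ceilDiv-≡ : ∀ q {h k} .{{_ : NonZero k}} → h ≤ q * k → (∀ {r} → q ≡ suc r → r * k < h) → ceilDiv h k ≡ q
ceilDiv-≡ zero {h} {suc k} h≤ _ rewrite n≤0⇒n≡0 h≤ = m<n⇒m/n≡0 (n<1+n k)
ceilDiv-≡ (suc r) {h} {suc k} h≤ low = begin
  (h + k) / suc k                       ≡⟨ cong (λ z → (z + k) / suc k) h≡ ⟨
  (suc (r * suc k + j) + k) / suc k     ≡⟨ cong (_/ suc k) shuffle ⟩
  (suc r * suc k + j) / suc k           ≡⟨ +-distrib-/-∣ˡ j (n∣m*n (suc r)) ⟩
  suc r * suc k / suc k + j / suc k     ≡⟨ cong₂ _+_ (m*n/n≡m (suc r) (suc k)) (m<n⇒m/n≡0 j<) ⟩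
  suc r + 0                             ≡⟨ +-identityʳ (suc r) ⟩
  suc r                                 ∎
  where
    open ≡-Reasoning
    j : ℕ
    j = h ∸ suc (r * suc k)
    h≡ : suc (r * suc k + j) ≡ h
    h≡ = m+[n∸m]≡n (low refl)
    j< : j < suc k
    j< = +-cancelˡ-≤ (r * suc k) (suc j) (suc k) (≤-trans (≤-reflexive (trans (+-suc (r * suc k) j) h≡))
           (≤-trans h≤ (≤-reflexive (+-comm (suc k) (r * suc k)))))
    shuffle : suc (r * suc k + j) + k ≡ suc r * suc k + j
    shuffle = cong suc (trans (+-comm (r * suc k + j) k) (sym (+-assoc k (r * suc k) j)))

-- Set-up and the last loop test cost at most `61 * N` and are charged to the passes, of which there
-- is at least one. The constant 3 per round is absorbed by `2 * N`; together this gives 63.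
total-time : ∀ {q m N M c} A B → 1 ≤ q → 2 ≤ N → N ≤ 2 * M → A ≤ c → 2 * (B + 63) ≤ c →
             60 * N + (q * (2 + (1 + (m * A + 0) + B * N)) + 2) ≤ q * (c * (m + M))
total-time {q} {m} {N} {M} {c} A B 1≤q 2≤N N≤ A≤ B≤ = begin
  60 * N + (q * (2 + (1 + (m * A + 0) + B * N)) + 2)
    ≤⟨ +-monoʳ-≤ (60 * N) (+-monoʳ-≤ (q * (2 + (1 + (m * A + 0) + B * N))) 2≤N) ⟩
  60 * N + (q * (2 + (1 + (m * A + 0) + B * N)) + N)
    ≡⟨ solve 2 (λ a b → con 60 :* a :+ (b :+ a) := a :* con 61 :+ b) refl N (q * (2 + (1 + (m * A + 0) + B * N))) ⟩
  N * 61 + q * (2 + (1 + (m * A + 0) + B * N))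
    ≤⟨ +-mono-≤ (m≤n*m (N * 61) q {{>-nonZero 1≤q}}) (*-monoʳ-≤ q inner) ⟩
  q * (N * 61) + q * (m * A + (B + 2) * N)
    ≡⟨ solve 5 (λ q m N A B → q :* (N :* con 61) :+ q :* (m :* A :+ (B :+ con 2) :* N)
                            := q :* (m :* A :+ (B :+ con 63) :* N)) refl q m N A B ⟩
  q * (m * A + (B + 63) * N)
    ≤⟨ *-monoʳ-≤ q (+-mono-≤ (*-monoʳ-≤ m A≤) (*-monoʳ-≤ (B + 63) N≤)) ⟩
  q * (m * c + (B + 63) * (2 * M))
    ≡⟨ solve 5 (λ q m c b M → q :* (m :* c :+ b :* (con 2 :* M)) := q :* (c :* m :+ con 2 :* b :* M)) refl q m c (B + 63) M ⟩
  q * (c * m + 2 * (B + 63) * M)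
    ≤⟨ *-monoʳ-≤ q (+-monoʳ-≤ (c * m) (*-monoˡ-≤ M B≤)) ⟩
  q * (c * m + c * M)
    ≡⟨ cong (q *_) (*-distribˡ-+ c m M) ⟨
  q * (c * (m + M)) ∎
  where
    open ≤-Reasoning
    open +-*-Solver
    inner : 2 + (1 + (m * A + 0) + B * N) ≤ m * A + (B + 2) * N
    inner = begin
      2 + (1 + (m * A + 0) + B * N) ≡⟨ solve 2 (λ a b → con 2 :+ (con 1 :+ (a :+ con 0) :+ b) := a :+ b :+ con 3) refl (m * A) (B * N) ⟩
      m * A + B * N + 3             ≤⟨ +-monoʳ-≤ (m * A + B * N) (≤-trans (n≤1+n 3) (*-monoʳ-≤ 2 2≤N)) ⟩
      m * A + B * N + 2 * N         ≡⟨ solve 3 (λ a b n → a :+ b :* n :+ con 2 :* n := a :+ (b :+ con 2) :* n) refl (m * A) B N ⟩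
      m * A + (B + 2) * N           ∎

cells≤2nk : ∀ n {k} → 1 ≤ k → n * suc k ≤ 2 * (n * k)
cells≤2nk n {k} 1≤k = begin
  n * (1 + k)  ≤⟨ *-monoʳ-≤ n (+-monoˡ-≤ k 1≤k) ⟩
  n * (k + k)  ≡⟨ *-distribˡ-+ n k k ⟩
  n * k + n * k ≡⟨ cong (n * k +_) (+-identityʳ (n * k)) ⟨
  2 * (n * k)  ∎
  where open ≤-Reasoning

-- From `1 ≤ k < n` follows `2 ≤ n`, so the factor 8 is at most the cube of n, and `suc k` is at
-- most n.
word-size : ∀ {n k} → 1 ≤ k → k < n → 8 * (n * suc k) ≤ n ^ 6
word-size {n} {k} 1≤k k<n = begin
  8 * (n * suc k)  ≤⟨ *-mono-≤ {8} {n ^ 3} (^-monoˡ-≤ 3 (≤-trans (s≤s 1≤k) k<n)) (*-monoʳ-≤ n k<n) ⟩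
  n ^ 3 * (n * n)  ≡⟨ cong (λ z → n ^ 3 * (n * z)) (*-identityʳ n) ⟨
  n ^ 3 * n ^ 2    ≡⟨ ^-distribˡ-+-* n 3 2 ⟨
  n ^ 5            ≤⟨ ^-monoʳ-≤ n {{>-nonZero (≤-<-trans z≤n k<n)}} (n≤1+n 5) ⟩
  n ^ 6            ∎
  where open ≤-Reasoning

-- Assembly for a connected graph

module Correctness {n : ℕ} .{{_ : NonZero n}} (G : Graph n) (connected : Graph.Connected G) {k : ℕ} .{{_ : NonZero k}}
  (streams : ℕ → List (Edge n)) (orders : ∀ i → EdgeOrder G (streams i)) where

  private
    1≤n : 1 ≤ n
    1≤n = >-nonZero⁻¹ n
    1≤k : 1 ≤ k
    1≤k = >-nonZero⁻¹ k

    root-path : ∀ {v} → v < n → Star (AdjacentIn G) v 0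
    root-path v< = subst₂ (Star (AdjacentIn G)) (toℕ-fromℕ< v<) (toℕ-fromℕ< 1≤n)
      (gmap toℕ (λ {u} {v} a → u , v , refl , refl , a) (connected (fromℕ< v<) (fromℕ< 1≤n)))

    module R = Run {n} {k} streams 1≤n 1≤k (AdjacentIn G) (adjacent-sym {G = G}) (adjacent-bound {G = G})
                   (λ q → order-sound {G = G} (orders q)) (λ q → order-complete {G = G} (orders q))
                   (Graph.size G) (λ q → order-length {G = G} (orders q)) root-path

    -- Kept opaque: the proof term contains the whole symbolic execution.
    abstract
      completed : Σ[ s ∈ State 27 ] R.Complete s
      completed = R.complete

  result : State 27
  result = proj₁ completed

  private
    module C = R.Complete (proj₂ completed)
    module T = Tree G 1≤n

  output : RootedTree n
  output = T.tree C.tree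

  run : Execution._,_⇓_ streams program (state (((λ _ _ → 0) [ IN , 0 ↦ n ]) [ IN , 1 ↦ k ]) 0 0 2 (n ⊔ k)) result
  run = C.run

  outputs : ∀ v → State.store result PAR (toℕ v) ≡ toℕ (RootedTree.parent output v)
  outputs = T.parent-agrees C.tree

  dfs : IsDFSTree G output
  dfs = T.isDFSTree C.tree C.final

  private
    h≤ : RootedTree.height output ≤ C.rounds * k
    h≤ = T.height≤ C.tree C.final

  -- The assumption on `k` enters in two ways: it gives `k < n`, which makes the word bound
  -- polynomial in n alone, and it forces at least one pass, to which the set-up time can be
  -- charged.
  bounds : ∀ {c} → 5000 ≤ c → k ≤ RootedTree.height output →
           Bounds c n (Graph.size G) k (RootedTree.height output) result
  bounds {c} 5000≤c k≤h = record
    { passBound = trans C.passes≡ (sym (ceilDiv-≡ C.rounds h≤ tall))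
    ; spaceBound = space
    ; wordBound = ≤-trans (R.Fits.word≤ C.fit) (≤-trans (word-size 1≤k (≤-<-trans k≤h (T.height<n C.tree)))
        (^-monoʳ-≤ n (≤-trans (≤ᵇ⇒≤ 6 5000 _) 5000≤c)))
    ; timeBound = time
    }
    where
      open ≤-Reasoning

      tall : ∀ {r} → C.rounds ≡ suc r → r * k < RootedTree.height output
      tall e with C.tall e
      ... | v , v< , lt = T.height> C.tree v< lt

      space : 27 * State.extent result ≤ c * (n * k)
      space = begin
        27 * State.extent result   ≤⟨ *-monoʳ-≤ 27 (R.Fits.extent≤ C.fit) ⟩
        27 * suc R.W               ≤⟨ *-monoʳ-≤ 27 (+-monoˡ-≤ R.W (≤-trans (s≤s z≤n) R.2≤cells)) ⟩
        27 * (9 * R.cells)         ≤⟨ *-monoʳ-≤ 27 (*-monoʳ-≤ 9 (cells≤2nk n 1≤k)) ⟩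
        27 * (9 * (2 * (n * k)))   ≡⟨ regroup 27 9 2 (n * k) ⟩
        27 * 9 * 2 * (n * k)       ≤⟨ *-monoˡ-≤ (n * k) (≤-trans (≤ᵇ⇒≤ 486 5000 _) 5000≤c) ⟩
        c * (n * k)                ∎
        where
          regroup : ∀ a b d x → a * (b * (d * x)) ≡ a * b * d * x
          regroup a b d x = trans (sym (*-assoc a b (d * x))) (sym (*-assoc (a * b) d x))

      1≤rounds : 1 ≤ C.rounds
      1≤rounds = n≢0⇒n>0 λ e → contradiction (≤-trans (≤-trans 1≤k k≤h) (≤-trans h≤ (≤-reflexive (cong (_* k) e)))) λ ()

      time : State.time result ≤ State.passes result * (c * (Graph.size G + n * k))
      time = begin
        State.time result
          ≤⟨ C.time≤ ⟩
        60 * R.cells + (C.rounds * (2 + R.roundTime) + 2)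
          ≡⟨ cong (λ z → 60 * R.cells + (C.rounds * (2 + z) + 2)) R.roundTime≡ ⟩
        60 * R.cells + (C.rounds * (2 + (1 + (Graph.size G * (2 + R.edgeTime) + 0) + 1100 * R.cells)) + 2)
          ≤⟨ total-time {m = Graph.size G} (2 + R.edgeTime) 1100 1≤rounds R.2≤cells (cells≤2nk n 1≤k)
               (≤-trans (≤ᵇ⇒≤ (2 + R.edgeTime) 5000 _) 5000≤c) (≤-trans (≤ᵇ⇒≤ (2 * (1100 + 63)) 5000 _) 5000≤c) ⟩
        C.rounds * (c * (Graph.size G + n * k))
          ≡⟨ cong (_* (c * (Graph.size G + n * k))) C.passes≡ ⟨
        State.passes result * (c * (Graph.size G + n * k)) ∎

theorem1p2 : Σ[ A ∈ Algorithm ] Σ[ c ∈ ℕ ]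
    (∀ (n : ℕ) .{{_ : NonZero n}} (G : Graph n) → Graph.Connected G →
    ∀ (k : ℕ) .{{_ : NonZero k}} (streams : ℕ → List (Edge n)) →
    (∀ i → EdgeOrder G (streams i)) →
    Σ[ s ∈ State (Algorithm.arrays A) ] Σ[ T ∈ RootedTree n ]
    Algorithm.Run A k streams s × Algorithm.Outputs A s T ×
    IsDFSTree G T ×
    (k ≤ RootedTree.height T →
    Bounds c n (Graph.size G) k (RootedTree.height T) s))
-- The largest demand on the constant is the cost 4102 per edge read, `2 + edgeTime`; the others are
-- 2326 from the rest of the time bound, 486 from the space and the exponent 6.
theorem1p2 = record { extraArrays = 25 ; program = program } , 5000 ,
  λ n G connected k streams orders → let open Correctness G connected {k} streams orders in
    result , output , run , outputs , dfs , bounds ≤-refl
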